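{- Let $p$ be an odd prime and $n$ an odd positive integer. For each $0\le k\le p-1$ let $c_k\in\mathbb{F}_p^*$ and let $r_k,t_k$ be nonnegative integers with $\gcd(n,r_k+t_k)=\gcd(n,r_k-t_k)=\gcd(n,p)=1$, and let $g_k(x)=c_k\mathrm{Tr}_n(x^{p^{r_k}+1}-x^{p^{t_k}+1})$ (a near-bent function from $\mathbb{F}_{p^n}$ to $\mathbb{F}_p$). Let $b_0,\ldots,b_{p-1}\in\mathbb{F}_{p^n}$ be such that the functions $f_k(x)=g_k(x)+\mathrm{Tr}_n(b_kx)$ satisfy $supp(\widehat{f_i})\cap supp(\widehat{f_j})=\emptyset$ for $i\ne j$. Then the bent function $F:\mathbb{F}_{p^n}\times\mathbb{F}_p\to\mathbb{F}_p$, \[ F(x,y)=(p-1)\sum_{k=0}^{p-1}\Big(\prod_{j\neq k}(y-j)\Big)f_k(x), \] is weakly regular.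
   Context: $\mathrm{Tr}_n$ is the absolute trace, $\epsilon_p=e^{2\pi i/p}$, $\widehat{f}(b)=\sum_{x\in\mathbb{F}_{p^n}}\epsilon_p^{f(x)-\mathrm{Tr}_n(bx)}$, $supp(\widehat f)=\{b:\widehat f(b)\ne0\}$. For $F:\mathbb{F}_{p^n}\times\mathbb{F}_p\to\mathbb{F}_p$, $\widehat F(a,b)=\sum_{x,y}\epsilon_p^{F(x,y)-\mathrm{Tr}_n(ax)-by}$; $F$ is bent if $|\widehat F(a,b)|^2=p^{n+1}$ for all $(a,b)$, and a bent $F$ is weakly regular if there exist a complex $\zeta$ with $|\zeta|=1$ and a function $F^*:\mathbb{F}_{p^n}\times\mathbb{F}_p\to\mathbb{F}_p$ with $p^{ -(n+1)/2}\widehat F(a,b)=\zeta\,\epsilon_p^{F^*(a,b)}$ for all $(a,b)$. -}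

module Defs where

open import Level using (0ℓ)
open import Data.Nat as ℕ using (ℕ; zero; suc; NonZero; _%_; _∸_)
open import Data.Nat.DivMod using (m%n<n)
open import Data.Integer as ℤ using (ℤ; +_)
open import Data.Fin as Fin using (Fin; toℕ; fromℕ<)
open import Data.List using (List; []; _∷_; length; filter; map; foldr; upTo; allFin; concatMap)
open import Data.List.Membership.Propositional using (_∈_)
open import Data.List.Relation.Unary.Unique.Propositional using (Unique)
open import Data.Product using (Σ; ∃; _×_; _,_; proj₁; proj₂)
open import Relation.Binary.PropositionalEquality using (_≡_)
open import Relation.Binary.Definitions using (DecidableEquality)
open import Relation.Nullary using (¬_; Dec; yes; no; ¬?)
open import Algebra.Structures using (IsCommutativeRing)

record FiniteField (p n : ℕ) : Set₁ where
  infixl 6 _+_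
  infixl 7 _*_
  field
    K     : Set
    _+_   : K → K → K
    _*_   : K → K → K
    -_    : K → K
    0#    : K
    1#    : K
    isCommutativeRing : IsCommutativeRing _≡_ _+_ _*_ -_ 0# 1#
    _⁻¹   : K → K
    inverse : ∀ x → ¬ (x ≡ 0#) → x * (x ⁻¹) ≡ 1#
    0≢1   : ¬ (0# ≡ 1#)
    _≟_   : DecidableEquality K
    elems : List K
    complete : ∀ x → x ∈ elems
    unique   : Unique elems
    size     : length elems ≡ p ℕ.^ n

-- Z[ε_p] represented as Z[C_p] = (Fin p → ℤ), where u represents
-- Σ_j u(j) ε_p^j.  Since 1 + ε + … + ε^{p-1} = 0 is the only relation
-- (p prime), u = v in Z[ε_p] iff u - v is a constant vector.

Cyc : ℕ → Set
Cyc p = Fin p → ℤ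

module Cyclotomic (p : ℕ) {{_ : NonZero p}} where

  modp : ℕ → Fin p
  modp m = fromℕ< (m%n<n m p)

  _⊖_ : Fin p → Fin p → Fin p
  i ⊖ j = modp (toℕ i ℕ.+ (p ∸ toℕ j))

  negF : Fin p → Fin p
  negF j = modp (p ∸ toℕ j)

  _≈ᶜ_ : Cyc p → Cyc p → Set
  u ≈ᶜ v = Σ ℤ λ c → ∀ j → u j ≡ v j ℤ.+ c

  zeroᶜ : Cyc p
  zeroᶜ _ = + 0

  εpow : Fin p → Cyc p
  εpow s j with s Fin.≟ j
  ... | yes _ = + 1
  ... | no  _ = + 0

  intᶜ : ℕ → Cyc p
  intᶜ m j with j Fin.≟ modp 0
  ... | yes _ = + m
  ... | no  _ = + 0

  _⊛_ : Cyc p → Cyc p → Cyc p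
  (u ⊛ v) j = foldr (λ i acc → u i ℤ.* v (j ⊖ i) ℤ.+ acc) (+ 0) (allFin p)

  conj : Cyc p → Cyc p
  conj u j = u (negF j)

module FF {p n : ℕ} (𝔽 : FiniteField p n) {{_ : NonZero p}} where
  open FiniteField 𝔽
  open Cyclotomic p

  infixl 6 _-_
  _-_ : K → K → K
  x - y = x + (- y)

  pow : K → ℕ → K
  pow x zero    = 1#
  pow x (suc m) = x * pow x m

  sumK : List K → K
  sumK = foldr _+_ 0#

  prodK : List K → K
  prodK = foldr _*_ 1#

  ιℕ : ℕ → K
  ιℕ zero    = 0#
  ιℕ (suc m) = 1# + ιℕ m

  ι : Fin p → K
  ι j = ιℕ (toℕ j)

  Tr : K → K
  Tr x = sumK (map (λ i → pow x (p ℕ.^ i)) (upTo n))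

  count : {A : Set} → (A → K) → List A → Fin p → ℤ
  count h xs j = + length (filter (λ x → h x ≟ ι j) xs)

  -- Walsh transform of f : F_{p^n} → F_p (values taken in the prime field
  -- inside K):  f̂(b) = Σ_x ε_p^{f(x) - Tr(bx)}
  walsh : (K → K) → K → Cyc p
  walsh f b = count (λ x → f x - Tr (b * x)) elems

  InSupp : (K → K) → K → Set
  InSupp f b = ¬ (walsh f b ≈ᶜ zeroᶜ)

  pairs : List (K × Fin p)
  pairs = concatMap (λ x → map (λ y → x , y) (allFin p)) elems

  walsh₂ : (K → Fin p → K) → K → Fin p → Cyc p
  walsh₂ F a b = count (λ xy → F (proj₁ xy) (proj₂ xy) - Tr (a * proj₁ xy)
                                 - ι b * ι (proj₂ xy)) pairs

  Bent : (K → Fin p → K) → Set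
  Bent F = ∀ a b → (walsh₂ F a b ⊛ conj (walsh₂ F a b)) ≈ᶜ intᶜ (p ℕ.^ suc n)

  -- weakly regular: bent, and there is F* : F_{p^n} × F_p → F_p such that
  -- F̂(a,b) ε_p^{-F*(a,b)} is independent of (a,b)
  -- (equivalently p^{-(n+1)/2} F̂(a,b) = ζ ε_p^{F*(a,b)} with |ζ| = 1).
  WeaklyRegular : (K → Fin p → K) → Set
  WeaklyRegular F = Bent F × Σ (K → Fin p → Fin p) λ F* →
    ∀ a b → (walsh₂ F a b ⊛ εpow (negF (F* a b)))
             ≈ᶜ (walsh₂ F 0# (modp 0) ⊛ εpow (negF (F* 0# (modp 0))))

  gfun : Fin p → ℕ → ℕ → K → K
  gfun c r t x = ι c * Tr (pow x (p ℕ.^ r ℕ.+ 1) - pow x (p ℕ.^ t ℕ.+ 1))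

  ffun : Fin p → ℕ → ℕ → K → K → K
  ffun c r t b x = gfun c r t x + Tr (b * x)

  Fgen : (Fin p → K → K) → K → Fin p → K
  Fgen f x y = ιℕ (p ∸ 1) * sumK (map (λ k →
      prodK (map (λ j → ι y - ι j) (filter (λ j → ¬? (j Fin.≟ k)) (allFin p)))
        * f k x) (allFin p))

{-# OPTIONS --safe #-}
module Submission where

-- Write φ i x = x^(p^i), V d for the fixed field of φ d, and Q for one of the quadratic forms
-- c Tr(x^(p^r+1) − x^(p^t+1)).  Its polar form is c Tr(x L z) with φ r ∘ L = (φ (r+t) − 1)(φ (r−t) − 1),
-- so the coprimality conditions make F_p = V 1 the radical.  Completing the square, the Walsh transform
-- of g + Tr(b x) at a vanishes when Tr a ≠ Tr b, and otherwise is a p-th root of unity times the Gauss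
-- sum G of Q.  Disjoint supports thus say that the traces of the b_k are distinct, exactly one f_k
-- contributes to each Walsh coefficient of F, and all that remains is that G is ± p^((n+1)/2) with a
-- sign that depends neither on c, nor on r, nor on t.
--
-- The sign is found by counting N d y = #{x ∈ V d : Q x = y} for d ∣ n.  Since N d is constant on square
-- classes, its second moment gives a² + p D² = 4 p^(d+1) with D = N d ν − N d 1 for a nonsquare ν.  As d
-- is odd, descent reduces this to a′² + p D′² = 4.  For a prime ℓ the map φ d has orbits of length
-- ℓ on V (ℓ d) outside V d, so N (ℓ d) ≡ N d modulo ℓ.  Starting from d = 1, where Q = 0, induction along
-- a prime factorisation of n then gives D = 0 and N d 0 − N d 1 = ± p^((d+1)/2), and the odd prime
-- ℓ ≠ p determines the sign at ℓ d from the one at d.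

open import Defs
open import Level using (0ℓ)
open import Algebra.Bundles using (CommutativeRing)
open import Algebra.Structures using (IsCommutativeMonoid)
open import Algebra.Solver.Ring.AlmostCommutativeRing using (AlmostCommutativeRing; fromCommutativeRing; _-Raw-AlmostCommutative⟶_)
import Algebra.Solver.Ring as RingSolver
import Algebra.Properties.CommutativeSemiring.Binomial as Binomial
import Algebra.Properties.Semiring.Exp as Exp
import Algebra.Properties.Semiring.Mult as Mult
import Algebra.Properties.Semiring.Sum as SemiringSum
import Algebra.Properties.Ring as RingProperties
open import Data.Empty using (⊥)
open import Data.Fin as Fin using (Fin; toℕ; fromℕ<; fromℕ; inject₁)
import Data.Fin.Properties as Finₚ
open import Data.Integer as ℤ using (ℤ; +_; -[1+_])
import Data.Integer.Divisibility.Signed as ℤ∣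
import Data.Integer.Properties as ℤₚ
import Data.Integer.Tactic.RingSolver as ℤSolver
open import Data.List using (List; []; _∷_; [_]; _++_; _∷ʳ_; length; filter; map; foldr; concatMap; allFin; upTo; lookup)
import Data.List.Properties as Listₚ
open import Data.List.Membership.Propositional using (_∈_; find; lose)
open import Data.List.Membership.Propositional.Properties using (∈-allFin)
open import Data.List.Relation.Unary.All as All using (All; []; _∷_)
import Data.List.Relation.Unary.All.Properties as Allₚ
open import Data.List.Relation.Unary.AllPairs using ([]; _∷_)
open import Data.List.Relation.Unary.Any as Any using (any?; here; there)
open import Data.List.Relation.Unary.Any.Properties using (lookup-index)
open import Data.List.Relation.Unary.Unique.Propositional using (Unique)
import Data.List.Relation.Unary.Unique.Propositional.Properties as Uniqueₚ
open import Data.Maybe using (Maybe; just; nothing)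
open import Data.Nat as ℕ using (ℕ; zero; suc; z≤n; s≤s; NonZero; _∸_; _!; _%_; _/_; ∣_-_∣)
open import Data.Nat.Combinatorics using (nCk≡n!/k![n-k]!; nCn≡1; k![n∸k]!∣n!) renaming (_C_ to _Choose_)
open import Data.Nat.DivMod using (m≡m%n+[m/n]*n; m/n*n≡m; m%n<n; m%n≤m)
open import Data.Nat.Divisibility using (_∣_; divides; ∣⇒≤; ∣-refl; ∣-reflexive; ∣-trans; _∣?_; m∣m*n; n∣m*n; >⇒∤)
open import Data.Nat.GCD using (gcd; GCD; gcd-GCD; gcd-greatest; gcd[m,n]∣m; gcd[m,n]∣n; module Bézout)
open import Data.Nat.ListAction using (product)
open import Data.Nat.Primality using (Prime; euclidsLemma; prime⇒nonZero; prime⇒nonTrivial; prime⇒irreducible)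
open import Data.Nat.Primality.Factorisation using (factorise; PrimeFactorisation)
import Data.Nat.Properties as ℕₚ
open import Data.Product using (_,_; _×_; proj₁; proj₂; ∃; ∃₂)
open import Data.Sum using (_⊎_; inj₁; inj₂)
open import Function using (_∘_; id)
open import Relation.Binary.Definitions using (DecidableEquality; tri<; tri≈; tri>)
open import Relation.Binary.PropositionalEquality using (_≡_; _≢_; refl; sym; trans; cong; cong₂; subst; module ≡-Reasoning)
open import Relation.Nullary using (¬_; Dec; yes; no; contradiction; ¬?)
open import Relation.Nullary.Decidable using (_×-dec_)
open import Relation.Unary using (Pred; Decidable)

-- No complex number occurs. A Walsh coefficient is the vector of its level counts, and "G times a
-- root of unity" means a constant vector with one entry raised by the integer G = N n 0 - N n 1;
-- character sums vanish because some translation makes all levels equally large. The second moment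
-- leaves two gaps. For p = 3 the equation a′² + p D′² = 4 also has the solutions a′ = ±1, D′ = ±1,
-- and even when D = 0 a second moment cannot see the sign of G. The congruence modulo ℓ closes
-- both, and this is why all subfields V d are treated and not K alone. At d = 1 the difference N d
-- 0 - N d 1 is p for every form, a common start from which the signs are compared without ever
-- being computed. The condition gcd(n, p) = 1 acts twice: it keeps every prime ℓ ∣ n different from
-- p, and it makes n = Tr 1 invertible modulo p. The absolute trace of K can therefore serve on
-- every V d, and the radical of Q restricted to V d is F_p for every d ∣ n.

record Finite (A : Set) : Set where
  field
    _≟_      : DecidableEquality A
    elements : List A
    complete : ∀ x → x ∈ elements
    unique   : Unique elements

Fin-finite : ∀ m → Finite (Fin m)
Fin-finite m = record
  { _≟_ = Fin._≟_ ; elements = allFin m ; complete = ∈-allFin ; unique = Uniqueₚ.allFin⁺ m }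

-- Finite sums and products over a commutative monoid.

module BigOp {C : Set} {_∙_ : C → C → C} {ε : C}
             (isCM : IsCommutativeMonoid _≡_ _∙_ ε) where
  open IsCommutativeMonoid isCM using (assoc; comm; identityˡ; identityʳ)
  open ≡-Reasoning

  -- An Iverson bracket for any monoid: additively it yields the indicator `ind`, multiplicatively
  -- it replaces an unwanted factor by 1.
  when : {P : Set} → Dec P → C → C
  when (yes _) c = c
  when (no  _) c = ε

  when-yes : {P : Set} (d : Dec P) {c : C} → P → when d c ≡ c
  when-yes (yes _) _ = refl
  when-yes (no ¬p) p = contradiction p ¬p

  when-no : {P : Set} (d : Dec P) {c : C} → ¬ P → when d c ≡ ε
  when-no (yes p) ¬p = contradiction p ¬p
  when-no (no _)  _  = refl

  when-⇔ : {P Q : Set} (d : Dec P) (e : Dec Q) {c : C} → (P → Q) → (Q → P) → when d c ≡ when e c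
  when-⇔ (yes p) e f g = sym (when-yes e (f p))
  when-⇔ (no ¬p) e f g = sym (when-no e (¬p ∘ g))

  ∑ : {A : Set} → List A → (A → C) → C
  ∑ []       f = ε
  ∑ (x ∷ xs) f = f x ∙ ∑ xs f

  foldr≡∑ : {A : Set} (xs : List A) (f : A → C) → foldr (λ x acc → f x ∙ acc) ε xs ≡ ∑ xs f
  foldr≡∑ []       f = refl
  foldr≡∑ (x ∷ xs) f = cong (f x ∙_) (foldr≡∑ xs f)

  ∑-cong : {A : Set} (xs : List A) {f g : A → C} → (∀ x → f x ≡ g x) → ∑ xs f ≡ ∑ xs g
  ∑-cong []       f≗g = refl
  ∑-cong (x ∷ xs) f≗g = cong₂ _∙_ (f≗g x) (∑-cong xs f≗g)

  ∑-ε : {A : Set} (xs : List A) → ∑ xs (λ _ → ε) ≡ ε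
  ∑-ε []       = refl
  ∑-ε (x ∷ xs) = trans (identityˡ _) (∑-ε xs)

  interchange : ∀ a b c d → (a ∙ b) ∙ (c ∙ d) ≡ (a ∙ c) ∙ (b ∙ d)
  interchange a b c d = begin
    (a ∙ b) ∙ (c ∙ d) ≡⟨ assoc a b (c ∙ d) ⟩
    a ∙ (b ∙ (c ∙ d)) ≡⟨ cong (a ∙_) (sym (assoc b c d)) ⟩
    a ∙ ((b ∙ c) ∙ d) ≡⟨ cong (λ z → a ∙ (z ∙ d)) (comm b c) ⟩
    a ∙ ((c ∙ b) ∙ d) ≡⟨ cong (a ∙_) (assoc c b d) ⟩
    a ∙ (c ∙ (b ∙ d)) ≡⟨ sym (assoc a c (b ∙ d)) ⟩
    (a ∙ c) ∙ (b ∙ d) ∎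

  ∑-∙ : {A : Set} (xs : List A) (f g : A → C) → ∑ xs (λ x → f x ∙ g x) ≡ ∑ xs f ∙ ∑ xs g
  ∑-∙ []       f g = sym (identityˡ ε)
  ∑-∙ (x ∷ xs) f g = trans (cong ((f x ∙ g x) ∙_) (∑-∙ xs f g)) (interchange _ _ _ _)

  ∑-swap : {A B : Set} (xs : List A) (ys : List B) (f : A → B → C) →
           ∑ xs (λ x → ∑ ys (f x)) ≡ ∑ ys (λ y → ∑ xs (λ x → f x y))
  ∑-swap []       ys f = sym (∑-ε ys)
  ∑-swap (x ∷ xs) ys f =
    trans (cong (∑ ys (f x) ∙_) (∑-swap xs ys f)) (sym (∑-∙ ys (f x) (λ y → ∑ xs (λ x → f x y))))

  module _ {A : Set} (F : Finite A) where
    open Finite F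

    ∑-delta : ∀ a (f : A → C) → ∑ elements (λ x → when (x ≟ a) (f x)) ≡ f a
    ∑-delta a f = go elements unique (complete a)
      where
      absent : ∀ xs → All.All (λ x → ¬ x ≡ a) xs → ∑ xs (λ x → when (x ≟ a) (f x)) ≡ ε
      absent []       []         = refl
      absent (x ∷ xs) (x≢a ∷ ps) =
        trans (cong₂ _∙_ (when-no (x ≟ a) x≢a) (absent xs ps)) (identityˡ ε)
      go : ∀ xs → Unique xs → a ∈ xs → ∑ xs (λ x → when (x ≟ a) (f x)) ≡ f a
      go (x ∷ xs) (x∉ ∷ _) (here refl) =
        trans (cong₂ _∙_ (when-yes (x ≟ x) refl) (absent xs (All.map (λ ¬p q → ¬p (sym q)) x∉)))
              (identityʳ (f x))
      go (x ∷ xs) (x∉ ∷ u) (there a∈) =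
        trans (cong₂ _∙_ (when-no (x ≟ a) (All.lookup x∉ a∈)) (go xs u a∈)) (identityˡ (f a))

  -- Inserting a delta sum turns the change of variables into an exchange of two summations, so no
  -- permutation of lists has to be constructed.
  ∑-reindex : {A B : Set} (F : Finite A) (G : Finite B) (to : A → B) (from : B → A) →
              (∀ y → to (from y) ≡ y) → (∀ x → from (to x) ≡ x) → (f : B → C) →
              ∑ (Finite.elements F) (f ∘ to) ≡ ∑ (Finite.elements G) f
  ∑-reindex F G to from to-from from-to f = begin
    ∑ xs (f ∘ to)
      ≡⟨ ∑-cong xs (λ x → sym (∑-delta G (to x) f)) ⟩
    ∑ xs (λ x → ∑ ys (λ y → when (y G.≟ to x) (f y)))
      ≡⟨ ∑-swap xs ys _ ⟩
    ∑ ys (λ y → ∑ xs (λ x → when (y G.≟ to x) (f y)))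
      ≡⟨ ∑-cong ys (λ y → ∑-cong xs (λ x → when-⇔ (y G.≟ to x) (x F.≟ from y)
           (λ { refl → sym (from-to x) }) (λ { refl → sym (to-from y) }))) ⟩
    ∑ ys (λ y → ∑ xs (λ x → when (x F.≟ from y) (f y)))
      ≡⟨ ∑-cong ys (λ y → ∑-delta F (from y) (λ _ → f y)) ⟩
    ∑ ys f ∎
    where
    module F = Finite F
    module G = Finite G
    xs = F.elements
    ys = G.elements

open BigOp ℤₚ.+-0-isCommutativeMonoid

ind : {P : Set} → Dec P → ℤ
ind d = when d (+ 1)

when≡ind* : {P : Set} (d : Dec P) (z : ℤ) → when d z ≡ ind d ℤ.* z
when≡ind* (yes _) z = sym (ℤₚ.*-identityˡ z)
when≡ind* (no _)  z = refl

ind≥0 : {P : Set} (d : Dec P) → + 0 ℤ.≤ ind d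
ind≥0 (yes _) = ℤ.+≤+ z≤n
ind≥0 (no _)  = ℤ.+≤+ z≤n

∑-*ˡ : {A : Set} (xs : List A) (k : ℤ) (f : A → ℤ) → ∑ xs (λ x → k ℤ.* f x) ≡ k ℤ.* ∑ xs f
∑-*ˡ []       k f = sym (ℤₚ.*-zeroʳ k)
∑-*ˡ (x ∷ xs) k f = trans (cong (λ z → k ℤ.* f x ℤ.+ z) (∑-*ˡ xs k f)) (sym (ℤₚ.*-distribˡ-+ k (f x) _))

∑-*ʳ : {A : Set} (xs : List A) (k : ℤ) (f : A → ℤ) → ∑ xs (λ x → f x ℤ.* k) ≡ ∑ xs f ℤ.* k
∑-*ʳ xs k f = trans (∑-cong xs (λ x → ℤₚ.*-comm (f x) k)) (trans (∑-*ˡ xs k f) (ℤₚ.*-comm k _))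

∑-const : {A : Set} (xs : List A) (k : ℤ) → ∑ xs (λ _ → k) ≡ + length xs ℤ.* k
∑-const []       k = sym (ℤₚ.*-zeroˡ k)
∑-const (x ∷ xs) k = trans (cong (λ z → k ℤ.+ z) (∑-const xs k)) (sym (ℤₚ.suc-* (+ length xs) k))

∑-neg : {A : Set} (xs : List A) (f : A → ℤ) → ∑ xs (λ x → ℤ.- f x) ≡ ℤ.- ∑ xs f
∑-neg []       f = refl
∑-neg (x ∷ xs) f = trans (cong (λ z → ℤ.- f x ℤ.+ z) (∑-neg xs f)) (sym (ℤₚ.neg-distrib-+ (f x) (∑ xs f)))

∑-sub : {A : Set} (xs : List A) (f g : A → ℤ) → ∑ xs (λ x → f x ℤ.- g x) ≡ ∑ xs f ℤ.- ∑ xs g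
∑-sub xs f g = trans (∑-∙ xs f (λ x → ℤ.- g x)) (cong (λ z → ∑ xs f ℤ.+ z) (∑-neg xs g))

∑-mono : {A : Set} (xs : List A) {f g : A → ℤ} → (∀ x → f x ℤ.≤ g x) → ∑ xs f ℤ.≤ ∑ xs g
∑-mono []       f≤g = ℤₚ.≤-refl
∑-mono (x ∷ xs) f≤g = ℤₚ.+-mono-≤ (f≤g x) (∑-mono xs f≤g)

∑≥0 : {A : Set} (xs : List A) {f : A → ℤ} → (∀ x → + 0 ℤ.≤ f x) → + 0 ℤ.≤ ∑ xs f
∑≥0 []       f≥0 = ℤₚ.≤-refl
∑≥0 (x ∷ xs) f≥0 = ℤₚ.+-mono-≤ (f≥0 x) (∑≥0 xs f≥0)

nonneg-sum-zero : ∀ a b → + 0 ℤ.≤ a → + 0 ℤ.≤ b → a ℤ.+ b ≡ + 0 → a ≡ + 0 × b ≡ + 0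
nonneg-sum-zero (+ zero)  (+ zero)  _ _ _ = refl , refl
nonneg-sum-zero (+ zero)  (+ suc b) _ _ ()
nonneg-sum-zero (+ suc a) (+ b)     _ _ ()

-- The source of all equality cases below: a pointwise bound whose two sides have the same total is
-- an equality at every point.
∑≡0⇒each≡0 : {A : Set} (xs : List A) {f : A → ℤ} → (∀ x → + 0 ℤ.≤ f x) → ∑ xs f ≡ + 0 →
             ∀ {x} → x ∈ xs → f x ≡ + 0
∑≡0⇒each≡0 (y ∷ xs) {f} f≥0 eq x∈ with nonneg-sum-zero (f y) (∑ xs f) (f≥0 y) (∑≥0 xs f≥0) eq | x∈
... | fy , _ | here refl = fy
... | _ , s  | there x∈′ = ∑≡0⇒each≡0 xs f≥0 s x∈′

∑-ind-filter : {A : Set} {P : Pred A 0ℓ} (P? : Decidable P) (xs : List A) →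
               + length (filter P? xs) ≡ ∑ xs (λ x → ind (P? x))
∑-ind-filter P? []       = refl
∑-ind-filter P? (x ∷ xs) with P? x
... | yes _ = cong (λ z → + 1 ℤ.+ z) (∑-ind-filter P? xs)
... | no _  = trans (∑-ind-filter P? xs) (sym (ℤₚ.+-identityˡ _))

∑-++ : {A : Set} (xs ys : List A) (f : A → ℤ) → ∑ (xs ++ ys) f ≡ ∑ xs f ℤ.+ ∑ ys f
∑-++ []       ys f = sym (ℤₚ.+-identityˡ _)
∑-++ (x ∷ xs) ys f = trans (cong (λ z → f x ℤ.+ z) (∑-++ xs ys f)) (sym (ℤₚ.+-assoc (f x) _ _))

∑-map : {A B : Set} (h : A → B) (xs : List A) (f : B → ℤ) → ∑ (map h xs) f ≡ ∑ xs (f ∘ h)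
∑-map h []       f = refl
∑-map h (x ∷ xs) f = cong (λ z → f (h x) ℤ.+ z) (∑-map h xs f)

∑-pairs : {A B : Set} (xs : List A) (ys : List B) (f : A × B → ℤ) →
          ∑ (concatMap (λ x → map (x ,_) ys) xs) f ≡ ∑ xs (λ x → ∑ ys (λ y → f (x , y)))
∑-pairs []       ys f = refl
∑-pairs (x ∷ xs) ys f = trans (∑-++ (map (x ,_) ys) _ f) (cong₂ ℤ._+_ (∑-map (x ,_) ys f) (∑-pairs xs ys f))

module _ {A : Set} (F : Finite A) where
  open Finite F

  ∑-ind : ∀ a (f : A → ℤ) → ∑ elements (λ x → ind (x ≟ a) ℤ.* f x) ≡ f a
  ∑-ind a f = trans (∑-cong elements (λ x → sym (when≡ind* (x ≟ a) (f x)))) (∑-delta F a f)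

  ∑-permute : (to from : A → A) → (∀ y → to (from y) ≡ y) → (∀ x → from (to x) ≡ x) →
              (f : A → ℤ) → ∑ elements (f ∘ to) ≡ ∑ elements f
  ∑-permute = ∑-reindex F F

prime∤! : ∀ {p} → Prime p → ∀ m → m ℕ.< p → ¬ (p ∣ m !)
prime∤! pr zero    _   p∣1 = ℕₚ.<⇒≱ (ℕ.nonTrivial⇒n>1 _ {{prime⇒nonTrivial pr}}) (∣⇒≤ p∣1)
prime∤! pr (suc m) m<p p∣m! with euclidsLemma (suc m) (m !) pr p∣m!
... | inj₁ p∣1+m = ℕₚ.<⇒≱ m<p (∣⇒≤ p∣1+m)
... | inj₂ p∣m   = prime∤! pr m (ℕₚ.<-trans (ℕₚ.n<1+n m) m<p) p∣m

-- The product of the binomial coefficient with k! (p - k)! is p!, and p divides neither of these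
-- two factorials.
prime∣binomial : ∀ {p} → Prime p → ∀ k → 0 ℕ.< k → k ℕ.< p → p ∣ p Choose k
prime∣binomial {p@(suc p-1)} pr k 0<k k<p
  with euclidsLemma (p Choose k) (k ! ℕ.* (p ∸ k) !) pr
         (subst (p ∣_) (sym C*≡!) (m∣m*n (p-1 !)))
  where
  instance _ = k ℕₚ.!* (p ∸ k) !≢0
  C*≡! : (p Choose k) ℕ.* (k ! ℕ.* (p ∸ k) !) ≡ p !
  C*≡! = trans (cong (ℕ._* (k ! ℕ.* (p ∸ k) !)) (nCk≡n!/k![n-k]! (ℕₚ.<⇒≤ k<p)))
               (m/n*n≡m (k![n∸k]!∣n! (ℕₚ.<⇒≤ k<p)))
... | inj₁ p∣C = p∣C
... | inj₂ p∣!! with euclidsLemma (k !) ((p ∸ k) !) pr p∣!!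
...   | inj₁ p∣k! = contradiction p∣k! (prime∤! pr k k<p)
...   | inj₂ p∣r! = contradiction p∣r! (prime∤! pr (p ∸ k) (ℕₚ.∸-monoʳ-< 0<k (ℕₚ.<⇒≤ k<p)))

-- Characteristic and Frobenius maps of a field with p^n elements.

module FieldTheory {p n : ℕ} {{p≢0 : NonZero p}} (pr : Prime p) (𝔽 : FiniteField p n) where
  open FiniteField 𝔽 public
  open FF 𝔽 public
  open ≡-Reasoning

  K-finite : Finite K
  K-finite = record { _≟_ = _≟_ ; elements = elems ; complete = complete ; unique = unique }

  commutativeRing : CommutativeRing 0ℓ 0ℓ
  commutativeRing = record { isCommutativeRing = isCommutativeRing }

  module R = CommutativeRing commutativeRing
  open R public using (+-assoc; +-comm; +-identityˡ; +-identityʳ; *-assoc; *-comm; *-identityˡ; *-identityʳ;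
    -‿inverseˡ; -‿inverseʳ; zeroˡ; zeroʳ; distribˡ; distribʳ)
  private
    module RP = RingProperties R.ring
    module E = Exp R.semiring
    module M = Mult R.semiring
    module SS = SemiringSum R.semiring
    module B = Binomial R.commutativeSemiring

  ιℕ-+ : ∀ a b → ιℕ (a ℕ.+ b) ≡ ιℕ a + ιℕ b
  ιℕ-+ zero    b = sym (+-identityˡ _)
  ιℕ-+ (suc a) b = trans (cong (λ z → 1# + z) (ιℕ-+ a b)) (sym (+-assoc 1# (ιℕ a) (ιℕ b)))

  ιℕ-* : ∀ a b → ιℕ (a ℕ.* b) ≡ ιℕ a * ιℕ b
  ιℕ-* zero    b = sym (zeroˡ _)
  ιℕ-* (suc a) b = begin
    ιℕ (b ℕ.+ a ℕ.* b)        ≡⟨ ιℕ-+ b (a ℕ.* b) ⟩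
    ιℕ b + ιℕ (a ℕ.* b)       ≡⟨ cong₂ _+_ (sym (*-identityˡ _)) (ιℕ-* a b) ⟩
    1# * ιℕ b + ιℕ a * ιℕ b   ≡⟨ sym (distribʳ (ιℕ b) 1# (ιℕ a)) ⟩
    (1# + ιℕ a) * ιℕ b        ∎

  private
    ⟦_⟧ℤ : ℤ → K
    ⟦ + m ⟧ℤ      = ιℕ m
    ⟦ -[1+ m ] ⟧ℤ = - ιℕ (suc m)

    ⟦⟧-neg : ∀ i → ⟦ ℤ.- i ⟧ℤ ≡ - ⟦ i ⟧ℤ
    ⟦⟧-neg (+ zero)  = sym RP.-0#≈0#
    ⟦⟧-neg (+ suc m) = refl
    ⟦⟧-neg -[1+ m ]  = sym (RP.-‿involutive _)

    ⟦⟧-⊖ : ∀ a b → ⟦ a ℤ.⊖ b ⟧ℤ ≡ ιℕ a - ιℕ b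
    ⟦⟧-⊖ a       zero    = trans (sym (+-identityʳ _)) (cong (λ z → ιℕ a + z) (sym RP.-0#≈0#))
    ⟦⟧-⊖ zero    (suc b) = sym (+-identityˡ _)
    ⟦⟧-⊖ (suc a) (suc b) = begin
      ⟦ suc a ℤ.⊖ suc b ⟧ℤ                     ≡⟨ cong ⟦_⟧ℤ (ℤₚ.[1+m]⊖[1+n]≡m⊖n a b) ⟩
      ⟦ a ℤ.⊖ b ⟧ℤ                             ≡⟨ ⟦⟧-⊖ a b ⟩
      ιℕ a - ιℕ b                              ≡⟨ sym (+-identityˡ _) ⟩
      0# + (ιℕ a - ιℕ b)                       ≡⟨ cong (λ z → z + (ιℕ a - ιℕ b)) (sym (-‿inverseʳ 1#)) ⟩
      (1# + - 1#) + (ιℕ a + - ιℕ b)            ≡⟨ BigOp.interchange R.+-isCommutativeMonoid _ _ _ _ ⟩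
      (1# + ιℕ a) + (- 1# + - ιℕ b)            ≡⟨ cong (λ z → (1# + ιℕ a) + z) (RP.-‿+-comm 1# (ιℕ b)) ⟩
      ιℕ (suc a) - ιℕ (suc b)                  ∎

    ⟦⟧-+ : ∀ i j → ⟦ i ℤ.+ j ⟧ℤ ≡ ⟦ i ⟧ℤ + ⟦ j ⟧ℤ
    ⟦⟧-+ (+ a)    (+ b)    = ιℕ-+ a b
    ⟦⟧-+ (+ a)    -[1+ b ] = ⟦⟧-⊖ a (suc b)
    ⟦⟧-+ -[1+ a ] (+ b)    = trans (⟦⟧-⊖ b (suc a)) (+-comm _ _)
    ⟦⟧-+ -[1+ a ] -[1+ b ] = trans (cong (-_ ∘ ιℕ) (cong suc (sym (ℕₚ.+-suc a b))))
                               (trans (cong -_ (ιℕ-+ (suc a) (suc b))) (sym (RP.-‿+-comm _ _)))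

    ⟦⟧-*⁺ : ∀ a j → ⟦ + a ℤ.* j ⟧ℤ ≡ ιℕ a * ⟦ j ⟧ℤ
    ⟦⟧-*⁺ a (+ b)    = trans (cong ⟦_⟧ℤ (sym (ℤₚ.pos-* a b))) (ιℕ-* a b)
    ⟦⟧-*⁺ a -[1+ b ] = begin
      ⟦ + a ℤ.* (ℤ.- (+ suc b)) ⟧ℤ ≡⟨ cong ⟦_⟧ℤ (sym (ℤₚ.neg-distribʳ-* (+ a) (+ suc b))) ⟩
      ⟦ ℤ.- (+ a ℤ.* + suc b) ⟧ℤ   ≡⟨ ⟦⟧-neg (+ a ℤ.* + suc b) ⟩
      - ⟦ + a ℤ.* + suc b ⟧ℤ       ≡⟨ cong -_ (⟦⟧-*⁺ a (+ suc b)) ⟩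
      - (ιℕ a * ιℕ (suc b))        ≡⟨ RP.-‿distribʳ-* _ _ ⟩
      ιℕ a * - ιℕ (suc b)          ∎

    ⟦⟧-* : ∀ i j → ⟦ i ℤ.* j ⟧ℤ ≡ ⟦ i ⟧ℤ * ⟦ j ⟧ℤ
    ⟦⟧-* (+ a)    j = ⟦⟧-*⁺ a j
    ⟦⟧-* -[1+ a ] j = begin
      ⟦ (ℤ.- (+ suc a)) ℤ.* j ⟧ℤ   ≡⟨ cong ⟦_⟧ℤ (sym (ℤₚ.neg-distribˡ-* (+ suc a) j)) ⟩
      ⟦ ℤ.- (+ suc a ℤ.* j) ⟧ℤ     ≡⟨ ⟦⟧-neg (+ suc a ℤ.* j) ⟩
      - ⟦ + suc a ℤ.* j ⟧ℤ         ≡⟨ cong -_ (⟦⟧-*⁺ (suc a) j) ⟩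
      - (ιℕ (suc a) * ⟦ j ⟧ℤ)      ≡⟨ RP.-‿distribˡ-* _ _ ⟩
      - ιℕ (suc a) * ⟦ j ⟧ℤ        ∎

    almostRing : AlmostCommutativeRing 0ℓ 0ℓ
    almostRing = fromCommutativeRing commutativeRing

    ℤ⟶K : CommutativeRing.rawRing ℤₚ.+-*-commutativeRing -Raw-AlmostCommutative⟶ almostRing
    ℤ⟶K = record
      { ⟦_⟧ = ⟦_⟧ℤ ; +-homo = ⟦⟧-+ ; *-homo = ⟦⟧-* ; -‿homo = ⟦⟧-neg
      ; 0-homo = refl ; 1-homo = +-identityʳ 1# }

    ⟦⟧-≟ : ∀ i j → Maybe (⟦ i ⟧ℤ ≡ ⟦ j ⟧ℤ)
    ⟦⟧-≟ i j with i ℤ.≟ j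
    ... | yes refl = just refl
    ... | no _     = nothing

  -- Integer coefficients, so that the solver cancels opposite terms.
  module Solver = RingSolver (CommutativeRing.rawRing ℤₚ.+-*-commutativeRing) almostRing ℤ⟶K ⟦⟧-≟
  open Solver using (solve; _:=_; _:+_; _:*_; _:-_; :-_; con)

  x-y≡0⇒x≡y : ∀ {x y} → x - y ≡ 0# → x ≡ y
  x-y≡0⇒x≡y {x} {y} eq = begin
    x           ≡⟨ solve 2 (λ x y → x := (x :- y) :+ y) refl x y ⟩
    (x - y) + y ≡⟨ cong (λ z → z + y) eq ⟩
    0# + y      ≡⟨ +-identityˡ y ⟩
    y           ∎

  x≡y⇒x-y≡0 : ∀ {x y} → x ≡ y → x - y ≡ 0#
  x≡y⇒x-y≡0 refl = -‿inverseʳ _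

  +-cancelˡ : ∀ x {y z} → x + y ≡ x + z → y ≡ z
  +-cancelˡ x {y} {z} eq = begin
    y           ≡⟨ solve 2 (λ x y → y := (x :+ y) :- x) refl x y ⟩
    (x + y) - x ≡⟨ cong (λ w → w - x) eq ⟩
    (x + z) - x ≡⟨ solve 2 (λ x z → (x :+ z) :- x := z) refl x z ⟩
    z           ∎

  *-cancelˡ : ∀ x {y z} → x ≢ 0# → x * y ≡ x * z → y ≡ z
  *-cancelˡ x {y} {z} x≢0 eq = begin
    y              ≡⟨ lem y ⟩
    x ⁻¹ * (x * y) ≡⟨ cong (λ w → x ⁻¹ * w) eq ⟩
    x ⁻¹ * (x * z) ≡⟨ sym (lem z) ⟩
    z              ∎
    where
    lem : ∀ w → w ≡ x ⁻¹ * (x * w)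
    lem w = sym (trans (sym (*-assoc _ _ _)) (trans (cong (λ u → u * w) (trans (*-comm _ _) (inverse x x≢0))) (*-identityˡ w)))

  *-nonzero : ∀ {x y} → x ≢ 0# → y ≢ 0# → x * y ≢ 0#
  *-nonzero {x} x≢0 y≢0 eq = y≢0 (*-cancelˡ x x≢0 (trans eq (sym (zeroʳ x))))

  integral : ∀ {x y} → x * y ≡ 0# → x ≡ 0# ⊎ y ≡ 0#
  integral {x} {y} eq with x ≟ 0# | y ≟ 0#
  ... | yes x≡0 | _       = inj₁ x≡0
  ... | no _    | yes y≡0 = inj₂ y≡0
  ... | no x≢0  | no y≢0  = contradiction eq (*-nonzero x≢0 y≢0)

  pow-+ : ∀ x a b → pow x (a ℕ.+ b) ≡ pow x a * pow x b
  pow-+ x zero    b = sym (*-identityˡ _)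
  pow-+ x (suc a) b = trans (cong (λ z → x * z) (pow-+ x a b)) (sym (*-assoc _ _ _))

  pow-1 : ∀ a → pow 1# a ≡ 1#
  pow-1 zero    = refl
  pow-1 (suc a) = trans (*-identityˡ _) (pow-1 a)

  pow-0 : ∀ a → 0 ℕ.< a → pow 0# a ≡ 0#
  pow-0 (suc a) _ = zeroˡ _

  pow-distrib : ∀ x y a → pow (x * y) a ≡ pow x a * pow y a
  pow-distrib x y zero    = sym (*-identityˡ 1#)
  pow-distrib x y (suc a) = trans (cong (λ z → (x * y) * z) (pow-distrib x y a))
    (solve 4 (λ x y u v → (x :* y) :* (u :* v) := (x :* u) :* (y :* v)) refl x y (pow x a) (pow y a))

  pow-* : ∀ x a b → pow x (a ℕ.* b) ≡ pow (pow x b) a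
  pow-* x zero    b = refl
  pow-* x (suc a) b = trans (pow-+ x b (a ℕ.* b)) (cong (λ z → pow x b * z) (pow-* x a b))

  pow-nonzero : ∀ x a → x ≢ 0# → pow x a ≢ 0#
  pow-nonzero x zero    x≢0 = 0≢1 ∘ sym
  pow-nonzero x (suc a) x≢0 = *-nonzero x≢0 (pow-nonzero x a x≢0)

  pow≡^ : ∀ x a → pow x a ≡ x E.^ a
  pow≡^ x zero    = refl
  pow≡^ x (suc a) = cong (λ z → x * z) (pow≡^ x a)

  module ∑+ = BigOp R.+-isCommutativeMonoid
  module ∑* = BigOp R.*-isCommutativeMonoid

  private
    ∑+-1 : {A : Set} (xs : List A) → ∑+.∑ xs (λ _ → 1#) ≡ ιℕ (length xs)
    ∑+-1 []       = refl
    ∑+-1 (x ∷ xs) = cong (λ z → 1# + z) (∑+-1 xs)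

    ∑*-const : {A : Set} (xs : List A) (a : K) → ∑*.∑ xs (λ _ → a) ≡ pow a (length xs)
    ∑*-const []       a = refl
    ∑*-const (x ∷ xs) a = cong (λ z → a * z) (∑*-const xs a)

  -- Translating by 1 permutes K, hence does not change the sum of all elements.
  ιℕ-size : ιℕ (p ℕ.^ n) ≡ 0#
  ιℕ-size = +-cancelˡ (∑+.∑ elems id) (begin
    ∑+.∑ elems id + ιℕ (p ℕ.^ n)
      ≡⟨ cong (λ z → ∑+.∑ elems id + z) (trans (cong ιℕ (sym size)) (sym (∑+-1 elems))) ⟩
    ∑+.∑ elems id + ∑+.∑ elems (λ _ → 1#)
      ≡⟨ sym (∑+.∑-∙ elems id (λ _ → 1#)) ⟩
    ∑+.∑ elems (λ x → x + 1#)
      ≡⟨ ∑+.∑-reindex K-finite K-finite (λ x → x + 1#) (λ x → x - 1#)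
           (λ x → solve 2 (λ x o → (x :- o) :+ o := x) refl x 1#)
           (λ x → solve 2 (λ x o → (x :+ o) :- o := x) refl x 1#) id ⟩
    ∑+.∑ elems id
      ≡⟨ sym (+-identityʳ _) ⟩
    ∑+.∑ elems id + 0# ∎)

  ιℕ-^ : ∀ a b → ιℕ (a ℕ.^ b) ≡ pow (ιℕ a) b
  ιℕ-^ a zero    = +-identityʳ 1#
  ιℕ-^ a (suc b) = trans (ιℕ-* a (a ℕ.^ b)) (cong (λ z → ιℕ a * z) (ιℕ-^ a b))

  -- Only the order of K is given. By `ιℕ-size` the n-th power of `ιℕ p` vanishes, and a field has
  -- no nilpotent elements.
  ιℕ-p : ιℕ p ≡ 0#
  ιℕ-p with ιℕ p ≟ 0#
  ... | yes eq = eq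
  ... | no neq = contradiction (trans (sym (ιℕ-^ p n)) ιℕ-size) (pow-nonzero (ιℕ p) n neq)

  ∣⇒ιℕ≡0 : ∀ {m} → p ∣ m → ιℕ m ≡ 0#
  ∣⇒ιℕ≡0 (divides k refl) = trans (ιℕ-* k p) (trans (cong (λ z → ιℕ k * z) ιℕ-p) (zeroʳ _))

  -- Multiplying by a ≢ 0 permutes K and fixes 0, hence does not change the
  -- product of all nonzero elements.
  pow-size : ∀ a → pow a (p ℕ.^ n) ≡ a
  pow-size a with a ≟ 0#
  ... | yes refl = pow-0 (p ℕ.^ n) (ℕₚ.m^n>0 p n)
  ... | no a≢0   = begin
    pow a (p ℕ.^ n)               ≡⟨ trans (cong (pow a) (sym size)) (sym (∑*-const elems a)) ⟩
    ∑*.∑ elems (λ _ → a)          ≡⟨ ∑*.∑-cong elems a≡v*w ⟩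
    ∑*.∑ elems (λ x → v x * w x)  ≡⟨ ∑*.∑-∙ elems v w ⟩
    ∑*.∑ elems v * ∑*.∑ elems w   ≡⟨ cong₂ _*_ ∏v≡1 (∑*.∑-delta K-finite 0# (λ _ → a)) ⟩
    1# * a                        ≡⟨ *-identityˡ a ⟩
    a                             ∎
    where
    u v w : K → K
    u x with x ≟ 0#
    ... | yes _ = 1#
    ... | no  _ = x
    v x with x ≟ 0#
    ... | yes _ = 1#
    ... | no  _ = a
    w x = ∑*.when (x ≟ 0#) a
    a≡v*w : ∀ x → a ≡ v x * w x
    a≡v*w x with x ≟ 0#
    ... | yes _ = sym (*-identityˡ a)
    ... | no  _ = sym (*-identityʳ a)
    u-nonzero : ∀ x → u x ≢ 0#
    u-nonzero x with x ≟ 0#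
    ... | yes _  = 0≢1 ∘ sym
    ... | no x≢0 = x≢0
    u-scale : ∀ x → u (a * x) ≡ u x * v x
    u-scale x with x ≟ 0# | (a * x) ≟ 0#
    ... | yes _    | yes _  = sym (*-identityˡ 1#)
    ... | yes refl | no ¬0  = contradiction (zeroʳ a) ¬0
    ... | no x≢0   | yes ax = contradiction ax (*-nonzero a≢0 x≢0)
    ... | no _     | no _   = *-comm a x
    ∏u≢0 : ∀ xs → ∑*.∑ xs u ≢ 0#
    ∏u≢0 []       = 0≢1 ∘ sym
    ∏u≢0 (x ∷ xs) = *-nonzero (u-nonzero x) (∏u≢0 xs)
    ∏v≡1 : ∑*.∑ elems v ≡ 1#
    ∏v≡1 = *-cancelˡ (∑*.∑ elems u) (∏u≢0 elems) (begin
      ∑*.∑ elems u * ∑*.∑ elems v  ≡⟨ sym (∑*.∑-∙ elems u v) ⟩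
      ∑*.∑ elems (λ x → u x * v x) ≡⟨ ∑*.∑-cong elems (λ x → sym (u-scale x)) ⟩
      ∑*.∑ elems (λ x → u (a * x)) ≡⟨ ∑*.∑-reindex K-finite K-finite (λ x → a * x) (λ x → a ⁻¹ * x)
         (λ x → trans (sym (*-assoc _ _ _)) (trans (cong (λ z → z * x) (inverse a a≢0)) (*-identityˡ x)))
         (λ x → trans (sym (*-assoc _ _ _)) (trans (cong (λ z → z * x) (trans (*-comm _ _) (inverse a a≢0))) (*-identityˡ x)))
         u ⟩
      ∑*.∑ elems u                 ≡⟨ sym (*-identityʳ _) ⟩
      ∑*.∑ elems u * 1#            ∎)

  private
    ×≡ιℕ* : ∀ m x → m M.× x ≡ ιℕ m * x
    ×≡ιℕ* zero    x = sym (zeroˡ x)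
    ×≡ιℕ* (suc m) x = trans (cong₂ _+_ (sym (*-identityˡ x)) (×≡ιℕ* m x)) (sym (distribʳ x 1# (ιℕ m)))

    -- The inner binomial coefficients vanish in K. The exponent is bound afresh so that it can be
    -- matched as a successor, which splits off the two outer terms.
    freshman : ∀ p → Prime p → ιℕ p ≡ 0# → ∀ x y → (x + y) E.^ p ≡ x E.^ p + y E.^ p
    freshman p@(suc p-1) pr p≡0 x y = begin
      (x + y) E.^ p                                    ≡⟨ B.theorem p x y ⟩
      term Fin.zero + SS.sum (λ k → term (Fin.suc k))  ≡⟨ cong₂ _+_ first (SS.sum-init-last (λ k → term (Fin.suc k))) ⟩
      y E.^ p + (SS.sum (λ k → term (Fin.suc (inject₁ k))) + term (Fin.suc (fromℕ p-1)))
        ≡⟨ cong (λ z → y E.^ p + z) (cong₂ _+_ (trans (SS.sum-cong-≗ middle) (SS.sum-replicate-zero p-1)) last) ⟩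
      y E.^ p + (0# + x E.^ p)                         ≡⟨ solve 2 (λ x y → y :+ (con (+ 0) :+ x) := x :+ y) refl (x E.^ p) (y E.^ p) ⟩
      x E.^ p + y E.^ p ∎
      where
      term = B.binomialTerm x y p
      first : term Fin.zero ≡ y E.^ p
      first = trans (×≡ιℕ* (p Choose 0) (1# * y E.^ p)) (trans (cong₂ _*_ (+-identityʳ 1#) (*-identityˡ _)) (*-identityˡ _))
      last : term (Fin.suc (fromℕ p-1)) ≡ x E.^ p
      last rewrite Finₚ.toℕ-fromℕ p-1 | nCn≡1 p | ℕₚ.n∸n≡0 p-1 =
        trans (+-identityʳ _) (*-identityʳ _)
      middle : ∀ k → term (Fin.suc (inject₁ k)) ≡ 0#
      middle k rewrite Finₚ.toℕ-inject₁ k =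
        trans (×≡ιℕ* (p Choose suc (toℕ k)) rest) (trans (cong (λ z → z * rest) C≡0) (zeroˡ _))
        where
        rest = x E.^ suc (toℕ k) * y E.^ (p ∸ suc (toℕ k))
        C≡0 : ιℕ (p Choose suc (toℕ k)) ≡ 0#
        C≡0 with prime∣binomial pr (suc (toℕ k)) (s≤s z≤n) (s≤s (Finₚ.toℕ<n k))
        ... | divides m eq = trans (cong ιℕ eq) (trans (ιℕ-* m p) (trans (cong (λ z → ιℕ m * z) p≡0) (zeroʳ _)))

  φ : ℕ → K → K
  φ i x = pow x (p ℕ.^ i)

  φ-+ : ∀ i x y → φ i (x + y) ≡ φ i x + φ i y
  φ-+ zero    x y = trans (*-identityʳ _) (sym (cong₂ _+_ (*-identityʳ x) (*-identityʳ y)))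
  φ-+ (suc i) x y = begin
    pow (x + y) (p ℕ.* p ℕ.^ i)             ≡⟨ pow-* (x + y) p (p ℕ.^ i) ⟩
    pow (φ i (x + y)) p                     ≡⟨ cong (λ z → pow z p) (φ-+ i x y) ⟩
    pow (φ i x + φ i y) p                   ≡⟨ trans (pow≡^ _ p) (freshman p pr ιℕ-p _ _) ⟩
    (φ i x) E.^ p + (φ i y) E.^ p           ≡⟨ sym (cong₂ _+_ (pow≡^ _ p) (pow≡^ _ p)) ⟩
    pow (φ i x) p + pow (φ i y) p           ≡⟨ sym (cong₂ _+_ (pow-* x p (p ℕ.^ i)) (pow-* y p (p ℕ.^ i))) ⟩
    φ (suc i) x + φ (suc i) y               ∎

  φ-* : ∀ i x y → φ i (x * y) ≡ φ i x * φ i y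
  φ-* i x y = pow-distrib x y (p ℕ.^ i)

  φ-1 : ∀ i → φ i 1# ≡ 1#
  φ-1 i = pow-1 (p ℕ.^ i)

  φ-0 : ∀ i → φ i 0# ≡ 0#
  φ-0 i = pow-0 (p ℕ.^ i) (ℕₚ.m^n>0 p i)

  φ-neg : ∀ i x → φ i (- x) ≡ - φ i x
  φ-neg i x = begin
    φ i (- x)                     ≡⟨ solve 2 (λ a b → a := (b :+ a) :- b) refl (φ i (- x)) (φ i x) ⟩
    (φ i x + φ i (- x)) - φ i x   ≡⟨ cong (λ z → z - φ i x) (sym (φ-+ i x (- x))) ⟩
    φ i (x - x) - φ i x           ≡⟨ cong (λ z → φ i z - φ i x) (-‿inverseʳ x) ⟩
    φ i 0# - φ i x                ≡⟨ cong (λ z → z - φ i x) (φ-0 i) ⟩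
    0# - φ i x                    ≡⟨ +-identityˡ _ ⟩
    - φ i x                       ∎

  φ-sub : ∀ i x y → φ i (x - y) ≡ φ i x - φ i y
  φ-sub i x y = trans (φ-+ i x (- y)) (cong (λ z → φ i x + z) (φ-neg i y))

  φ-φ : ∀ i j x → φ i (φ j x) ≡ φ (i ℕ.+ j) x
  φ-φ i j x = trans (sym (pow-* x (p ℕ.^ i) (p ℕ.^ j))) (cong (pow x) (sym (ℕₚ.^-distribˡ-+-* p i j)))

  φ-comm : ∀ i j x → φ i (φ j x) ≡ φ j (φ i x)
  φ-comm i j x = trans (φ-φ i j x) (trans (cong (λ k → φ k x) (ℕₚ.+-comm i j)) (sym (φ-φ j i x)))

  φ-zero : ∀ x → φ 0 x ≡ x
  φ-zero x = *-identityʳ x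

  φ-n : ∀ x → φ n x ≡ x
  φ-n = pow-size

  φ-inj : ∀ i x → φ i x ≡ 0# → x ≡ 0#
  φ-inj i x eq with x ≟ 0#
  ... | yes x≡0 = x≡0
  ... | no x≢0  = contradiction eq (pow-nonzero x (p ℕ.^ i) x≢0)

  φ-fixed-* : ∀ k i x → φ i x ≡ x → φ (k ℕ.* i) x ≡ x
  φ-fixed-* zero    i x eq = φ-zero x
  φ-fixed-* (suc k) i x eq = trans (sym (φ-φ i (k ℕ.* i) x)) (trans (cong (φ i) (φ-fixed-* k i x eq)) eq)

bezout : ∀ a b → gcd a b ≡ 1 →
         (∃₂ λ u v → 1 ℕ.+ v ℕ.* b ≡ u ℕ.* a) ⊎ (∃₂ λ u v → 1 ℕ.+ u ℕ.* a ≡ v ℕ.* b)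
bezout a b g≡1 with Bézout.identity (subst (λ g → GCD a b g) g≡1 (gcd-GCD a b))
... | Bézout.+- u v eq = inj₁ (u , v , eq)
... | Bézout.-+ u v eq = inj₂ (u , v , eq)

prime-coprime : ∀ {p} → Prime p → ∀ m → ¬ (p ∣ m) → gcd m p ≡ 1
prime-coprime {p} pr m p∤m with prime⇒irreducible pr (gcd[m,n]∣n m p)
... | inj₁ g≡1 = g≡1
... | inj₂ g≡p = contradiction (subst (_∣ m) g≡p (gcd[m,n]∣m m p)) p∤m

module _ {A : Set} (F : Finite A) where
  open Finite F

  any-finite? : {P : A → Set} → Decidable P → Dec (∃ P)
  any-finite? P? with any? P? elements
  ... | yes a = yes (let (x , _ , px) = find a in x , px)
  ... | no ¬a = no (λ (x , px) → ¬a (lose (complete x) px))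

  ∑-ind′ : ∀ a (f : A → ℤ) → ∑ elements (λ x → ind (a ≟ x) ℤ.* f x) ≡ f a
  ∑-ind′ a f = trans (∑-cong elements (λ x → cong (ℤ._* f x) (when-⇔ (a ≟ x) (x ≟ a) sym sym))) (∑-ind F a f)

  ∑-ind-one : ∀ a → ∑ elements (λ x → ind (a ≟ x)) ≡ + 1
  ∑-ind-one a = trans (∑-cong elements (λ x → sym (ℤₚ.*-identityʳ _))) (∑-ind′ a (λ _ → + 1))

-- Root counting, and the subfields fixed by powers of Frobenius.

module Subfields {p n : ℕ} {{p≢0 : NonZero p}} (pr : Prime p) (𝔽 : FiniteField p n) where
  open FieldTheory pr 𝔽 public
  open Solver using (solve; _:=_; _:+_; _:*_; _:-_; :-_; con)
  open ≡-Reasoning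

  p>1 : 1 ℕ.< p
  p>1 = ℕ.nonTrivial⇒n>1 p {{prime⇒nonTrivial pr}}

  -- Monic polynomials of a given degree as functions in Horner form: counting roots takes only
  -- values and a degree, so no polynomial ring is built.
  data Monic : ℕ → (K → K) → Set where
    one  : ∀ {f} → (∀ x → f x ≡ 1#) → Monic 0 f
    step : ∀ {m f} c g → (∀ x → f x ≡ c + x * g x) → Monic m g → Monic (suc m) f

  -- Polynomial functions of degree < m.
  data Low : ℕ → (K → K) → Set where
    nil  : ∀ {f} → (∀ x → f x ≡ 0#) → Low 0 f
    step : ∀ {m f} c g → (∀ x → f x ≡ c + x * g x) → Low m g → Low (suc m) f

  Low-0 : ∀ m {f} → (∀ x → f x ≡ 0#) → Low m f
  Low-0 zero    f≡0 = nil f≡0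
  Low-0 (suc m) f≡0 = step 0# (λ _ → 0#)
    (λ x → trans (f≡0 x) (solve 1 (λ x → con (+ 0) := con (+ 0) :+ x :* con (+ 0)) refl x)) (Low-0 m (λ _ → refl))

  Low-≤ : ∀ {m k f} → m ℕ.≤ k → Low m f → Low k f
  Low-≤ {k = k} z≤n (nil f≡0)  = Low-0 k f≡0
  Low-≤ (s≤s m≤k) (step c g e l) = step c g e (Low-≤ m≤k l)

  private
    shuffle : ∀ c d x u v → (c + x * u) + (d + x * v) ≡ (c + d) + x * (u + v)
    shuffle = solve 5 (λ c d x u v → (c :+ x :* u) :+ (d :+ x :* v) := (c :+ d) :+ x :* (u :+ v)) refl

  Monic-+ : ∀ {m f h} → Monic m f → Low m h → Monic m (λ x → f x + h x)
  Monic-+ (one e) (nil e′) = one (λ x → trans (cong₂ _+_ (e x) (e′ x)) (+-identityʳ 1#))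
  Monic-+ (step c g e l) (step c′ g′ e′ l′) =
    step (c + c′) (λ x → g x + g′ x) (λ x → trans (cong₂ _+_ (e x) (e′ x)) (shuffle c c′ x (g x) (g′ x))) (Monic-+ l l′)

  Monic-pow : ∀ a → Monic a (λ x → pow x a)
  Monic-pow zero    = one (λ _ → refl)
  Monic-pow (suc a) = step 0# (λ x → pow x a) (λ x → sym (+-identityˡ _)) (Monic-pow a)

  Monic⇒Low : ∀ {m f} → Monic m f → Low (suc m) f
  Monic⇒Low (one e) = step 1# (λ _ → 0#)
    (λ x → trans (e x) (sym (trans (cong (λ z → 1# + z) (zeroʳ x)) (+-identityʳ 1#)))) (nil (λ _ → refl))
  Monic⇒Low (step c g e l) = step c g e (Monic⇒Low l)

  -- Synthetic division: for f = c + x h the quotient has constant coefficient h r and continues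
  -- with the quotient of h.
  divide : ∀ {m f} → Monic (suc m) f → ∀ r → ∃ λ g → Monic m g × (∀ x → f x ≡ f r + (x - r) * g x)
  divide {zero} {f} (step c h e (one h≡1)) r = (λ _ → 1#) , one (λ _ → refl) , λ x → begin
    f x                   ≡⟨ e x ⟩
    c + x * h x           ≡⟨ cong (λ z → c + x * z) (h≡1 x) ⟩
    c + x * 1#            ≡⟨ solve 4 (λ c x r o → c :+ x :* o := (c :+ r :* o) :+ (x :- r) :* o) refl c x r 1# ⟩
    (c + r * 1#) + (x - r) * 1# ≡⟨ cong (λ z → (c + r * z) + (x - r) * 1#) (sym (h≡1 r)) ⟩
    (c + r * h r) + (x - r) * 1# ≡⟨ cong (λ z → z + (x - r) * 1#) (sym (e r)) ⟩
    f r + (x - r) * 1#    ∎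
  divide {suc m} {f} (step c h e mh) r with divide mh r
  ... | g , mg , eg = (λ x → h r + x * g x) , step (h r) g (λ _ → refl) mg , λ x → begin
    f x                                 ≡⟨ e x ⟩
    c + x * h x                         ≡⟨ cong (λ z → c + x * z) (eg x) ⟩
    c + x * (h r + (x - r) * g x)       ≡⟨ solve 5 (λ c x r u v → c :+ x :* (u :+ (x :- r) :* v) := (c :+ r :* u) :+ (x :- r) :* (u :+ x :* v)) refl c x r (h r) (g x) ⟩
    (c + r * h r) + (x - r) * (h r + x * g x) ≡⟨ cong (λ z → z + (x - r) * (h r + x * g x)) (sym (e r)) ⟩
    f r + (x - r) * (h r + x * g x)     ∎

  Monic-roots-≤ : ∀ {m f} → Monic m f → ∀ xs → Unique xs → All (λ x → f x ≡ 0#) xs → length xs ℕ.≤ m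
  Monic-roots-≤ mf [] _ _ = z≤n
  Monic-roots-≤ (one e) (x ∷ xs) _ (fx ∷ _) = contradiction (trans (sym fx) (e x)) 0≢1
  Monic-roots-≤ {suc m} {f} mf@(step _ _ _ _) (x ∷ xs) (x∉ ∷ u) (fx ∷ fxs) with divide mf x
  ... | g , mg , eg = s≤s (Monic-roots-≤ mg xs u (All.zipWith gy≡0 (x∉ , fxs)))
    where
    gy≡0 : ∀ {y} → (x ≢ y) × f y ≡ 0# → g y ≡ 0#
    gy≡0 {y} (x≢y , fy) with integral {y - x} {g y}
        (trans (sym (+-identityˡ _)) (trans (cong (λ z → z + (y - x) * g y) (sym fx)) (trans (sym (eg y)) fy)))
    ... | inj₁ y-x≡0 = contradiction (sym (x-y≡0⇒x≡y y-x≡0)) x≢y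
    ... | inj₂ gy    = gy

  #roots-≤ : ∀ {m f} → Monic m f → ∑ elems (λ x → ind (f x ≟ 0#)) ℤ.≤ + m
  #roots-≤ {m} {f} mf = subst (ℤ._≤ + m) (∑-ind-filter (λ x → f x ≟ 0#) elems)
    (ℤ.+≤+ (Monic-roots-≤ mf _ (Uniqueₚ.filter⁺ (λ x → f x ≟ 0#) unique) (Allₚ.all-filter (λ x → f x ≟ 0#) elems)))

  q : ℤ
  q = + (p ℕ.^ n)

  ∑-one : ∑ elems (λ _ → + 1) ≡ q
  ∑-one = trans (∑-const elems (+ 1)) (trans (ℤₚ.*-identityʳ _) (cong +_ size))

  module Additive (ψ : K → K) (ψ-+ : ∀ x y → ψ (x + y) ≡ ψ x + ψ y) where

    #fibre : K → ℤ
    #fibre β = ∑ elems (λ x → ind (ψ x ≟ β))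

    -- Translation by x₀ carries the kernel onto the fibre through x₀.
    #fibre-hit : ∀ x₀ → #fibre (ψ x₀) ≡ #fibre 0#
    #fibre-hit x₀ = begin
      ∑ elems (λ x → ind (ψ x ≟ ψ x₀))
        ≡⟨ sym (∑-permute K-finite (λ x → x + x₀) (λ x → x - x₀)
             (λ x → solve 2 (λ x a → (x :- a) :+ a := x) refl x x₀)
             (λ x → solve 2 (λ x a → (x :+ a) :- a := x) refl x x₀) (λ x → ind (ψ x ≟ ψ x₀))) ⟩
      ∑ elems (λ x → ind (ψ (x + x₀) ≟ ψ x₀))
        ≡⟨ ∑-cong elems (λ x → when-⇔ (ψ (x + x₀) ≟ ψ x₀) (ψ x ≟ 0#)
             (λ e → +-cancelˡ (ψ x₀) (trans (trans (+-comm _ _) (trans (sym (ψ-+ x x₀)) e)) (sym (+-identityʳ _))))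
             (λ e → trans (ψ-+ x x₀) (trans (cong (λ z → z + ψ x₀) e) (+-identityˡ _)))) ⟩
      ∑ elems (λ x → ind (ψ x ≟ 0#)) ∎

    #fibre-miss : ∀ β → ¬ (∃ λ x → ψ x ≡ β) → #fibre β ≡ + 0
    #fibre-miss β ¬hit = trans (∑-cong elems (λ x → when-no (ψ x ≟ β) (λ e → ¬hit (x , e)))) (∑-ε elems)

    hit? : ∀ β → Dec (∃ λ x → ψ x ≡ β)
    hit? β = any-finite? K-finite (λ x → ψ x ≟ β)

    #fibre-≤ : ∀ β → #fibre β ℤ.≤ #fibre 0#
    #fibre-≤ β with hit? β
    ... | yes (x₀ , refl) = ℤₚ.≤-reflexive (#fibre-hit x₀)
    ... | no ¬hit         = subst (ℤ._≤ #fibre 0#) (sym (#fibre-miss β ¬hit)) (∑≥0 elems (λ x → ind≥0 (ψ x ≟ 0#)))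

    ∑-#fibre : ∑ elems #fibre ≡ q
    ∑-#fibre = begin
      ∑ elems (λ β → ∑ elems (λ x → ind (ψ x ≟ β))) ≡⟨ ∑-swap elems elems _ ⟩
      ∑ elems (λ x → ∑ elems (λ β → ind (ψ x ≟ β))) ≡⟨ ∑-cong elems (λ x → ∑-ind-one K-finite (ψ x)) ⟩
      ∑ elems (λ _ → + 1)                           ≡⟨ ∑-one ⟩
      q ∎

    -- Rank and nullity as an inequality, for any `H` that contains the image. Upper bounds for `H`
    -- and for the kernel whose product is q must then both be attained.
    ∑-#fibre-≤ : {H : K → Set} (H? : Decidable H) → (∀ x → H (ψ x)) →
                 q ℤ.≤ ∑ elems (λ β → ind (H? β)) ℤ.* #fibre 0#
    ∑-#fibre-≤ H? img = subst (ℤ._≤ ∑ elems (λ β → ind (H? β)) ℤ.* #fibre 0#) ∑-#fibre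
      (ℤₚ.≤-trans (∑-mono elems bound) (ℤₚ.≤-reflexive (∑-*ʳ elems (#fibre 0#) (λ β → ind (H? β)))))
      where
      bound : ∀ β → #fibre β ℤ.≤ ind (H? β) ℤ.* #fibre 0#
      bound β with H? β
      ... | yes _ = subst (#fibre β ℤ.≤_) (sym (ℤₚ.*-identityˡ _)) (#fibre-≤ β)
      ... | no ¬h = ℤₚ.≤-reflexive (#fibre-miss β (λ { (x , refl) → ¬h (img x) }))

  -- For d ∣ n with d > 0 this is the subfield with p^d elements. All subfields are predicates on
  -- the one K, so elements, Q and the trace never move between fields.
  V : ℕ → K → Set
  V d x = φ d x ≡ x

  V? : ∀ d → Decidable (V d)
  V? d x = φ d x ≟ x

  [_∈V_] : K → ℕ → ℤ
  [ x ∈V d ] = ind (V? d x)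

  V-∣ : ∀ {d e} → d ∣ e → ∀ {x} → V d x → V e x
  V-∣ {d} (divides k refl) {x} = φ-fixed-* k d x

  V-+ : ∀ {d x y} → V d x → V d y → V d (x + y)
  V-+ {d} {x} {y} vx vy = trans (φ-+ d x y) (cong₂ _+_ vx vy)

  V-neg : ∀ {d x} → V d x → V d (- x)
  V-neg {d} {x} vx = trans (φ-neg d x) (cong -_ vx)

  V-sub : ∀ {d x y} → V d x → V d y → V d (x - y)
  V-sub {d} vx vy = V-+ {d} vx (V-neg {d} vy)

  V-* : ∀ {d x y} → V d x → V d y → V d (x * y)
  V-* {d} {x} {y} vx vy = trans (φ-* d x y) (cong₂ _*_ vx vy)

  V-0 : ∀ {d} → V d 0#
  V-0 {d} = φ-0 d

  V-1 : ∀ {d} → V d 1#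
  V-1 {d} = φ-1 d

  V-φ : ∀ {d x} i → V d x → V d (φ i x)
  V-φ {d} {x} i vx = trans (φ-comm d i x) (cong (φ i) vx)

  V-⁻¹ : ∀ {d x} → x ≢ 0# → V d x → V d (x ⁻¹)
  V-⁻¹ {d} {x} x≢0 vx = *-cancelˡ x x≢0 (begin
    x * φ d (x ⁻¹)     ≡⟨ cong (λ z → z * φ d (x ⁻¹)) (sym vx) ⟩
    φ d x * φ d (x ⁻¹) ≡⟨ sym (φ-* d x (x ⁻¹)) ⟩
    φ d (x * x ⁻¹)     ≡⟨ cong (φ d) (inverse x x≢0) ⟩
    φ d 1#             ≡⟨ φ-1 d ⟩
    1#                 ≡⟨ sym (inverse x x≢0) ⟩
    x * x ⁻¹           ∎)

  -- The relative trace of K over V d when k d = n.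
  T : ℕ → ℕ → K → K
  T d zero    x = 0#
  T d (suc k) x = φ (k ℕ.* d) x + T d k x

  T-+ : ∀ d k x y → T d k (x + y) ≡ T d k x + T d k y
  T-+ d zero    x y = sym (+-identityˡ 0#)
  T-+ d (suc k) x y = trans (cong₂ _+_ (φ-+ (k ℕ.* d) x y) (T-+ d k x y))
    (BigOp.interchange R.+-isCommutativeMonoid _ _ _ _)

  -- Applying `φ d` shifts every exponent by d: one term is gained at the top, and x is lost at the
  -- bottom.
  T-telescope : ∀ d k x → T d k (φ d x) + x ≡ T d k x + φ (k ℕ.* d) x
  T-telescope d zero    x = cong (λ z → 0# + z) (sym (φ-zero x))
  T-telescope d (suc k) x = begin
    (φ (k ℕ.* d) (φ d x) + T d k (φ d x)) + x ≡⟨ cong (λ z → (z + T d k (φ d x)) + x) (trans (φ-comm (k ℕ.* d) d x) (φ-φ d (k ℕ.* d) x)) ⟩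
    (φ (suc k ℕ.* d) x + T d k (φ d x)) + x   ≡⟨ +-assoc _ _ _ ⟩
    φ (suc k ℕ.* d) x + (T d k (φ d x) + x)   ≡⟨ cong (λ z → φ (suc k ℕ.* d) x + z) (T-telescope d k x) ⟩
    φ (suc k ℕ.* d) x + (T d k x + φ (k ℕ.* d) x) ≡⟨ solve 3 (λ a b c → a :+ (b :+ c) := (c :+ b) :+ a) refl _ _ _ ⟩
    (φ (k ℕ.* d) x + T d k x) + φ (suc k ℕ.* d) x ∎

  Low-T : ∀ d k → 0 ℕ.< d → Low (p ℕ.^ (k ℕ.* d)) (T d k)
  Monic-T : ∀ d k → 0 ℕ.< d → Monic (p ℕ.^ (k ℕ.* d)) (T d (suc k))
  Low-T d zero    _   = Low-0 1 (λ _ → refl)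
  Low-T d (suc k) 0<d = Low-≤ (ℕₚ.^-monoʳ-< p p>1 (ℕₚ.+-monoˡ-< (k ℕ.* d) 0<d)) (Monic⇒Low (Monic-T d k 0<d))
  Monic-T d k 0<d = Monic-+ (Monic-pow (p ℕ.^ (k ℕ.* d))) (Low-T d k 0<d)

  ∣V∣ : ℕ → ℤ
  ∣V∣ d = ∑ elems (λ x → [ x ∈V d ])

  module _ (d k : ℕ) (0<d : 0 ℕ.< d) (n≡ : n ≡ suc k ℕ.* d) where
    private
      ψ : K → K
      ψ x = φ d x - x

      ψ-+ : ∀ x y → ψ (x + y) ≡ ψ x + ψ y
      ψ-+ x y = trans (cong (λ z → z - (x + y)) (φ-+ d x y))
        (solve 4 (λ a b x y → (a :+ b) :- (x :+ y) := (a :- x) :+ (b :- y)) refl (φ d x) (φ d y) x y)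

      open Additive ψ ψ-+

      ker≡V : #fibre 0# ≡ ∣V∣ d
      ker≡V = ∑-cong elems (λ x → when-⇔ (ψ x ≟ 0#) (V? d x) x-y≡0⇒x≡y x≡y⇒x-y≡0)

      -- The easy half of additive Hilbert 90: since `φ n` is the identity, the two end terms of the
      -- telescope agree.
      Tψ≡0 : ∀ x → T d (suc k) (ψ x) ≡ 0#
      Tψ≡0 x = begin
        T d (suc k) (ψ x)
          ≡⟨ solve 3 (λ a b x → a := (a :+ b) :+ x :- (b :+ x)) refl _ (T d (suc k) x) x ⟩
        (T d (suc k) (ψ x) + T d (suc k) x) + x - (T d (suc k) x + x)
          ≡⟨ cong (λ z → z + x - (T d (suc k) x + x)) (trans (sym (T-+ d (suc k) (ψ x) x)) (cong (T d (suc k)) (solve 2 (λ a b → (a :- b) :+ b := a) refl (φ d x) x))) ⟩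
        T d (suc k) (φ d x) + x - (T d (suc k) x + x)
          ≡⟨ cong (λ z → z - (T d (suc k) x + x)) (trans (T-telescope d (suc k) x) (cong (λ z → T d (suc k) x + z) (trans (cong (λ m → φ m x) (sym n≡)) (φ-n x)))) ⟩
        (T d (suc k) x + x) - (T d (suc k) x + x)
          ≡⟨ -‿inverseʳ _ ⟩
        0# ∎

      V-≤ : ∣V∣ d ℤ.≤ + (p ℕ.^ d)
      V-≤ = subst (ℤ._≤ + (p ℕ.^ d)) ker≡V (#roots-≤ (Monic-+ (Monic-pow (p ℕ.^ d)) (Low-≤ 2≤ low)))
        where
        2≤ : 2 ℕ.≤ p ℕ.^ d
        2≤ = ℕₚ.≤-trans p>1 (subst (ℕ._≤ p ℕ.^ d) (ℕₚ.*-identityʳ p) (ℕₚ.^-monoʳ-≤ p 0<d))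
        low : Low 2 (λ x → - x)
        low = step 0# (λ _ → - 1#) (λ x → sym (trans (+-identityˡ _)
                (trans (*-comm x (- 1#)) (trans (solve 2 (λ o x → (:- o) :* x := :- (o :* x)) refl 1# x) (cong -_ (*-identityˡ x))))))
              (step (- 1#) (λ _ → 0#) (λ x → sym (trans (cong (λ z → - 1# + z) (zeroʳ x)) (+-identityʳ _))) (nil (λ _ → refl)))

    -- The image of φ d − 1 lies in the zero set of T d (n / d), so the root
    -- bounds for x^(p^d) − x and for T d (n / d) are both attained.
    ∣V∣≡p^d : ∣V∣ d ≡ + (p ℕ.^ d)
    ∣V∣≡p^d = ℤₚ.≤-antisym V-≤ (ℤₚ.*-cancelˡ-≤-pos (+ (p ℕ.^ d)) (∣V∣ d) (+ (p ℕ.^ (k ℕ.* d))) {{ℤ.positive (ℤ.+<+ (ℕₚ.m^n>0 p (k ℕ.* d)))}}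
      (ℤₚ.≤-trans (ℤₚ.≤-reflexive (trans (sym (ℤₚ.pos-* (p ℕ.^ (k ℕ.* d)) (p ℕ.^ d))) (cong +_ (trans (sym (ℕₚ.^-distribˡ-+-* p (k ℕ.* d) d)) (cong (p ℕ.^_) (trans (ℕₚ.+-comm (k ℕ.* d) d) (sym n≡)))))))
      (ℤₚ.≤-trans (∑-#fibre-≤ (λ x → T d (suc k) x ≟ 0#) Tψ≡0)
      (ℤₚ.≤-trans (ℤₚ.≤-reflexive (cong (∑ elems (λ x → ind (T d (suc k) x ≟ 0#)) ℤ.*_) ker≡V))
      (ℤₚ.*-monoʳ-≤-nonNeg (∣V∣ d) {{ℤ.nonNegative (∑≥0 elems (λ x → ind≥0 (V? d x)))}} (#roots-≤ (Monic-T d k 0<d)))))))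

-- The prime field and the absolute trace.

∑-Fin-const : ∀ m k → ∑ (allFin m) (λ _ → k) ≡ + m ℤ.* k
∑-Fin-const m k = trans (∑-const (allFin m) k) (cong (λ l → + l ℤ.* k) (Listₚ.length-tabulate {n = m} id))

module TraceTheory {p n : ℕ} {{p≢0 : NonZero p}} (pr : Prime p) (𝔽 : FiniteField p n)
                   (n≥1 : 1 ℕ.≤ n) (n⊥p : gcd n p ≡ 1) where
  open Subfields pr 𝔽 public
  open Cyclotomic p public
  open Solver using (solve; _:=_; _:+_; _:*_; _:-_; :-_; con)
  open ≡-Reasoning

  n≡1+[n∸1]*1 : n ≡ suc (n ∸ 1) ℕ.* 1
  n≡1+[n∸1]*1 = trans (sym (ℕₚ.m+[n∸m]≡n n≥1)) (sym (ℕₚ.*-identityʳ _))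

  -- If p did not divide m, a Bézout relation between m and p would read 0 = 1 in K.
  ιℕ≡0⇒p∣ : ∀ m → ιℕ m ≡ 0# → p ∣ m
  ιℕ≡0⇒p∣ m ιm≡0 with p ∣? m
  ... | yes p∣m = p∣m
  ... | no p∤m with bezout m p (prime-coprime pr m p∤m)
  ...   | inj₁ (u , v , eq) = contradiction (begin
            0#                   ≡⟨ sym (zeroʳ (ιℕ u)) ⟩
            ιℕ u * 0#            ≡⟨ cong (λ z → ιℕ u * z) (sym ιm≡0) ⟩
            ιℕ u * ιℕ m          ≡⟨ sym (ιℕ-* u m) ⟩
            ιℕ (u ℕ.* m)         ≡⟨ cong ιℕ (sym eq) ⟩
            1# + ιℕ (v ℕ.* p)    ≡⟨ cong (λ z → 1# + z) (∣⇒ιℕ≡0 (divides v refl)) ⟩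
            1# + 0#              ≡⟨ +-identityʳ 1# ⟩
            1#                   ∎) 0≢1
  ...   | inj₂ (u , v , eq) = contradiction (begin
            0#                   ≡⟨ sym (∣⇒ιℕ≡0 (divides v refl)) ⟩
            ιℕ (v ℕ.* p)         ≡⟨ cong ιℕ (sym eq) ⟩
            1# + ιℕ (u ℕ.* m)    ≡⟨ cong (λ z → 1# + z) (trans (ιℕ-* u m) (trans (cong (λ z → ιℕ u * z) ιm≡0) (zeroʳ _))) ⟩
            1# + 0#              ≡⟨ +-identityʳ 1# ⟩
            1#                   ∎) 0≢1

  -- On F_p the trace is multiplication by n, so this makes it injective there.
  ιn≢0 : ιℕ n ≢ 0#
  ιn≢0 eq = ℕₚ.<⇒≱ p>1 (∣⇒≤ (subst (p ∣_) n⊥p (gcd-greatest (ιℕ≡0⇒p∣ n eq) ∣-refl)))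

  V1-ιℕ : ∀ m → V 1 (ιℕ m)
  V1-ιℕ zero    = V-0 {1}
  V1-ιℕ (suc m) = V-+ {1} (V-1 {1}) (V1-ιℕ m)

  V1⊆V : ∀ d {x} → V 1 x → V d x
  V1⊆V d = V-∣ (divides d (sym (ℕₚ.*-identityʳ d)))

  ∣V1∣ : ∣V∣ 1 ≡ + p
  ∣V1∣ = trans (∣V∣≡p^d 1 (n ∸ 1) (s≤s z≤n) n≡1+[n∸1]*1) (cong +_ (ℕₚ.*-identityʳ p))

  ιℕ-% : ∀ m → ιℕ (m % p) ≡ ιℕ m
  ιℕ-% m = begin
    ιℕ (m % p)                      ≡⟨ sym (+-identityʳ _) ⟩
    ιℕ (m % p) + 0#                 ≡⟨ cong (λ z → ιℕ (m % p) + z) (sym (∣⇒ιℕ≡0 (divides (m / p) refl))) ⟩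
    ιℕ (m % p) + ιℕ (m / p ℕ.* p)   ≡⟨ sym (ιℕ-+ (m % p) (m / p ℕ.* p)) ⟩
    ιℕ (m % p ℕ.+ m / p ℕ.* p)      ≡⟨ cong ιℕ (sym (m≡m%n+[m/n]*n m p)) ⟩
    ιℕ m                            ∎

  ι-modp : ∀ m → ι (modp m) ≡ ιℕ m
  ι-modp m = trans (cong ιℕ (Finₚ.toℕ-fromℕ< (m%n<n m p))) (ιℕ-% m)

  ιℕ-p∸ : ∀ (j : Fin p) → ιℕ (p ∸ toℕ j) ≡ - ι j
  ιℕ-p∸ j = begin
    ιℕ (p ∸ toℕ j)                 ≡⟨ solve 2 (λ a b → a := (a :+ b) :- b) refl _ (ι j) ⟩
    (ιℕ (p ∸ toℕ j) + ι j) - ι j   ≡⟨ cong (λ z → z - ι j) (sym (ιℕ-+ (p ∸ toℕ j) (toℕ j))) ⟩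
    ιℕ (p ∸ toℕ j ℕ.+ toℕ j) - ι j ≡⟨ cong (λ z → ιℕ z - ι j) (ℕₚ.m∸n+n≡m (ℕₚ.<⇒≤ (Finₚ.toℕ<n j))) ⟩
    ιℕ p - ι j                     ≡⟨ cong (λ z → z - ι j) ιℕ-p ⟩
    0# - ι j                       ≡⟨ +-identityˡ _ ⟩
    - ι j                          ∎

  ι-⊖ : ∀ i j → ι (i ⊖ j) ≡ ι i - ι j
  ι-⊖ i j = trans (ι-modp _) (trans (ιℕ-+ (toℕ i) (p ∸ toℕ j)) (cong (λ z → ι i + z) (ιℕ-p∸ j)))

  ι-negF : ∀ j → ι (negF j) ≡ - ι j
  ι-negF j = trans (ι-modp _) (ιℕ-p∸ j)

  ι-0 : ι (modp 0) ≡ 0#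
  ι-0 = ι-modp 0

  ιℕ-inj : ∀ a b → a ℕ.≤ b → b ℕ.< p → ιℕ a ≡ ιℕ b → a ≡ b
  ιℕ-inj a b a≤b b<p eq with b ∸ a in b∸a | ιℕ≡0⇒p∣ (b ∸ a) (+-cancelˡ (ιℕ a) (begin
      ιℕ a + ιℕ (b ∸ a)   ≡⟨ sym (ιℕ-+ a (b ∸ a)) ⟩
      ιℕ (a ℕ.+ (b ∸ a))  ≡⟨ cong ιℕ (ℕₚ.m+[n∸m]≡n a≤b) ⟩
      ιℕ b                ≡⟨ sym eq ⟩
      ιℕ a                ≡⟨ sym (+-identityʳ _) ⟩
      ιℕ a + 0#           ∎))
  ... | zero  | _   = ℕₚ.≤-antisym a≤b (ℕₚ.m∸n≡0⇒m≤n b∸a)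
  ... | suc k | p∣k = contradiction (ℕₚ.≤-<-trans (subst (p ℕ.≤_) (sym b∸a) (∣⇒≤ p∣k)) (ℕₚ.≤-<-trans (ℕₚ.m∸n≤m b a) b<p)) (ℕₚ.<-irrefl refl)

  ι-inj : ∀ {i j} → ι i ≡ ι j → i ≡ j
  ι-inj {i} {j} eq with ℕₚ.≤-total (toℕ i) (toℕ j)
  ... | inj₁ i≤j = Finₚ.toℕ-injective (ιℕ-inj _ _ i≤j (Finₚ.toℕ<n j) eq)
  ... | inj₂ j≤i = sym (Finₚ.toℕ-injective (ιℕ-inj _ _ j≤i (Finₚ.toℕ<n i) (sym eq)))

  V1-ι : ∀ j → V 1 (ι j)
  V1-ι j = V1-ιℕ (toℕ j)

  -- The pigeonhole principle as a sum: injectivity makes every defect nonnegative, and the defects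
  -- add up to p - p. It serves both for the embedding `ι` and, later, for the traces of the b_k.
  injective⇒onto-V1 : (g : Fin p → K) → (∀ j → V 1 (g j)) → (∀ {i j} → g i ≡ g j → i ≡ j) →
                      ∀ y → V 1 y → ∃ λ j → g j ≡ y
  injective⇒onto-V1 g g∈V g-inj y y∈V with any-finite? (Fin-finite p) (λ j → g j ≟ y)
  ... | yes hit = hit
  ... | no ¬hit = contradiction (trans (sym (defect≡1)) (∑≡0⇒each≡0 elems defect≥0 ∑defect (complete y))) (λ ())
    where
    #hits : K → ℤ
    #hits z = ∑ (allFin p) (λ j → ind (g j ≟ z))
    defect : K → ℤ
    defect z = [ z ∈V 1 ] ℤ.- #hits z
    #hits-hit : ∀ j → #hits (g j) ≡ + 1
    #hits-hit j = trans (∑-cong (allFin p) (λ i → trans (when-⇔ (g i ≟ g j) (i Fin.≟ j) g-inj (cong g)) (sym (ℤₚ.*-identityʳ _)))) (∑-ind (Fin-finite p) j (λ _ → + 1))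
    #hits-miss : ∀ z → ¬ (∃ λ j → g j ≡ z) → #hits z ≡ + 0
    #hits-miss z ¬h = trans (∑-cong (allFin p) (λ i → when-no (g i ≟ z) (λ e → ¬h (i , e)))) (∑-ε (allFin p))
    defect≥0 : ∀ z → + 0 ℤ.≤ defect z
    defect≥0 z with any-finite? (Fin-finite p) (λ j → g j ≟ z)
    ... | yes (j , refl) = ℤₚ.≤-reflexive (sym (cong₂ ℤ._-_ (when-yes (V? 1 (g j)) (g∈V j)) (#hits-hit j)))
    ... | no ¬h = subst (+ 0 ℤ.≤_) (sym (trans (cong (λ w → [ z ∈V 1 ] ℤ.- w) (#hits-miss z ¬h)) (ℤₚ.+-identityʳ _))) (ind≥0 (V? 1 z))
    defect≡1 : defect y ≡ + 1
    defect≡1 = cong₂ ℤ._-_ (when-yes (V? 1 y) y∈V) (#hits-miss y ¬hit)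
    ∑defect : ∑ elems defect ≡ + 0
    ∑defect = begin
      ∑ elems defect                 ≡⟨ ∑-sub elems (λ z → [ z ∈V 1 ]) #hits ⟩
      ∣V∣ 1 ℤ.- ∑ elems #hits        ≡⟨ cong₂ ℤ._-_ ∣V1∣ (∑-swap elems (allFin p) _) ⟩
      + p ℤ.- ∑ (allFin p) (λ j → ∑ elems (λ z → ind (g j ≟ z)))
                                     ≡⟨ cong (λ w → + p ℤ.- w) (∑-cong (allFin p) (λ j → ∑-ind-one K-finite (g j))) ⟩
      + p ℤ.- ∑ (allFin p) (λ _ → + 1)
        ≡⟨ cong (λ w → + p ℤ.- w) (trans (∑-Fin-const p (+ 1)) (ℤₚ.*-identityʳ (+ p))) ⟩
      + p ℤ.- + p                    ≡⟨ ℤₚ.+-inverseʳ (+ p) ⟩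
      + 0                            ∎

  ι-onto : ∀ y → V 1 y → ∃ λ j → ι j ≡ y
  ι-onto = injective⇒onto-V1 ι V1-ι ι-inj

  private
    sumK-∷ʳ : ∀ xs y → sumK (xs ∷ʳ y) ≡ y + sumK xs
    sumK-∷ʳ []       y = refl
    sumK-∷ʳ (x ∷ xs) y = trans (cong (λ z → x + z) (sumK-∷ʳ xs y))
      (solve 3 (λ x y s → x :+ (y :+ s) := y :+ (x :+ s)) refl x y (sumK xs))

    sum-upTo : ∀ k x → sumK (map (λ i → φ i x) (upTo k)) ≡ T 1 k x
    sum-upTo zero    x = refl
    sum-upTo (suc k) x = begin
      sumK (map (λ i → φ i x) (upTo (suc k)))
        ≡⟨ cong (λ l → sumK (map (λ i → φ i x) l)) (sym (Listₚ.upTo-∷ʳ k)) ⟩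
      sumK (map (λ i → φ i x) (upTo k ∷ʳ k))
        ≡⟨ cong sumK (Listₚ.map-++ (λ i → φ i x) (upTo k) [ k ]) ⟩
      sumK (map (λ i → φ i x) (upTo k) ∷ʳ φ k x)
        ≡⟨ sumK-∷ʳ (map (λ i → φ i x) (upTo k)) (φ k x) ⟩
      φ k x + sumK (map (λ i → φ i x) (upTo k))
        ≡⟨ cong₂ _+_ (cong (λ m → φ m x) (sym (ℕₚ.*-identityʳ k))) (sum-upTo k x) ⟩
      φ (k ℕ.* 1) x + T 1 k x ∎

  Tr≡T : ∀ x → Tr x ≡ T 1 n x
  Tr≡T = sum-upTo n

  Tr-+ : ∀ x y → Tr (x + y) ≡ Tr x + Tr y
  Tr-+ x y = trans (Tr≡T _) (trans (T-+ 1 n x y) (sym (cong₂ _+_ (Tr≡T x) (Tr≡T y))))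

  T-scale : ∀ k {a} x → V 1 a → T 1 k (a * x) ≡ a * T 1 k x
  T-scale zero    {a} x va = sym (zeroʳ a)
  T-scale (suc k) {a} x va = trans
    (cong₂ _+_ (trans (φ-* (k ℕ.* 1) a x) (cong (λ z → z * φ (k ℕ.* 1) x) (V1⊆V (k ℕ.* 1) va))) (T-scale k x va))
    (sym (distribˡ a (φ (k ℕ.* 1) x) (T 1 k x)))

  Tr-scale : ∀ {a} x → V 1 a → Tr (a * x) ≡ a * Tr x
  Tr-scale {a} x va = trans (Tr≡T _) (trans (T-scale n x va) (cong (λ z → a * z) (sym (Tr≡T x))))

  Tr-neg : ∀ x → Tr (- x) ≡ - Tr x
  Tr-neg x = begin
    Tr (- x)          ≡⟨ cong Tr (sym (neg1* x)) ⟩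
    Tr (- 1# * x)     ≡⟨ Tr-scale x (V-neg {1} (V-1 {1})) ⟩
    - 1# * Tr x       ≡⟨ neg1* (Tr x) ⟩
    - Tr x            ∎
    where
    neg1* : ∀ y → - 1# * y ≡ - y
    neg1* y = trans (solve 2 (λ o y → (:- o) :* y := :- (o :* y)) refl 1# y) (cong -_ (*-identityˡ y))

  Tr-sub : ∀ x y → Tr (x - y) ≡ Tr x - Tr y
  Tr-sub x y = trans (Tr-+ x (- y)) (cong (λ z → Tr x + z) (Tr-neg y))

  Tr-0 : Tr 0# ≡ 0#
  Tr-0 = trans (cong Tr (sym (-‿inverseʳ 0#))) (trans (Tr-sub 0# 0#) (-‿inverseʳ _))

  Tr-φ₁ : ∀ x → Tr (φ 1 x) ≡ Tr x
  Tr-φ₁ x = trans (Tr≡T _) (trans (+-cancelˡ x (begin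
    x + T 1 n (φ 1 x)      ≡⟨ +-comm _ _ ⟩
    T 1 n (φ 1 x) + x      ≡⟨ T-telescope 1 n x ⟩
    T 1 n x + φ (n ℕ.* 1) x ≡⟨ cong (λ z → T 1 n x + z) (trans (cong (λ m → φ m x) (ℕₚ.*-identityʳ n)) (φ-n x)) ⟩
    T 1 n x + x            ≡⟨ +-comm _ _ ⟩
    x + T 1 n x            ∎)) (sym (Tr≡T x)))

  Tr-φ : ∀ i x → Tr (φ i x) ≡ Tr x
  Tr-φ zero    x = cong Tr (φ-zero x)
  Tr-φ (suc i) x = trans (cong Tr (sym (φ-φ 1 i x))) (trans (Tr-φ₁ (φ i x)) (Tr-φ i x))

  φ-T : ∀ k e x → φ e (T 1 k x) ≡ T 1 k (φ e x)
  φ-T zero    e x = φ-0 e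
  φ-T (suc k) e x = trans (φ-+ e _ _) (cong₂ _+_ (φ-comm e (k ℕ.* 1) x) (φ-T k e x))

  V1-Tr : ∀ x → V 1 (Tr x)
  V1-Tr x = begin
    φ 1 (Tr x)    ≡⟨ cong (φ 1) (Tr≡T x) ⟩
    φ 1 (T 1 n x) ≡⟨ φ-T n 1 x ⟩
    T 1 n (φ 1 x) ≡⟨ sym (Tr≡T (φ 1 x)) ⟩
    Tr (φ 1 x)    ≡⟨ Tr-φ₁ x ⟩
    Tr x          ∎

  Tr-1 : Tr 1# ≡ ιℕ n
  Tr-1 = trans (Tr≡T 1#) (go n)
    where
    go : ∀ k → T 1 k 1# ≡ ιℕ k
    go zero    = refl
    go (suc k) = cong₂ _+_ (φ-1 (k ℕ.* 1)) (go k)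

  Tr-V1 : ∀ {w} → V 1 w → Tr w ≡ w * ιℕ n
  Tr-V1 {w} vw = trans (cong Tr (sym (*-identityʳ w))) (trans (Tr-scale 1# vw) (cong (λ z → w * z) Tr-1))

  -- As `φ n` is the identity, x is fixed by `φ n` and `φ a`, hence by `φ 1` through a Bézout
  -- relation.
  fixed-coprime : ∀ a → gcd n a ≡ 1 → ∀ {x} → φ a x ≡ x → V 1 x
  fixed-coprime a n⊥a {x} va with bezout n a n⊥a
  ... | inj₁ (u , v , eq) = trans (cong (φ 1) (sym (φ-fixed-* v a x va)))
          (trans (φ-φ 1 (v ℕ.* a) x) (trans (cong (λ m → φ m x) eq) (φ-fixed-* u n x (φ-n x))))
  ... | inj₂ (u , v , eq) = trans (cong (φ 1) (sym (φ-fixed-* u n x (φ-n x))))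
          (trans (φ-φ 1 (u ℕ.* n) x) (trans (cong (λ m → φ m x) eq) (φ-fixed-* v a x va)))

  -- A natural number that represents -i modulo n, since i (n - 1) + i = i n; thus `φ (op i)` is the
  -- inverse of `φ i`.
  op : ℕ → ℕ
  op i = i ℕ.* (n ∸ 1)

  φ-op : ∀ i x → φ (op i) (φ i x) ≡ x
  φ-op i x = trans (φ-φ (op i) i x) (trans (cong (λ m → φ m x) eq) (φ-fixed-* i n x (φ-n x)))
    where
    eq : op i ℕ.+ i ≡ i ℕ.* n
    eq = trans (ℕₚ.+-comm (op i) i) (trans (sym (ℕₚ.*-suc i (n ∸ 1))) (cong (i ℕ.*_) (ℕₚ.m+[n∸m]≡n n≥1)))

  -- The translations x ↦ x + a v with a in F_p permute V d and carry the p level sets of h to one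
  -- another. This stands in for the vanishing of a character sum.
  equidistribution : ∀ d (h : K → K) v → V d v → (∀ x → V 1 (h x)) →
    (∀ a x → V 1 a → h (x + a * v) ≡ h x + a) → ∀ y → V 1 y →
    + p ℤ.* ∑ elems (λ x → [ x ∈V d ] ℤ.* ind (h x ≟ y)) ≡ ∣V∣ d
  equidistribution d h v v∈V h∈V1 shift y y∈V1 = begin
    + p ℤ.* N y                         ≡⟨ cong (+ p ℤ.*_) (N≡N0 y y∈V1) ⟩
    + p ℤ.* N 0#                        ≡⟨ cong (ℤ._* N 0#) (sym ∣V1∣) ⟩
    ∣V∣ 1 ℤ.* N 0#                      ≡⟨ sym (∑-*ʳ elems (N 0#) (λ z → [ z ∈V 1 ])) ⟩
    ∑ elems (λ z → [ z ∈V 1 ] ℤ.* N 0#) ≡⟨ ∑-cong elems N-restrict ⟩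
    ∑ elems N                           ≡⟨ ∑-swap elems elems _ ⟩
    ∑ elems (λ x → ∑ elems (λ z → [ x ∈V d ] ℤ.* ind (h x ≟ z)))
      ≡⟨ ∑-cong elems (λ x → trans (∑-*ˡ elems [ x ∈V d ] _) (trans (cong ([ x ∈V d ] ℤ.*_) (∑-ind-one K-finite (h x))) (ℤₚ.*-identityʳ _))) ⟩
    ∣V∣ d ∎
    where
    N : K → ℤ
    N z = ∑ elems (λ x → [ x ∈V d ] ℤ.* ind (h x ≟ z))
    N≡N0 : ∀ z → V 1 z → N z ≡ N 0#
    N≡N0 z vz = begin
      N z
        ≡⟨ sym (∑-permute K-finite (λ x → x + z * v) (λ x → x - z * v)
             (λ x → solve 2 (λ x a → (x :- a) :+ a := x) refl x (z * v))
             (λ x → solve 2 (λ x a → (x :+ a) :- a := x) refl x (z * v)) _) ⟩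
      ∑ elems (λ x → [ x + z * v ∈V d ] ℤ.* ind (h (x + z * v) ≟ z))
        ≡⟨ ∑-cong elems (λ x → cong₂ ℤ._*_
             (when-⇔ (V? d (x + z * v)) (V? d x)
               (λ e → subst (V d) (solve 2 (λ x a → (x :+ a) :- a := x) refl x (z * v)) (V-sub {d} e zv∈V))
               (λ e → V-+ {d} e zv∈V))
             (when-⇔ (h (x + z * v) ≟ z) (h x ≟ 0#)
               (λ e → +-cancelˡ z (trans (+-comm _ _) (trans (sym (shift z x vz)) (trans e (sym (+-identityʳ z))))))
               (λ e → trans (shift z x vz) (trans (cong (λ w → w + z) e) (+-identityˡ z))))) ⟩
      N 0# ∎
      where
      zv∈V : V d (z * v)
      zv∈V = V-* {d} (V1⊆V d vz) v∈V
    N-restrict : ∀ z → [ z ∈V 1 ] ℤ.* N 0# ≡ N z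
    N-restrict z with V? 1 z
    ... | yes vz = trans (ℤₚ.*-identityˡ _) (sym (N≡N0 z vz))
    ... | no ¬vz = sym (trans (∑-cong elems (λ x → trans (cong ([ x ∈V d ] ℤ.*_) (when-no (h x ≟ z) (λ e → ¬vz (subst (V 1) e (h∈V1 x))))) (ℤₚ.*-zeroʳ [ x ∈V d ]))) (∑-ε elems))

-- The quadratic form, its polar form and its radical.

record Parameters {p n : ℕ} (𝔽 : FiniteField p n) {{p≢0 : NonZero p}} : Set where
  open FiniteField 𝔽
  open FF 𝔽
  field
    c      : K
    r t    : ℕ
    c∈F    : pow c (p ℕ.^ 1) ≡ c
    c≢0    : c ≢ 0#
    n⊥r+t  : gcd n (r ℕ.+ t) ≡ 1
    n⊥∣r-t∣ : gcd n ∣ r - t ∣ ≡ 1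

module QuadraticForm {p n : ℕ} {{p≢0 : NonZero p}} (pr : Prime p) (𝔽 : FiniteField p n)
                     (n≥1 : 1 ℕ.≤ n) (n⊥p : gcd n p ≡ 1) (P : Parameters 𝔽) where
  open TraceTheory pr 𝔽 n≥1 n⊥p
  open Parameters P
  open Solver using (solve; _:=_; _:+_; _:*_; _:-_; :-_; con)
  open ≡-Reasoning

  φ-adjoint : ∀ i x y → Tr (φ i x * y) ≡ Tr (x * φ (op i) y)
  φ-adjoint i x y = begin
    Tr (φ i x * y)                        ≡⟨ sym (Tr-φ (op i) _) ⟩
    Tr (φ (op i) (φ i x * y))             ≡⟨ cong Tr (φ-* (op i) (φ i x) y) ⟩
    Tr (φ (op i) (φ i x) * φ (op i) y)    ≡⟨ cong (λ z → Tr (z * φ (op i) y)) (φ-op i x) ⟩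
    Tr (x * φ (op i) y)                   ∎

  Q : K → K
  Q x = c * (Tr (φ r x * x) - Tr (φ t x * x))

  -- The operator `φ r` plus its adjoint under the trace pairing (see `φ-adjoint`), minus the same
  -- for t; up to the factor c it represents the polar form.
  L : K → K
  L z = (φ r z + φ (op r) z) - (φ t z + φ (op t) z)

  private
    square : ∀ i x z → Tr (φ i (x + z) * (x + z)) ≡ Tr (φ i x * x) + Tr (φ i z * z) + Tr (x * (φ i z + φ (op i) z))
    square i x z = begin
      Tr (φ i (x + z) * (x + z))
        ≡⟨ cong (λ w → Tr (w * (x + z))) (φ-+ i x z) ⟩
      Tr ((φ i x + φ i z) * (x + z))
        ≡⟨ cong Tr (solve 4 (λ a b x z → (a :+ b) :* (x :+ z) := (a :* x :+ b :* z) :+ (x :* b :+ a :* z)) refl (φ i x) (φ i z) x z) ⟩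
      Tr ((φ i x * x + φ i z * z) + (x * φ i z + φ i x * z))
        ≡⟨ trans (Tr-+ _ _) (cong₂ _+_ (Tr-+ _ _) (Tr-+ _ _)) ⟩
      (Tr (φ i x * x) + Tr (φ i z * z)) + (Tr (x * φ i z) + Tr (φ i x * z))
        ≡⟨ cong (λ w → (Tr (φ i x * x) + Tr (φ i z * z)) + w) (trans (cong (λ w → Tr (x * φ i z) + w) (φ-adjoint i x z)) (trans (sym (Tr-+ _ _)) (cong Tr (sym (distribˡ x _ _))))) ⟩
      (Tr (φ i x * x) + Tr (φ i z * z)) + Tr (x * (φ i z + φ (op i) z)) ∎

  polar : ∀ x z → Q (x + z) ≡ Q x + Q z + c * Tr (x * L z)
  polar x z = begin
    c * (Tr (φ r (x + z) * (x + z)) - Tr (φ t (x + z) * (x + z)))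
      ≡⟨ cong₂ (λ a b → c * (a - b)) (square r x z) (square t x z) ⟩
    c * ((Tr (φ r x * x) + Tr (φ r z * z) + Tr (x * lr)) - (Tr (φ t x * x) + Tr (φ t z * z) + Tr (x * lt)))
      ≡⟨ solve 7 (λ c a b u a' b' u' → c :* ((a :+ b :+ u) :- (a' :+ b' :+ u')) := c :* (a :- a') :+ c :* (b :- b') :+ c :* (u :- u')) refl c _ _ _ _ _ _ ⟩
    Q x + Q z + c * (Tr (x * lr) - Tr (x * lt))
      ≡⟨ cong (λ w → Q x + Q z + c * w) (trans (sym (Tr-sub _ _)) (cong Tr (solve 3 (λ x a b → x :* a :- x :* b := x :* (a :- b)) refl x lr lt))) ⟩
    Q x + Q z + c * Tr (x * L z) ∎
    where
    lr = φ r z + φ (op r) z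
    lt = φ t z + φ (op t) z

  L-+ : ∀ x y → L (x + y) ≡ L x + L y
  L-+ x y = trans (cong₂ _-_ (cong₂ _+_ (φ-+ r x y) (φ-+ (op r) x y)) (cong₂ _+_ (φ-+ t x y) (φ-+ (op t) x y)))
    (solve 8 (λ a b c d a' b' c' d' → ((a :+ b) :+ (c :+ d)) :- ((a' :+ b') :+ (c' :+ d')) := ((a :+ c) :- (a' :+ c')) :+ ((b :+ d) :- (b' :+ d'))) refl _ _ _ _ _ _ _ _)

  -- This keeps the vector (L z)⁻¹ inside V d, so that the second moment can be computed on each
  -- subfield separately.
  L-V : ∀ {d z} → V d z → V d (L z)
  L-V {d} vz = V-sub {d} (V-+ {d} (V-φ {d} r vz) (V-φ {d} (op r) vz)) (V-+ {d} (V-φ {d} t vz) (V-φ {d} (op t) vz))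

  V1⇒L≡0 : ∀ {z} → V 1 z → L z ≡ 0#
  V1⇒L≡0 {z} vz = x≡y⇒x-y≡0 (cong₂ _+_ (trans (V1⊆V r vz) (sym (V1⊆V t vz))) (trans (V1⊆V (op r) vz) (sym (V1⊆V (op t) vz))))

  -- Frobenius preserves the trace, so both brackets of `L z` have trace 2 Tr z.
  Tr-L : ∀ z → Tr (L z) ≡ 0#
  Tr-L z = trans (Tr-sub _ _) (x≡y⇒x-y≡0 (trans (two r) (sym (two t))))
    where
    two : ∀ i → Tr (φ i z + φ (op i) z) ≡ Tr z + Tr z
    two i = trans (Tr-+ _ _) (cong₂ _+_ (Tr-φ i z) (Tr-φ (op i) z))

  -- φ r ∘ L factors as (φ (r + t) − 1) ∘ (φ (r − t) − 1); on the kernel the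
  -- second factor has a value in the prime field and of trace zero, and the
  -- trace of w in the prime field is n w.
  L≡0⇒V1 : ∀ {x} → L x ≡ 0# → V 1 x
  L≡0⇒V1 {x} Lx≡0 = φr≡φt⇒V1 φr≡φt
    where
    e : ℕ
    e = r ℕ.+ op t
    w : K
    w = φ e x - x

    φr-op : φ r (φ (op r) x) ≡ x
    φr-op = trans (φ-comm r (op r) x) (φ-op r x)

    factored : φ (r ℕ.+ t) w - w ≡ 0#
    factored = begin
      φ (r ℕ.+ t) w - w
        ≡⟨ cong (λ z → z - w) (φ-sub (r ℕ.+ t) (φ e x) x) ⟩
      (φ (r ℕ.+ t) (φ e x) - φ (r ℕ.+ t) x) - (φ e x - x)
        ≡⟨ cong (λ z → (z - φ (r ℕ.+ t) x) - (φ e x - x)) rr ⟩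
      (φ r (φ r x) - φ (r ℕ.+ t) x) - (φ e x - x)
        ≡⟨ cong₂ (λ a b → (φ r (φ r x) - a) - (b - x)) (sym (φ-φ r t x)) (sym (φ-φ r (op t) x)) ⟩
      (φ r (φ r x) - φ r (φ t x)) - (φ r (φ (op t) x) - x)
        ≡⟨ solve 4 (λ a b c x → (a :- b) :- (c :- x) := (a :+ x) :- (b :+ c)) refl _ _ _ _ ⟩
      (φ r (φ r x) + x) - (φ r (φ t x) + φ r (φ (op t) x))
        ≡⟨ cong (λ z → (φ r (φ r x) + z) - (φ r (φ t x) + φ r (φ (op t) x))) (sym φr-op) ⟩
      (φ r (φ r x) + φ r (φ (op r) x)) - (φ r (φ t x) + φ r (φ (op t) x))
        ≡⟨ sym (trans (φ-sub r _ _) (cong₂ _-_ (φ-+ r _ _) (φ-+ r _ _))) ⟩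
      φ r (L x)
        ≡⟨ trans (cong (φ r) Lx≡0) (φ-0 r) ⟩
      0# ∎
      where
      rr : φ (r ℕ.+ t) (φ e x) ≡ φ r (φ r x)
      rr = begin
        φ (r ℕ.+ t) (φ e x)            ≡⟨ sym (φ-φ r t _) ⟩
        φ r (φ t (φ e x))              ≡⟨ cong (φ r ∘ φ t) (sym (φ-φ r (op t) x)) ⟩
        φ r (φ t (φ r (φ (op t) x)))   ≡⟨ cong (φ r) (φ-comm t r _) ⟩
        φ r (φ r (φ t (φ (op t) x)))   ≡⟨ cong (φ r ∘ φ r) (trans (φ-comm t (op t) x) (φ-op t x)) ⟩
        φ r (φ r x)                    ∎

    w∈V1 : V 1 w
    w∈V1 = fixed-coprime (r ℕ.+ t) n⊥r+t (x-y≡0⇒x≡y factored)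

    w≡0 : w ≡ 0#
    w≡0 with integral (trans (sym (Tr-V1 w∈V1)) (trans (Tr-sub (φ e x) x) (x≡y⇒x-y≡0 (Tr-φ e x))))
    ... | inj₁ eq = eq
    ... | inj₂ eq = contradiction eq ιn≢0

    φr≡φt : φ r x ≡ φ t x
    φr≡φt = begin
      φ r x                    ≡⟨ cong (φ r) (sym (trans (φ-comm t (op t) x) (φ-op t x))) ⟩
      φ r (φ t (φ (op t) x))   ≡⟨ φ-comm r t _ ⟩
      φ t (φ r (φ (op t) x))   ≡⟨ cong (φ t) (φ-φ r (op t) x) ⟩
      φ t (φ e x)              ≡⟨ cong (φ t) (x-y≡0⇒x≡y w≡0) ⟩
      φ t x                    ∎

    cancel : ∀ a b → a ℕ.≤ b → φ a x ≡ φ b x → φ ∣ a - b ∣ x ≡ x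
    cancel a b a≤b eq = x-y≡0⇒x≡y (φ-inj a _ (trans (φ-sub a _ _) (x≡y⇒x-y≡0
      (trans (φ-φ a ∣ a - b ∣ x) (trans (cong (λ m → φ m x) (trans (cong (a ℕ.+_) (ℕₚ.m≤n⇒∣m-n∣≡n∸m a≤b)) (ℕₚ.m+[n∸m]≡n a≤b))) (sym eq))))))

    φr≡φt⇒V1 : φ r x ≡ φ t x → V 1 x
    φr≡φt⇒V1 eq with ℕₚ.≤-total r t
    ... | inj₁ r≤t = fixed-coprime ∣ r - t ∣ n⊥∣r-t∣ (cancel r t r≤t eq)
    ... | inj₂ t≤r = fixed-coprime ∣ r - t ∣ n⊥∣r-t∣ (subst (λ m → φ m x ≡ x) (ℕₚ.∣-∣-comm t r) (cancel t r t≤r (sym eq)))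

  V1-Q : ∀ x → V 1 (Q x)
  V1-Q x = V-* {1} c∈F (V-sub {1} (V1-Tr _) (V1-Tr _))

  Q-φ : ∀ i x → Q (φ i x) ≡ Q x
  Q-φ i x = cong₂ (λ a b → c * (a - b)) (inv r) (inv t)
    where
    inv : ∀ j → Tr (φ j (φ i x) * φ i x) ≡ Tr (φ j x * x)
    inv j = trans (cong (λ z → Tr (z * φ i x)) (φ-comm j i x)) (trans (cong Tr (sym (φ-* i _ _))) (Tr-φ i _))

  Q-scale : ∀ {a} x → V 1 a → Q (a * x) ≡ (a * a) * Q x
  Q-scale {a} x va = trans (cong₂ (λ u v → c * (u - v)) (sc r) (sc t))
    (solve 4 (λ c s u v → c :* (s :* u :- s :* v) := s :* (c :* (u :- v))) refl c (a * a) _ _)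
    where
    sc : ∀ j → Tr (φ j (a * x) * (a * x)) ≡ (a * a) * Tr (φ j x * x)
    sc j = trans (cong Tr (trans (cong (λ z → z * (a * x)) (trans (φ-* j a x) (cong (λ z → z * φ j x) (V1⊆V j va))))
             (solve 3 (λ a x y → (a :* y) :* (a :* x) := (a :* a) :* (y :* x)) refl a x (φ j x))))
           (Tr-scale _ (V-* {1} va va))

  Q-V1 : ∀ {z} → V 1 z → Q z ≡ 0#
  Q-V1 {z} vz = trans (cong (λ w → c * w) (x≡y⇒x-y≡0 (cong (λ w → Tr (w * z)) (trans (V1⊆V r vz) (sym (V1⊆V t vz)))))) (zeroʳ c)

-- Squares and nonsquares of the prime field.

ind-yes : {P : Set} (d : Dec P) → P → ind d ≡ + 1
ind-yes d = when-yes d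

-- Take a function on F_p with value N₀ at 0, N₁ on the nonzero squares and N₂ on the nonsquares.
-- The left side is 4 (p Σ N² - (Σ N)²); the doubled sums avoid the class size (p - 1)/2.
moments-identity : ∀ P N₀ N₁ N₂ →
  + 2 ℤ.* P ℤ.* (+ 2 ℤ.* (N₀ ℤ.* N₀) ℤ.+ (P ℤ.- + 1) ℤ.* (N₁ ℤ.* N₁ ℤ.+ N₂ ℤ.* N₂))
    ℤ.- (+ 2 ℤ.* N₀ ℤ.+ (P ℤ.- + 1) ℤ.* (N₁ ℤ.+ N₂)) ℤ.* (+ 2 ℤ.* N₀ ℤ.+ (P ℤ.- + 1) ℤ.* (N₁ ℤ.+ N₂))
  ≡ (P ℤ.- + 1) ℤ.* (((N₀ ℤ.- N₁) ℤ.+ (N₀ ℤ.- N₂)) ℤ.* ((N₀ ℤ.- N₁) ℤ.+ (N₀ ℤ.- N₂)) ℤ.+ P ℤ.* ((N₂ ℤ.- N₁) ℤ.* (N₂ ℤ.- N₁)))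
moments-identity = ℤSolver.solve-∀

module SquareClasses {p n : ℕ} {{p≢0 : NonZero p}} (pr : Prime p) (𝔽 : FiniteField p n)
                     (n≥1 : 1 ℕ.≤ n) (n⊥p : gcd n p ≡ 1) (p-odd : ¬ (2 ∣ p)) where
  open TraceTheory pr 𝔽 n≥1 n⊥p
  open Solver using (solve; _:=_; _:+_; _:*_; _:-_; :-_; con)
  open ≡-Reasoning

  1≢-1 : 1# ≢ - 1#
  1≢-1 eq = p-odd (subst (2 ∣_) 2≡p ∣-refl)
    where
    p∣2 : p ∣ 2
    p∣2 = ιℕ≡0⇒p∣ 2 (trans (cong (λ z → 1# + z) (trans (+-identityʳ 1#) eq)) (-‿inverseʳ 1#))
    2≡p : 2 ≡ p
    2≡p = ℕₚ.≤-antisym p>1 (∣⇒≤ p∣2)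

  #roots : K → K → ℤ
  #roots μ y = ∑ elems (λ a → [ a ∈V 1 ] ℤ.* ind ((μ * (a * a)) ≟ y))

  ∑-#roots* : ∀ μ (f : K → ℤ) → ∑ elems (λ y → #roots μ y ℤ.* f y) ≡ ∑ elems (λ a → [ a ∈V 1 ] ℤ.* f (μ * (a * a)))
  ∑-#roots* μ f = begin
    ∑ elems (λ y → #roots μ y ℤ.* f y)
      ≡⟨ ∑-cong elems (λ y → sym (∑-*ʳ elems (f y) _)) ⟩
    ∑ elems (λ y → ∑ elems (λ a → [ a ∈V 1 ] ℤ.* ind ((μ * (a * a)) ≟ y) ℤ.* f y))
      ≡⟨ ∑-swap elems elems _ ⟩
    ∑ elems (λ a → ∑ elems (λ y → [ a ∈V 1 ] ℤ.* ind ((μ * (a * a)) ≟ y) ℤ.* f y))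
      ≡⟨ ∑-cong elems (λ a → trans (∑-cong elems (λ y → ℤₚ.*-assoc [ a ∈V 1 ] _ (f y)))
           (trans (∑-*ˡ elems [ a ∈V 1 ] _) (cong ([ a ∈V 1 ] ℤ.*_) (∑-ind′ K-finite (μ * (a * a)) f)))) ⟩
    ∑ elems (λ a → [ a ∈V 1 ] ℤ.* f (μ * (a * a))) ∎

  ∑-#roots : ∀ μ → ∑ elems (#roots μ) ≡ + p
  ∑-#roots μ = trans (∑-cong elems (λ y → sym (ℤₚ.*-identityʳ _)))
    (trans (∑-#roots* μ (λ _ → + 1)) (trans (∑-cong elems (λ a → ℤₚ.*-identityʳ _)) ∣V1∣))

  HasRoot : K → K → Set
  HasRoot μ y = ∃ λ a → V 1 a × μ * (a * a) ≡ y

  hasRoot? : ∀ μ y → Dec (HasRoot μ y)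
  hasRoot? μ y = any-finite? K-finite (λ a → V? 1 a ×-dec ((μ * (a * a)) ≟ y))

  #roots-none : ∀ μ y → ¬ HasRoot μ y → #roots μ y ≡ + 0
  #roots-none μ y ¬root = trans (∑-cong elems zero-term) (∑-ε elems)
    where
    zero-term : ∀ a → [ a ∈V 1 ] ℤ.* ind ((μ * (a * a)) ≟ y) ≡ + 0
    zero-term a with V? 1 a
    ... | no _   = refl
    ... | yes va = trans (ℤₚ.*-identityˡ _) (when-no ((μ * (a * a)) ≟ y) (λ e → ¬root (a , va , e)))

  sqrt-unique : ∀ {μ} a b → μ ≢ 0# → μ * (a * a) ≡ μ * (b * b) → a ≡ b ⊎ a ≡ - b
  sqrt-unique {μ} a b μ≢0 eq with integral {a - b} {a + b}
    (trans (solve 2 (λ a b → (a :- b) :* (a :+ b) := (a :* a) :- (b :* b)) refl a b) (x≡y⇒x-y≡0 (*-cancelˡ μ μ≢0 eq)))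
  ... | inj₁ e = inj₁ (x-y≡0⇒x≡y e)
  ... | inj₂ e = inj₂ (x-y≡0⇒x≡y (trans (solve 2 (λ a b → a :- (:- b) := a :+ b) refl a b) e))

  #roots-≤2 : ∀ μ y → μ ≢ 0# → #roots μ y ℤ.≤ + 2
  #roots-≤2 μ y μ≢0 with hasRoot? μ y
  ... | no ¬root = subst (ℤ._≤ + 2) (sym (#roots-none μ y ¬root)) (ℤ.+≤+ z≤n)
  ... | yes (b , vb , refl) = ℤₚ.≤-trans (∑-mono elems bound)
        (ℤₚ.≤-reflexive (trans (∑-∙ elems _ _) (cong₂ ℤ._+_ (∑-ind-one K-finite b) (∑-ind-one K-finite (- b)))))
    where
    bound : ∀ a → [ a ∈V 1 ] ℤ.* ind ((μ * (a * a)) ≟ (μ * (b * b))) ℤ.≤ ind (b ≟ a) ℤ.+ ind ((- b) ≟ a)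
    bound a with V? 1 a | (μ * (a * a)) ≟ (μ * (b * b))
    ... | no _  | _    = ℤₚ.+-mono-≤ (ind≥0 (b ≟ a)) (ind≥0 ((- b) ≟ a))
    ... | yes _ | no _ = ℤₚ.+-mono-≤ (ind≥0 (b ≟ a)) (ind≥0 ((- b) ≟ a))
    ... | yes _ | yes e with sqrt-unique a b μ≢0 e
    ...   | inj₁ refl = ℤₚ.+-mono-≤ (ℤₚ.≤-reflexive (sym (ind-yes (a ≟ a) refl))) (ind≥0 ((- a) ≟ a))
    ...   | inj₂ refl = ℤₚ.+-mono-≤ (ind≥0 (b ≟ (- b))) (ℤₚ.≤-reflexive (sym (ind-yes ((- b) ≟ (- b)) refl)))

  #roots-0≤1 : ∀ μ → μ ≢ 0# → #roots μ 0# ℤ.≤ + 1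
  #roots-0≤1 μ μ≢0 = ℤₚ.≤-trans (∑-mono elems bound) (ℤₚ.≤-reflexive (∑-ind-one K-finite 0#))
    where
    bound : ∀ a → [ a ∈V 1 ] ℤ.* ind ((μ * (a * a)) ≟ 0#) ℤ.≤ ind (0# ≟ a)
    bound a with V? 1 a | (μ * (a * a)) ≟ 0#
    ... | no _  | _    = ind≥0 (0# ≟ a)
    ... | yes _ | no _ = ind≥0 (0# ≟ a)
    ... | yes _ | yes e with integral e
    ...   | inj₁ μ≡0 = contradiction μ≡0 μ≢0
    ...   | inj₂ aa≡0 with integral aa≡0
    ...     | inj₁ refl = ℤₚ.≤-reflexive (sym (ind-yes (a ≟ a) refl))
    ...     | inj₂ refl = ℤₚ.≤-reflexive (sym (ind-yes (a ≟ a) refl))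

  #roots≥0 : ∀ μ y → + 0 ℤ.≤ #roots μ y
  #roots≥0 μ y = ∑≥0 elems nonneg
    where
    nonneg : ∀ a → + 0 ℤ.≤ [ a ∈V 1 ] ℤ.* ind ((μ * (a * a)) ≟ y)
    nonneg a with V? 1 a
    ... | no _  = ℤₚ.≤-refl
    ... | yes _ = subst (+ 0 ℤ.≤_) (sym (ℤₚ.*-identityˡ _)) (ind≥0 ((μ * (a * a)) ≟ y))

  #roots-hit≥1 : ∀ μ y → HasRoot μ y → + 1 ℤ.≤ #roots μ y
  #roots-hit≥1 μ y (b , vb , e) = ℤₚ.≤-trans (ℤₚ.≤-reflexive (sym (∑-ind-one K-finite b))) (∑-mono elems bound)
    where
    bound : ∀ a → ind (b ≟ a) ℤ.≤ [ a ∈V 1 ] ℤ.* ind ((μ * (a * a)) ≟ y)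
    bound a with b ≟ a
    ... | yes refl = ℤₚ.≤-reflexive (sym (cong₂ ℤ._*_ (ind-yes (V? 1 b) vb) (ind-yes ((μ * (b * b)) ≟ y) e)))
    ... | no _ with V? 1 a
    ...   | no _ = ℤₚ.≤-refl
    ...   | yes _ = subst (+ 0 ℤ.≤_) (sym (ℤₚ.*-identityˡ _)) (ind≥0 ((μ * (a * a)) ≟ y))

  #roots-1≥2 : + 2 ℤ.≤ #roots 1# 1#
  #roots-1≥2 = ℤₚ.≤-trans
    (ℤₚ.≤-reflexive (sym (trans (∑-∙ elems _ _) (cong₂ ℤ._+_ (∑-ind-one K-finite 1#) (∑-ind-one K-finite (- 1#))))))
    (∑-mono elems bound)
    where
    sq1 : 1# * (1# * 1#) ≡ 1#
    sq1 = trans (*-identityˡ _) (*-identityˡ 1#)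
    sq-1 : 1# * (- 1# * - 1#) ≡ 1#
    sq-1 = trans (solve 1 (λ o → o :* ((:- o) :* (:- o)) := o :* (o :* o)) refl 1#) sq1
    bound : ∀ a → ind (1# ≟ a) ℤ.+ ind ((- 1#) ≟ a) ℤ.≤ [ a ∈V 1 ] ℤ.* ind ((1# * (a * a)) ≟ 1#)
    bound a with 1# ≟ a | (- 1#) ≟ a
    ... | yes refl | yes e   = contradiction (sym e) 1≢-1
    ... | yes refl | no _    = ℤₚ.≤-reflexive (sym (cong₂ ℤ._*_ (ind-yes (V? 1 1#) (V-1 {1})) (ind-yes ((1# * (1# * 1#)) ≟ 1#) sq1)))
    ... | no _     | yes refl = ℤₚ.≤-reflexive (sym (cong₂ ℤ._*_ (ind-yes (V? 1 (- 1#)) (V-neg {1} (V-1 {1}))) (ind-yes ((1# * (- 1# * - 1#)) ≟ 1#) sq-1)))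
    ... | no _     | no _ with V? 1 a
    ...   | no _  = ℤₚ.≤-refl
    ...   | yes _ = subst (+ 0 ℤ.≤_) (sym (ℤₚ.*-identityˡ _)) (ind≥0 ((1# * (a * a)) ≟ 1#))

  -- If all of F_p were squares, the p values a² would hit each element exactly once, but 1 is hit
  -- by both 1 and -1.
  nonsquare : ∃ λ ν → V 1 ν × ¬ HasRoot 1# ν
  nonsquare with any-finite? K-finite (λ y → V? 1 y ×-dec ¬? (hasRoot? 1# y))
  ... | yes found = found
  ... | no none = contradiction #roots-1≥2 (ℤₚ.<⇒≱ (subst (ℤ._< + 2) (sym exactly1) (ℤ.+<+ (s≤s (s≤s z≤n)))))
    where
    excess : K → ℤ
    excess y = #roots 1# y ℤ.- [ y ∈V 1 ]
    excess≥0 : ∀ y → + 0 ℤ.≤ excess y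
    excess≥0 y with V? 1 y
    ... | no _ = subst (+ 0 ℤ.≤_) (sym (ℤₚ.+-identityʳ _)) (#roots≥0 1# y)
    ... | yes vy with hasRoot? 1# y
    ...   | yes root = ℤₚ.i≤j⇒0≤j-i (#roots-hit≥1 1# y root)
    ...   | no ¬root = contradiction (y , vy , ¬root) none
    ∑excess : ∑ elems excess ≡ + 0
    ∑excess = trans (∑-sub elems _ _) (trans (cong₂ ℤ._-_ (∑-#roots 1#) ∣V1∣) (ℤₚ.+-inverseʳ (+ p)))
    exactly1 : #roots 1# 1# ≡ + 1
    exactly1 = trans (ℤₚ.i-j≡0⇒i≡j _ _ (∑≡0⇒each≡0 elems excess≥0 ∑excess (complete 1#))) (ind-yes (V? 1 1#) (V-1 {1}))

  ν : K
  ν = proj₁ nonsquare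

  ν∈V1 : V 1 ν
  ν∈V1 = proj₁ (proj₂ nonsquare)

  ν≢0 : ν ≢ 0#
  ν≢0 ν≡0 = proj₂ (proj₂ nonsquare) (0# , V-0 {1} , trans (solve 1 (λ o → o :* (con (+ 0) :* con (+ 0)) := con (+ 0)) refl 1#) (sym ν≡0))

  1≢0 : 1# ≢ 0#
  1≢0 = 0≢1 ∘ sym

  -- From a² = ν b² it would follow that ν = (a/b)².
  not-both : ∀ {y} → y ≢ 0# → HasRoot 1# y → HasRoot ν y → ⊥
  not-both {y} y≢0 (a , va , ea) (b , vb , eb) = proj₂ (proj₂ nonsquare) (a * b ⁻¹ , V-* {1} va (V-⁻¹ {1} b≢0 vb) , (begin
    1# * ((a * b ⁻¹) * (a * b ⁻¹))      ≡⟨ solve 3 (λ o a b → o :* ((a :* b) :* (a :* b)) := (o :* (a :* a)) :* (b :* b)) refl 1# a (b ⁻¹) ⟩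
    (1# * (a * a)) * (b ⁻¹ * b ⁻¹)      ≡⟨ cong (λ z → z * (b ⁻¹ * b ⁻¹)) (trans ea (sym eb)) ⟩
    (ν * (b * b)) * (b ⁻¹ * b ⁻¹)       ≡⟨ solve 3 (λ n a b → (n :* (a :* a)) :* (b :* b) := n :* ((a :* b) :* (a :* b))) refl ν b (b ⁻¹) ⟩
    ν * ((b * b ⁻¹) * (b * b ⁻¹))       ≡⟨ cong (λ z → ν * (z * z)) (inverse b b≢0) ⟩
    ν * (1# * 1#)                       ≡⟨ trans (cong (λ z → ν * z) (*-identityˡ 1#)) (*-identityʳ ν) ⟩
    ν                                   ∎))
    where
    b≢0 : b ≢ 0#
    b≢0 refl = y≢0 (trans (sym eb) (solve 1 (λ n → n :* (con (+ 0) :* con (+ 0)) := con (+ 0)) refl ν))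

  HasRoot⇒V1 : ∀ {μ y} → V 1 μ → HasRoot μ y → V 1 y
  HasRoot⇒V1 vμ (a , va , refl) = V-* {1} vμ (V-* {1} va va)

  private
    2[V1] : K → ℤ
    2[V1] y = [ y ∈V 1 ] ℤ.+ [ y ∈V 1 ]

    both : K → ℤ
    both y = #roots 1# y ℤ.+ #roots ν y

    both≤2 : ∀ y → both y ℤ.≤ 2[V1] y
    both≤2 y with V? 1 y
    ... | no ¬vy = ℤₚ.≤-reflexive (cong₂ ℤ._+_ (#roots-none 1# y (λ h → ¬vy (HasRoot⇒V1 (V-1 {1}) h))) (#roots-none ν y (λ h → ¬vy (HasRoot⇒V1 ν∈V1 h))))
    ... | yes vy with y ≟ 0#
    ...   | yes refl = ℤₚ.+-mono-≤ (#roots-0≤1 1# 1≢0) (#roots-0≤1 ν ν≢0)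
    ...   | no y≢0 with hasRoot? 1# y
    ...     | no ¬root = ℤₚ.+-mono-≤ {#roots 1# y} {+ 0} {#roots ν y} {+ 2} (ℤₚ.≤-reflexive (#roots-none 1# y ¬root)) (#roots-≤2 ν y ν≢0)
    ...     | yes root = ℤₚ.+-mono-≤ {#roots 1# y} {+ 2} {#roots ν y} {+ 0} (#roots-≤2 1# y 1≢0) (ℤₚ.≤-reflexive (#roots-none ν y (not-both y≢0 root)))

  -- The values a² and ν a² together cover F_p exactly twice: at most 1 + 1 times at 0 and 2 + 0 or
  -- 0 + 2 times elsewhere, and the total is 2p.
  #roots-1+ν : ∀ y → #roots 1# y ℤ.+ #roots ν y ≡ [ y ∈V 1 ] ℤ.+ [ y ∈V 1 ]
  #roots-1+ν y = sym (ℤₚ.i-j≡0⇒i≡j _ _ (∑≡0⇒each≡0 elems {λ y → 2[V1] y ℤ.- both y} (λ y → ℤₚ.i≤j⇒0≤j-i (both≤2 y)) total (complete y)))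
    where
    total : ∑ elems (λ y → 2[V1] y ℤ.- both y) ≡ + 0
    total = trans (∑-sub elems 2[V1] both) (trans (cong₂ ℤ._-_
      (trans (∑-∙ elems _ _) (cong₂ ℤ._+_ ∣V1∣ ∣V1∣))
      (trans (∑-∙ elems _ _) (cong₂ ℤ._+_ (∑-#roots 1#) (∑-#roots ν)))) (ℤₚ.+-inverseʳ (+ p ℤ.+ + p)))

  SquareInvariant : (K → ℤ) → Set
  SquareInvariant f = ∀ a y → V 1 a → a ≢ 0# → f ((a * a) * y) ≡ f y

  square-dichotomy : ∀ y → V 1 y → HasRoot 1# y ⊎ HasRoot ν y
  square-dichotomy y vy with hasRoot? 1# y | hasRoot? ν y
  ... | yes root | _        = inj₁ root
  ... | no _     | yes root = inj₂ root
  ... | no ¬1    | no ¬ν    = contradiction (trans (sym (cong₂ ℤ._+_ (#roots-none 1# y ¬1) (#roots-none ν y ¬ν)))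
      (trans (#roots-1+ν y) (cong₂ ℤ._+_ (ind-yes (V? 1 y) vy) (ind-yes (V? 1 y) vy)))) (λ ())

  -- By `#roots-1+ν` twice the sum runs once over the values a² and once over the values ν a²; each
  -- run gives f 0 for a = 0 and p - 1 equal terms.
  ∑-SquareInvariant : (f : K → ℤ) → SquareInvariant f →
    + 2 ℤ.* ∑ elems (λ y → [ y ∈V 1 ] ℤ.* f y) ≡ + 2 ℤ.* f 0# ℤ.+ (+ p ℤ.- + 1) ℤ.* (f 1# ℤ.+ f ν)
  ∑-SquareInvariant f inv = begin
    + 2 ℤ.* ∑ elems (λ y → [ y ∈V 1 ] ℤ.* f y)
      ≡⟨ sym (∑-*ˡ elems (+ 2) _) ⟩
    ∑ elems (λ y → + 2 ℤ.* ([ y ∈V 1 ] ℤ.* f y))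
      ≡⟨ ∑-cong elems (λ y → trans (double [ y ∈V 1 ] (f y)) (trans (cong (ℤ._* f y) (sym (#roots-1+ν y))) (ℤₚ.*-distribʳ-+ (f y) (#roots 1# y) (#roots ν y)))) ⟩
    ∑ elems (λ y → #roots 1# y ℤ.* f y ℤ.+ #roots ν y ℤ.* f y)
      ≡⟨ trans (∑-∙ elems _ _) (cong₂ ℤ._+_ (∑-#roots* 1# f) (∑-#roots* ν f)) ⟩
    ∑ elems (λ a → [ a ∈V 1 ] ℤ.* f (1# * (a * a))) ℤ.+ ∑ elems (λ a → [ a ∈V 1 ] ℤ.* f (ν * (a * a)))
      ≡⟨ cong₂ ℤ._+_ (half 1#) (half ν) ⟩
    (f 0# ℤ.+ (+ p ℤ.- + 1) ℤ.* f 1#) ℤ.+ (f 0# ℤ.+ (+ p ℤ.- + 1) ℤ.* f ν)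
      ≡⟨ collect (f 0#) (+ p ℤ.- + 1) (f 1#) (f ν) ⟩
    + 2 ℤ.* f 0# ℤ.+ (+ p ℤ.- + 1) ℤ.* (f 1# ℤ.+ f ν) ∎
    where
    double : ∀ a b → + 2 ℤ.* (a ℤ.* b) ≡ (a ℤ.+ a) ℤ.* b
    double = ℤSolver.solve-∀
    collect : ∀ a k b c → (a ℤ.+ k ℤ.* b) ℤ.+ (a ℤ.+ k ℤ.* c) ≡ + 2 ℤ.* a ℤ.+ k ℤ.* (b ℤ.+ c)
    collect = ℤSolver.solve-∀
    regroup : ∀ a b v → v ℤ.* b ℤ.+ + 1 ℤ.* (a ℤ.- b) ≡ a ℤ.+ (v ℤ.- + 1) ℤ.* b
    regroup = ℤSolver.solve-∀
    half : ∀ μ → ∑ elems (λ a → [ a ∈V 1 ] ℤ.* f (μ * (a * a))) ≡ f 0# ℤ.+ (+ p ℤ.- + 1) ℤ.* f μ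
    half μ = begin
      ∑ elems (λ a → [ a ∈V 1 ] ℤ.* f (μ * (a * a)))
        ≡⟨ ∑-cong elems split ⟩
      ∑ elems (λ a → [ a ∈V 1 ] ℤ.* f μ ℤ.+ ind (0# ≟ a) ℤ.* (f 0# ℤ.- f μ))
        ≡⟨ trans (∑-∙ elems _ _) (cong₂ ℤ._+_ (∑-*ʳ elems (f μ) _) (∑-*ʳ elems (f 0# ℤ.- f μ) _)) ⟩
      ∣V∣ 1 ℤ.* f μ ℤ.+ ∑ elems (λ a → ind (0# ≟ a)) ℤ.* (f 0# ℤ.- f μ)
        ≡⟨ cong₂ (λ u v → u ℤ.* f μ ℤ.+ v ℤ.* (f 0# ℤ.- f μ)) ∣V1∣ (∑-ind-one K-finite 0#) ⟩
      + p ℤ.* f μ ℤ.+ + 1 ℤ.* (f 0# ℤ.- f μ)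
        ≡⟨ regroup (f 0#) (f μ) (+ p) ⟩
      f 0# ℤ.+ (+ p ℤ.- + 1) ℤ.* f μ ∎
      where
      b+[a-b] : ∀ a b → + 1 ℤ.* b ℤ.+ + 1 ℤ.* (a ℤ.- b) ≡ a
      b+[a-b] = ℤSolver.solve-∀
      split : ∀ a → [ a ∈V 1 ] ℤ.* f (μ * (a * a)) ≡ [ a ∈V 1 ] ℤ.* f μ ℤ.+ ind (0# ≟ a) ℤ.* (f 0# ℤ.- f μ)
      split a with 0# ≟ a
      ... | yes refl = trans (cong₂ ℤ._*_ (ind-yes (V? 1 0#) (V-0 {1})) (cong f (solve 1 (λ m → m :* (con (+ 0) :* con (+ 0)) := con (+ 0)) refl μ)))
             (trans (ℤₚ.*-identityˡ _) (sym (trans (cong (λ w → w ℤ.* f μ ℤ.+ + 1 ℤ.* (f 0# ℤ.- f μ)) (ind-yes (V? 1 0#) (V-0 {1}))) (b+[a-b] (f 0#) (f μ)))))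
      ... | no 0≢a with V? 1 a
      ...   | no _   = refl
      ...   | yes va = trans (cong (+ 1 ℤ.*_) (trans (cong f (*-comm μ (a * a))) (inv a μ va (0≢a ∘ sym)))) (sym (ℤₚ.+-identityʳ _))

-- Frobenius orbits of prime length.

argmin : (f : ℕ → ℕ) (k : ℕ) → ∃ λ i → i ℕ.< suc k × (∀ j → j ℕ.< suc k → f i ℕ.≤ f j)
argmin f zero = 0 , s≤s z≤n , λ { zero _ → ℕₚ.≤-refl ; (suc _) (s≤s ()) }
argmin f (suc k) with argmin f k
... | i , i<k , min with ℕₚ.≤-total (f i) (f (suc k))
...   | inj₁ fi≤ = i , ℕₚ.m<n⇒m<1+n i<k , λ j j<  → lower j (ℕₚ.m≤n⇒m<n∨m≡n j<)
  where
  lower : ∀ j → suc j ℕ.< suc (suc k) ⊎ suc j ≡ suc (suc k) → f i ℕ.≤ f j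
  lower j (inj₁ (s≤s j<)) = min j j<
  lower j (inj₂ refl)     = fi≤
...   | inj₂ ≤fi = suc k , ℕₚ.≤-refl , λ j j< → lower j (ℕₚ.m≤n⇒m<n∨m≡n j<)
  where
  lower : ∀ j → suc j ℕ.< suc (suc k) ⊎ suc j ≡ suc (suc k) → f (suc k) ℕ.≤ f j
  lower j (inj₁ (s≤s j<)) = ℕₚ.≤-trans ≤fi (min j j<)
  lower j (inj₂ refl)     = ℕₚ.≤-refl

module _ {A : Set} (F : Finite A) where
  open Finite F

  position : A → ℕ
  position x = toℕ (Any.index (complete x))

  position-injective : ∀ {x y} → position x ≡ position y → x ≡ y
  position-injective {x} {y} eq = trans (lookup-index (complete x))
    (trans (cong (lookup elements) (Finₚ.toℕ-injective eq)) (sym (lookup-index (complete y))))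

module OrbitCounting {p n : ℕ} {{p≢0 : NonZero p}} (pr : Prime p) (𝔽 : FiniteField p n)
                     (n≥1 : 1 ℕ.≤ n) (n⊥p : gcd n p ≡ 1) where
  open TraceTheory pr 𝔽 n≥1 n⊥p
  open ≡-Reasoning

  V-φ⁻¹ : ∀ e i x → V e (φ i x) → V e x
  V-φ⁻¹ e i x v = subst (V e) (φ-op i x) (V-φ {e} (op i) v)

  ∑-φ : ∀ i (f : K → ℤ) → ∑ elems (f ∘ φ i) ≡ ∑ elems f
  ∑-φ i = ∑-permute K-finite (φ i) (φ (op i)) (λ y → trans (φ-comm i (op i) y) (φ-op i y)) (φ-op i)

  module _ (d ℓ-1 : ℕ) (ℓ-prime : Prime (suc ℓ-1)) where
    private
      ℓ = suc ℓ-1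

      pos : K → ℕ
      pos = position K-finite

      -- The representative of an orbit is the point that comes first in the enumeration of K, so no
      -- quotient is formed.
      Leader : K → Set
      Leader x = ∀ (i : Fin ℓ) → pos x ℕ.≤ pos (φ (toℕ i ℕ.* d) x)

      leader? : ∀ x → Dec (Leader x)
      leader? x = Finₚ.all? (λ i → pos x ℕ.≤? pos (φ (toℕ i ℕ.* d) x))

      [leader] : K → ℤ
      [leader] x = ind (leader? x)

      Moved : K → Set
      Moved x = V (ℓ ℕ.* d) x × ¬ V d x

      moved? : ∀ x → Dec (Moved x)
      moved? x = V? (ℓ ℕ.* d) x ×-dec ¬? (V? d x)

      [moved] : K → ℤ
      [moved] x = ind (moved? x)

      reduce : ∀ {x} → V (ℓ ℕ.* d) x → ∀ k → φ (k ℕ.* d) x ≡ φ ((k % ℓ) ℕ.* d) x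
      reduce {x} vx k = begin
        φ (k ℕ.* d) x
          ≡⟨ cong (λ m → φ (m ℕ.* d) x) (m≡m%n+[m/n]*n k ℓ) ⟩
        φ ((k % ℓ ℕ.+ (k / ℓ) ℕ.* ℓ) ℕ.* d) x
          ≡⟨ cong (λ m → φ m x) (trans (ℕₚ.*-distribʳ-+ d (k % ℓ) _) (cong ((k % ℓ) ℕ.* d ℕ.+_) (ℕₚ.*-assoc (k / ℓ) ℓ d))) ⟩
        φ ((k % ℓ) ℕ.* d ℕ.+ (k / ℓ) ℕ.* (ℓ ℕ.* d)) x
          ≡⟨ sym (φ-φ ((k % ℓ) ℕ.* d) _ x) ⟩
        φ ((k % ℓ) ℕ.* d) (φ ((k / ℓ) ℕ.* (ℓ ℕ.* d)) x)
          ≡⟨ cong (φ ((k % ℓ) ℕ.* d)) (φ-fixed-* (k / ℓ) (ℓ ℕ.* d) x vx) ⟩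
        φ ((k % ℓ) ℕ.* d) x ∎

      φφ : ∀ k i x → φ (k ℕ.* d) (φ (i ℕ.* d) x) ≡ φ ((k ℕ.+ i) ℕ.* d) x
      φφ k i x = trans (φ-φ (k ℕ.* d) (i ℕ.* d) x) (cong (λ m → φ m x) (sym (ℕₚ.*-distribʳ-+ d k i)))

      leader-min : ∀ {x} → V (ℓ ℕ.* d) x → Leader x → ∀ k → pos x ℕ.≤ pos (φ (k ℕ.* d) x)
      leader-min {x} vx lead k = subst (pos x ℕ.≤_)
        (cong pos (trans (cong (λ m → φ (m ℕ.* d) x) (Finₚ.toℕ-fromℕ< (m%n<n k ℓ))) (sym (reduce vx k))))
        (lead (fromℕ< (m%n<n k ℓ)))

      -- k = i (ℓ − 1) + j carries the i-th point of the orbit to the j-th.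
      transport : ∀ {x} → V (ℓ ℕ.* d) x → ∀ i j → φ ((i ℕ.* ℓ-1 ℕ.+ j) ℕ.* d) (φ (i ℕ.* d) x) ≡ φ (j ℕ.* d) x
      transport {x} vx i j = begin
        φ ((i ℕ.* ℓ-1 ℕ.+ j) ℕ.* d) (φ (i ℕ.* d) x) ≡⟨ φφ (i ℕ.* ℓ-1 ℕ.+ j) i x ⟩
        φ ((i ℕ.* ℓ-1 ℕ.+ j ℕ.+ i) ℕ.* d) x         ≡⟨ cong (λ m → φ (m ℕ.* d) x) eq ⟩
        φ ((j ℕ.+ i ℕ.* ℓ) ℕ.* d) x                 ≡⟨ sym (φφ j (i ℕ.* ℓ) x) ⟩
        φ (j ℕ.* d) (φ ((i ℕ.* ℓ) ℕ.* d) x)         ≡⟨ cong (φ (j ℕ.* d)) (trans (cong (λ m → φ m x) (ℕₚ.*-assoc i ℓ d)) (φ-fixed-* i (ℓ ℕ.* d) x vx)) ⟩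
        φ (j ℕ.* d) x                               ∎
        where
        eq : i ℕ.* ℓ-1 ℕ.+ j ℕ.+ i ≡ j ℕ.+ i ℕ.* ℓ
        eq = trans (cong (ℕ._+ i) (ℕₚ.+-comm (i ℕ.* ℓ-1) j)) (trans (ℕₚ.+-assoc j _ i)
          (cong (j ℕ.+_) (trans (ℕₚ.+-comm _ i) (sym (ℕₚ.*-suc i ℓ-1)))))

      V-orbit : ∀ {x} → V (ℓ ℕ.* d) x → ∀ i → V (ℓ ℕ.* d) (φ (i ℕ.* d) x)
      V-orbit vx i = V-φ {ℓ ℕ.* d} (i ℕ.* d) vx

      -- Here ℓ has to be prime: e is invertible modulo ℓ, so a return after e steps would already
      -- make x fixed by `φ d`.
      no-return : ∀ {x} → Moved x → ∀ e → 0 ℕ.< e → e ℕ.< ℓ → φ (e ℕ.* d) x ≢ x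
      no-return {x} (vx , ¬vx) e@(suc _) _ e<ℓ fix with bezout e ℓ (prime-coprime ℓ-prime e (>⇒∤ e<ℓ))
      ... | inj₁ (u , v , eq) = ¬vx (begin
        φ d x                         ≡⟨ cong (φ d) (sym (trans (cong (λ m → φ m x) (ℕₚ.*-assoc v ℓ d)) (φ-fixed-* v (ℓ ℕ.* d) x vx))) ⟩
        φ d (φ ((v ℕ.* ℓ) ℕ.* d) x)   ≡⟨ φ-φ d _ x ⟩
        φ ((1 ℕ.+ v ℕ.* ℓ) ℕ.* d) x   ≡⟨ cong (λ m → φ (m ℕ.* d) x) eq ⟩
        φ ((u ℕ.* e) ℕ.* d) x         ≡⟨ trans (cong (λ m → φ m x) (ℕₚ.*-assoc u e d)) (φ-fixed-* u (e ℕ.* d) x fix) ⟩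
        x                             ∎)
      ... | inj₂ (u , v , eq) = ¬vx (begin
        φ d x                         ≡⟨ cong (φ d) (sym (trans (cong (λ m → φ m x) (ℕₚ.*-assoc u e d)) (φ-fixed-* u (e ℕ.* d) x fix))) ⟩
        φ d (φ ((u ℕ.* e) ℕ.* d) x)   ≡⟨ φ-φ d _ x ⟩
        φ ((1 ℕ.+ u ℕ.* e) ℕ.* d) x   ≡⟨ cong (λ m → φ (m ℕ.* d) x) eq ⟩
        φ ((v ℕ.* ℓ) ℕ.* d) x         ≡⟨ trans (cong (λ m → φ m x) (ℕₚ.*-assoc v ℓ d)) (φ-fixed-* v (ℓ ℕ.* d) x vx) ⟩
        x                             ∎)

      distinct< : ∀ {x} → Moved x → ∀ i j → i ℕ.< j → j ℕ.< ℓ → φ (i ℕ.* d) x ≢ φ (j ℕ.* d) x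
      distinct< {x} mv@(vx , _) i j i<j j<ℓ eq = no-return mv (j ∸ i) (ℕₚ.m<n⇒0<n∸m i<j) (ℕₚ.≤-<-trans (ℕₚ.m∸n≤m j i) j<ℓ) (begin
        φ ((j ∸ i) ℕ.* d) x
          ≡⟨ cong (φ ((j ∸ i) ℕ.* d)) (sym back) ⟩
        φ ((j ∸ i) ℕ.* d) (φ (k ℕ.* d) (φ (i ℕ.* d) x))
          ≡⟨ φ-comm ((j ∸ i) ℕ.* d) (k ℕ.* d) _ ⟩
        φ (k ℕ.* d) (φ ((j ∸ i) ℕ.* d) (φ (i ℕ.* d) x))
          ≡⟨ cong (φ (k ℕ.* d)) (trans (φφ (j ∸ i) i x) (cong (λ m → φ (m ℕ.* d) x) (ℕₚ.m∸n+n≡m (ℕₚ.<⇒≤ i<j)))) ⟩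
        φ (k ℕ.* d) (φ (j ℕ.* d) x)
          ≡⟨ cong (φ (k ℕ.* d)) (sym eq) ⟩
        φ (k ℕ.* d) (φ (i ℕ.* d) x)
          ≡⟨ back ⟩
        x ∎)
        where
        -- From the i-th point of the orbit, i (ℓ - 1) further steps complete i full turns and end
        -- at x.
        k = i ℕ.* ℓ-1 ℕ.+ 0
        back : φ (k ℕ.* d) (φ (i ℕ.* d) x) ≡ x
        back = trans (transport vx i 0) (φ-zero x)

      distinct : ∀ {x} → Moved x → ∀ i j → i ℕ.< ℓ → j ℕ.< ℓ → φ (i ℕ.* d) x ≡ φ (j ℕ.* d) x → i ≡ j
      distinct mv i j i<ℓ j<ℓ eq with ℕₚ.<-cmp i j
      ... | tri< i<j _ _ = contradiction eq (distinct< mv i j i<j j<ℓ)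
      ... | tri≈ _ i≡j _ = i≡j
      ... | tri> _ _ j<i = contradiction (sym eq) (distinct< mv j i j<i i<ℓ)

      -- The ℓ points of the orbit are distinct, so the least position occurs at a single index.
      one-leader : ∀ {x} → Moved x → ∑ (allFin ℓ) (λ i → [leader] (φ (toℕ i ℕ.* d) x)) ≡ + 1
      one-leader {x} mv@(vx , _) with argmin (λ i → pos (φ (i ℕ.* d) x)) ℓ-1
      ... | i₀ , i₀<ℓ , min = begin
        ∑ (allFin ℓ) (λ i → [leader] (φ (toℕ i ℕ.* d) x))
          ≡⟨ ∑-cong (allFin ℓ) (λ i → trans (when-⇔ (leader? _) (i Fin.≟ f₀) (unique-leader i) (λ { refl → f₀-leader })) (sym (ℤₚ.*-identityʳ _))) ⟩
        ∑ (allFin ℓ) (λ i → ind (i Fin.≟ f₀) ℤ.* + 1)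
          ≡⟨ ∑-ind (Fin-finite ℓ) f₀ (λ _ → + 1) ⟩
        + 1 ∎
        where
        f₀ = fromℕ< i₀<ℓ
        f₀≡ : toℕ f₀ ≡ i₀
        f₀≡ = Finₚ.toℕ-fromℕ< i₀<ℓ
        below : ∀ k → pos (φ (i₀ ℕ.* d) x) ℕ.≤ pos (φ (k ℕ.* d) x)
        below k = subst (pos (φ (i₀ ℕ.* d) x) ℕ.≤_) (cong pos (sym (reduce vx k))) (min (k % ℓ) (m%n<n k ℓ))
        f₀-leader : Leader (φ (toℕ f₀ ℕ.* d) x)
        f₀-leader i = subst (λ m → pos (φ (m ℕ.* d) x) ℕ.≤ pos (φ (toℕ i ℕ.* d) (φ (m ℕ.* d) x))) (sym f₀≡)
          (subst (pos (φ (i₀ ℕ.* d) x) ℕ.≤_) (cong pos (sym (φφ (toℕ i) i₀ x))) (below (toℕ i ℕ.+ i₀)))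
        unique-leader : ∀ i → Leader (φ (toℕ i ℕ.* d) x) → i ≡ f₀
        unique-leader i lead = Finₚ.toℕ-injective (trans (distinct mv (toℕ i) i₀ (Finₚ.toℕ<n i) i₀<ℓ
          (position-injective K-finite (ℕₚ.≤-antisym
            (subst (pos (φ (toℕ i ℕ.* d) x) ℕ.≤_) (cong pos (transport vx (toℕ i) i₀))
              (leader-min (V-orbit vx (toℕ i)) lead (toℕ i ℕ.* ℓ-1 ℕ.+ i₀)))
            (below (toℕ i))))) (sym f₀≡))

      [moved]-φ : ∀ i x → [moved] (φ i x) ≡ [moved] x
      [moved]-φ i x = when-⇔ (moved? (φ i x)) (moved? x)
        (λ (a , b) → V-φ⁻¹ (ℓ ℕ.* d) i x a , λ v → b (V-φ {d} i v))
        (λ (a , b) → V-φ {ℓ ℕ.* d} i a , λ v → b (V-φ⁻¹ d i x v))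

      [V]-split : ∀ x → [ x ∈V ℓ ℕ.* d ] ≡ [ x ∈V d ] ℤ.+ [moved] x
      [V]-split x with V? (ℓ ℕ.* d) x | V? d x
      ... | yes _ | yes _ = refl
      ... | yes _ | no _  = refl
      ... | no ¬v | yes v = contradiction (V-∣ {d} (n∣m*n ℓ) v) ¬v
      ... | no _  | no _  = refl

      [moved]-leaders : ∀ x → [moved] x ≡ [moved] x ℤ.* ∑ (allFin ℓ) (λ i → [leader] (φ (toℕ i ℕ.* d) x))
      [moved]-leaders x with moved? x
      ... | yes mv = sym (trans (ℤₚ.*-identityˡ _) (one-leader mv))
      ... | no _   = refl

    -- Σ over the moved points collects each orbit ℓ times at its leader.
    orbit-congruence : (w : K → ℤ) → (∀ x → w (φ d x) ≡ w x) →
      ∃ λ m → ∑ elems (λ x → [ x ∈V ℓ ℕ.* d ] ℤ.* w x) ≡ ∑ elems (λ x → [ x ∈V d ] ℤ.* w x) ℤ.+ + ℓ ℤ.* m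
    orbit-congruence w w-φ = m , (begin
      ∑ elems (λ x → [ x ∈V ℓ ℕ.* d ] ℤ.* w x)
        ≡⟨ ∑-cong elems (λ x → trans (cong (ℤ._* w x) ([V]-split x)) (ℤₚ.*-distribʳ-+ (w x) [ x ∈V d ] ([moved] x))) ⟩
      ∑ elems (λ x → [ x ∈V d ] ℤ.* w x ℤ.+ [moved] x ℤ.* w x)
        ≡⟨ ∑-∙ elems _ _ ⟩
      ∑ elems (λ x → [ x ∈V d ] ℤ.* w x) ℤ.+ ∑ elems (λ x → [moved] x ℤ.* w x)
        ≡⟨ cong (λ z → ∑ elems (λ x → [ x ∈V d ] ℤ.* w x) ℤ.+ z) moved-sum ⟩
      ∑ elems (λ x → [ x ∈V d ] ℤ.* w x) ℤ.+ + ℓ ℤ.* m ∎)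
      where
      W : K → ℤ
      W x = [moved] x ℤ.* w x ℤ.* [leader] x
      m : ℤ
      m = ∑ elems W
      w-φ* : ∀ i x → w (φ (i ℕ.* d) x) ≡ w x
      w-φ* zero    x = cong w (φ-zero x)
      w-φ* (suc i) x = trans (cong w (sym (φ-φ d (i ℕ.* d) x))) (trans (w-φ _) (w-φ* i x))
      rearrange : ∀ a b c → (a ℤ.* c) ℤ.* b ≡ (a ℤ.* b) ℤ.* c
      rearrange = ℤSolver.solve-∀
      moved-sum : ∑ elems (λ x → [moved] x ℤ.* w x) ≡ + ℓ ℤ.* m
      moved-sum = begin
        ∑ elems (λ x → [moved] x ℤ.* w x)
          ≡⟨ ∑-cong elems (λ x → trans (cong (ℤ._* w x) ([moved]-leaders x)) (trans (rearrange ([moved] x) (w x) _) (sym (∑-*ˡ (allFin ℓ) ([moved] x ℤ.* w x) _)))) ⟩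
        ∑ elems (λ x → ∑ (allFin ℓ) (λ i → [moved] x ℤ.* w x ℤ.* [leader] (φ (toℕ i ℕ.* d) x)))
          ≡⟨ ∑-swap elems (allFin ℓ) _ ⟩
        ∑ (allFin ℓ) (λ i → ∑ elems (λ x → [moved] x ℤ.* w x ℤ.* [leader] (φ (toℕ i ℕ.* d) x)))
          ≡⟨ ∑-cong (allFin ℓ) (λ i → ∑-cong elems (λ x → cong₂ (λ a b → a ℤ.* b ℤ.* [leader] (φ (toℕ i ℕ.* d) x)) (sym ([moved]-φ (toℕ i ℕ.* d) x)) (sym (w-φ* (toℕ i) x)))) ⟩
        ∑ (allFin ℓ) (λ i → ∑ elems (W ∘ φ (toℕ i ℕ.* d)))
          ≡⟨ ∑-cong (allFin ℓ) (λ i → ∑-φ (toℕ i ℕ.* d) W) ⟩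
        ∑ (allFin ℓ) (λ _ → m)
          ≡⟨ ∑-Fin-const ℓ m ⟩
        + ℓ ℤ.* m ∎

-- The Diophantine equation a² + p D² = 4 p^(2h).

prime∣square⇒multiple : ∀ {p} → Prime p → ∀ a k → a ℤ.* a ≡ + p ℤ.* k → ∃ λ a′ → a ≡ + p ℤ.* a′
prime∣square⇒multiple {p} pr a k eq = quotient , trans equality (ℤₚ.*-comm quotient (+ p))
  where
  p∣∣a∣ : p ∣ ℤ.∣ a ∣
  p∣∣a∣ with euclidsLemma ℤ.∣ a ∣ ℤ.∣ a ∣ pr
    (divides ℤ.∣ k ∣ (trans (sym (ℤₚ.abs-* a a)) (trans (cong ℤ.∣_∣ eq) (trans (ℤₚ.abs-* (+ p) k) (ℕₚ.*-comm p ℤ.∣ k ∣)))))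
  ... | inj₁ d = d
  ... | inj₂ d = d
  open ℤ∣._∣_ (ℤ∣.∣ᵤ⇒∣ {+ p} {a} p∣∣a∣)

-- For h > 0 the prime p divides a² and, after one division by p, also D²; a second division by p
-- leaves the equation for h - 1.
norm-descent : ∀ {p} → Prime p → ∀ h a D →
  a ℤ.* a ℤ.+ + p ℤ.* (D ℤ.* D) ≡ + 4 ℤ.* (+ (p ℕ.^ h) ℤ.* + (p ℕ.^ h)) →
  ∃₂ λ a′ D′ → a ≡ + (p ℕ.^ h) ℤ.* a′ × D ≡ + (p ℕ.^ h) ℤ.* D′ × a′ ℤ.* a′ ℤ.+ + p ℤ.* (D′ ℤ.* D′) ≡ + 4
norm-descent {p} pr zero a D eq = a , D , sym (ℤₚ.*-identityˡ a) , sym (ℤₚ.*-identityˡ D) , eq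
norm-descent {p} pr (suc h) a D eq =
  let (a₁ , a≡) = prime∣square⇒multiple pr a (+ 4 ℤ.* (P ℤ.* (H ℤ.* H)) ℤ.- D ℤ.* D)
        (move₁ (a ℤ.* a) P H (D ℤ.* D) (trans eq (cong (λ z → + 4 ℤ.* (z ℤ.* z)) pow≡)))
      eq₁ = cancelP _ _ (step₁ P H a₁ (D ℤ.* D) (trans (cong (λ z → z ℤ.* z ℤ.+ P ℤ.* (D ℤ.* D)) (sym a≡)) (trans eq (cong (λ z → + 4 ℤ.* (z ℤ.* z)) pow≡))))
      (D₁ , D≡) = prime∣square⇒multiple pr D (+ 4 ℤ.* (H ℤ.* H) ℤ.- a₁ ℤ.* a₁) (move₂ (D ℤ.* D) P H (a₁ ℤ.* a₁) eq₁)
      eq₂ = cancelP _ _ (step₂ P H (a₁ ℤ.* a₁) D₁ (trans (cong (λ z → P ℤ.* (a₁ ℤ.* a₁) ℤ.+ z ℤ.* z) (sym D≡)) eq₁))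
      (a′ , D′ , a₁≡ , D₁≡ , final) = norm-descent pr h a₁ D₁ eq₂
  in a′ , D′ , trans a≡ (lift a₁≡) , trans D≡ (lift D₁≡) , final
  where
  P H : ℤ
  P = + p
  H = + (p ℕ.^ h)
  instance _ = prime⇒nonZero pr
  pow≡ : + (p ℕ.^ suc h) ≡ P ℤ.* H
  pow≡ = ℤₚ.pos-* p (p ℕ.^ h)
  lift : ∀ {x x′} → x ≡ H ℤ.* x′ → P ℤ.* x ≡ + (p ℕ.^ suc h) ℤ.* x′
  lift {x′ = x′} refl = trans (sym (ℤₚ.*-assoc P H x′)) (cong (ℤ._* x′) (sym pow≡))
  cancelP : ∀ x y → P ℤ.* x ≡ P ℤ.* y → x ≡ y
  cancelP x y = ℤₚ.*-cancelˡ-≡ P x y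
  isolate : ∀ x y z → x ℤ.+ y ≡ z → x ≡ z ℤ.- y
  isolate x y z refl = sym (trans (ℤₚ.+-assoc x y (ℤ.- y)) (trans (cong (λ w → x ℤ.+ w) (ℤₚ.+-inverseʳ y)) (ℤₚ.+-identityʳ x)))
  poly₁ : ∀ P H E → + 4 ℤ.* ((P ℤ.* H) ℤ.* (P ℤ.* H)) ℤ.- P ℤ.* E ≡ P ℤ.* (+ 4 ℤ.* (P ℤ.* (H ℤ.* H)) ℤ.- E)
  poly₁ = ℤSolver.solve-∀
  move₁ : ∀ A P H E → A ℤ.+ P ℤ.* E ≡ + 4 ℤ.* ((P ℤ.* H) ℤ.* (P ℤ.* H)) → A ≡ P ℤ.* (+ 4 ℤ.* (P ℤ.* (H ℤ.* H)) ℤ.- E)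
  move₁ A P H E e = trans (isolate A _ _ e) (poly₁ P H E)
  poly₂ : ∀ P H E → + 4 ℤ.* (P ℤ.* (H ℤ.* H)) ℤ.- P ℤ.* E ≡ P ℤ.* (+ 4 ℤ.* (H ℤ.* H) ℤ.- E)
  poly₂ = ℤSolver.solve-∀
  move₂ : ∀ A P H E → P ℤ.* E ℤ.+ A ≡ + 4 ℤ.* (P ℤ.* (H ℤ.* H)) → A ≡ P ℤ.* (+ 4 ℤ.* (H ℤ.* H) ℤ.- E)
  move₂ A P H E e = trans (isolate A _ _ (trans (ℤₚ.+-comm A _) e)) (poly₂ P H E)
  lhs₁ : ∀ P a E → P ℤ.* (P ℤ.* (a ℤ.* a) ℤ.+ E) ≡ (P ℤ.* a) ℤ.* (P ℤ.* a) ℤ.+ P ℤ.* E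
  lhs₁ = ℤSolver.solve-∀
  rhs₁ : ∀ P H → + 4 ℤ.* ((P ℤ.* H) ℤ.* (P ℤ.* H)) ≡ P ℤ.* (+ 4 ℤ.* (P ℤ.* (H ℤ.* H)))
  rhs₁ = ℤSolver.solve-∀
  step₁ : ∀ P H a E → (P ℤ.* a) ℤ.* (P ℤ.* a) ℤ.+ P ℤ.* E ≡ + 4 ℤ.* ((P ℤ.* H) ℤ.* (P ℤ.* H)) →
          P ℤ.* (P ℤ.* (a ℤ.* a) ℤ.+ E) ≡ P ℤ.* (+ 4 ℤ.* (P ℤ.* (H ℤ.* H)))
  step₁ P H a E e = trans (lhs₁ P a E) (trans e (rhs₁ P H))
  lhs₂ : ∀ P A D → P ℤ.* (A ℤ.+ P ℤ.* (D ℤ.* D)) ≡ P ℤ.* A ℤ.+ (P ℤ.* D) ℤ.* (P ℤ.* D)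
  lhs₂ = ℤSolver.solve-∀
  rhs₂ : ∀ P H → + 4 ℤ.* (P ℤ.* (H ℤ.* H)) ≡ P ℤ.* (+ 4 ℤ.* (H ℤ.* H))
  rhs₂ = ℤSolver.solve-∀
  step₂ : ∀ P H A D → P ℤ.* A ℤ.+ (P ℤ.* D) ℤ.* (P ℤ.* D) ≡ + 4 ℤ.* (P ℤ.* (H ℤ.* H)) →
          P ℤ.* (A ℤ.+ P ℤ.* (D ℤ.* D)) ≡ P ℤ.* (+ 4 ℤ.* (H ℤ.* H))
  step₂ P H A D e = trans (lhs₂ P A D) (trans e (rhs₂ P H))

prime∤^ : ∀ {ℓ p} → Prime ℓ → ¬ (ℓ ∣ p) → ∀ h → ¬ (ℓ ∣ p ℕ.^ h)
prime∤^ ℓ-prime ℓ∤p zero    ℓ∣1 = ℕₚ.<⇒≱ (ℕ.nonTrivial⇒n>1 _ {{prime⇒nonTrivial ℓ-prime}}) (∣⇒≤ ℓ∣1)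
prime∤^ {p = p} ℓ-prime ℓ∤p (suc h) ℓ∣ with euclidsLemma p (p ℕ.^ h) ℓ-prime ℓ∣
... | inj₁ d = ℓ∤p d
... | inj₂ d = prime∤^ ℓ-prime ℓ∤p h d

square-abs : ∀ i → i ℤ.* i ≡ + (ℤ.∣ i ∣ ℕ.* ℤ.∣ i ∣)
square-abs (+ m)    = sym (ℤₚ.pos-* m m)
square-abs -[1+ m ] = refl

-- A nonzero multiple D of ℓ ≥ 3 makes p D² too large. Divisibility is what excludes D = ±1, which
-- does solve the equation when p = 3.
small-norm : ∀ {p ℓ} → 1 ℕ.< p → 3 ℕ.≤ ℓ → ∀ a D → ℓ ∣ ℤ.∣ D ∣ → a ℤ.* a ℤ.+ + p ℤ.* (D ℤ.* D) ≡ + 4 → D ≡ + 0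
small-norm {p} {ℓ} p>1 3≤ℓ a D ℓ∣D eq with D ℤ.≟ + 0
... | yes D≡0 = D≡0
-- The lower bound is 18 = 2 · 3 · 3, and 5 ≤ 5 + 13 says 4 < 18.
... | no D≢0  = contradiction (ℕₚ.≤-trans big (ℕₚ.≤-reflexive eqℕ)) (ℕₚ.<⇒≱ (ℕₚ.m≤m+n 5 13))
  where
  eqℕ : ℤ.∣ a ∣ ℕ.* ℤ.∣ a ∣ ℕ.+ p ℕ.* (ℤ.∣ D ∣ ℕ.* ℤ.∣ D ∣) ≡ 4
  eqℕ = ℤₚ.+-injective (trans (cong₂ ℤ._+_ (sym (square-abs a)) (trans (ℤₚ.pos-* p _) (cong (+ p ℤ.*_) (sym (square-abs D))))) eq)
  3≤D : 3 ℕ.≤ ℤ.∣ D ∣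
  3≤D = ℕₚ.≤-trans 3≤ℓ (∣⇒≤ {{ℕ.≢-nonZero (D≢0 ∘ ℤₚ.∣i∣≡0⇒i≡0)}} ℓ∣D)
  big : 18 ℕ.≤ ℤ.∣ a ∣ ℕ.* ℤ.∣ a ∣ ℕ.+ p ℕ.* (ℤ.∣ D ∣ ℕ.* ℤ.∣ D ∣)
  big = ℕₚ.≤-trans (ℕₚ.*-mono-≤ p>1 (ℕₚ.*-mono-≤ 3≤D 3≤D)) (ℕₚ.m≤n+m _ _)

odd⇒suc-double : ∀ d → ¬ (2 ∣ d) → ∃ λ k → suc d ≡ k ℕ.+ k
odd⇒suc-double zero          ¬2∣ = contradiction (divides 0 refl) ¬2∣
odd⇒suc-double (suc zero)    ¬2∣ = 1 , refl
odd⇒suc-double (suc (suc d)) ¬2∣ with odd⇒suc-double d (λ { (divides k eq) → ¬2∣ (divides (suc k) (cong (suc ∘ suc) eq)) })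
... | k , eq = suc k , trans (cong (suc ∘ suc) eq) (cong suc (sym (ℕₚ.+-suc k k)))

-- First and second moment of the value distribution of Q on V d.

module Counting {p n : ℕ} {{p≢0 : NonZero p}} (pr : Prime p) (𝔽 : FiniteField p n)
                (n≥1 : 1 ℕ.≤ n) (n⊥p : gcd n p ≡ 1) (p-odd : ¬ (2 ∣ p)) (Π : Parameters 𝔽) where
  open TraceTheory pr 𝔽 n≥1 n⊥p
  open SquareClasses pr 𝔽 n≥1 n⊥p p-odd
  open QuadraticForm pr 𝔽 n≥1 n⊥p Π
  open Parameters Π
  open Solver using (solve; _:=_; _:+_; _:*_; _:-_; :-_; con)
  open ≡-Reasoning

  N : ℕ → K → ℤ
  N d y = ∑ elems (λ x → [ x ∈V d ] ℤ.* ind (Q x ≟ y))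

  ∑-N* : ∀ d (f : K → ℤ) → ∑ elems (λ y → N d y ℤ.* f y) ≡ ∑ elems (λ x → [ x ∈V d ] ℤ.* f (Q x))
  ∑-N* d f = begin
    ∑ elems (λ y → N d y ℤ.* f y)
      ≡⟨ ∑-cong elems (λ y → sym (∑-*ʳ elems (f y) _)) ⟩
    ∑ elems (λ y → ∑ elems (λ x → [ x ∈V d ] ℤ.* ind (Q x ≟ y) ℤ.* f y))
      ≡⟨ ∑-swap elems elems _ ⟩
    ∑ elems (λ x → ∑ elems (λ y → [ x ∈V d ] ℤ.* ind (Q x ≟ y) ℤ.* f y))
      ≡⟨ ∑-cong elems (λ x → trans (∑-cong elems (λ y → ℤₚ.*-assoc [ x ∈V d ] _ (f y)))
           (trans (∑-*ˡ elems [ x ∈V d ] _) (cong ([ x ∈V d ] ℤ.*_) (∑-ind′ K-finite (Q x) f)))) ⟩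
    ∑ elems (λ x → [ x ∈V d ] ℤ.* f (Q x)) ∎

  ∑-N : ∀ d → ∑ elems (N d) ≡ ∣V∣ d
  ∑-N d = trans (∑-cong elems (λ y → sym (ℤₚ.*-identityʳ _))) (trans (∑-N* d (λ _ → + 1)) (∑-cong elems (λ x → ℤₚ.*-identityʳ _)))

  N-outside : ∀ d y → ¬ V 1 y → N d y ≡ + 0
  N-outside d y ¬vy = trans (∑-cong elems (λ x → trans (cong ([ x ∈V d ] ℤ.*_) (when-no (Q x ≟ y) (λ { refl → ¬vy (V1-Q x) }))) (ℤₚ.*-zeroʳ [ x ∈V d ]))) (∑-ε elems)

  N-restrict : ∀ d y (f : K → ℤ) → [ y ∈V 1 ] ℤ.* (N d y ℤ.* f y) ≡ N d y ℤ.* f y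
  N-restrict d y f with V? 1 y
  ... | yes _  = ℤₚ.*-identityˡ _
  ... | no ¬vy = sym (cong (ℤ._* f y) (N-outside d y ¬vy))

  -- Q is homogeneous of degree two over F_p, and multiplication by a permutes V d.
  N-SquareInvariant : ∀ d → SquareInvariant (N d)
  N-SquareInvariant d a y va a≢0 = begin
    N d ((a * a) * y)
      ≡⟨ sym (∑-permute K-finite (λ x → a * x) (λ x → a ⁻¹ * x)
           (λ x → trans (sym (*-assoc _ _ _)) (trans (cong (λ z → z * x) (inverse a a≢0)) (*-identityˡ x)))
           (λ x → trans (sym (*-assoc _ _ _)) (trans (cong (λ z → z * x) (trans (*-comm _ _) (inverse a a≢0))) (*-identityˡ x))) _) ⟩
    ∑ elems (λ x → [ a * x ∈V d ] ℤ.* ind (Q (a * x) ≟ ((a * a) * y)))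
      ≡⟨ ∑-cong elems (λ x → cong₂ ℤ._*_
           (when-⇔ (V? d (a * x)) (V? d x)
             (λ v → *-cancelˡ a a≢0 (trans (trans (cong (λ z → z * φ d x) (sym (V1⊆V d va))) (sym (φ-* d a x))) v))
             (λ v → V-* {d} (V1⊆V d va) v))
           (when-⇔ (Q (a * x) ≟ ((a * a) * y)) (Q x ≟ y)
             (λ e → *-cancelˡ (a * a) (*-nonzero a≢0 a≢0) (trans (sym (Q-scale x va)) e))
             (λ e → trans (Q-scale x va) (cong (λ z → (a * a) * z) e)))) ⟩
    N d y ∎

  -- Σ N² counts the pairs (x , z) with Q (x + z) = Q x; it is computed one z at a time.
  private
    #stable : ℕ → K → ℤ
    #stable d z = ∑ elems (λ x → [ x ∈V d ] ℤ.* ind (Q (x + z) ≟ Q x))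

    #stable-radical : ∀ d z → V 1 z → #stable d z ≡ ∣V∣ d
    #stable-radical d z vz = ∑-cong elems (λ x → trans (cong ([ x ∈V d ] ℤ.*_) (ind-yes (Q (x + z) ≟ Q x) (stable x))) (ℤₚ.*-identityʳ _))
      where
      stable : ∀ x → Q (x + z) ≡ Q x
      stable x = begin
        Q (x + z)                        ≡⟨ polar x z ⟩
        Q x + Q z + c * Tr (x * L z)     ≡⟨ cong₂ (λ u v → Q x + u + c * v) (Q-V1 vz) (trans (cong (λ w → Tr (x * w)) (V1⇒L≡0 vz)) (trans (cong Tr (zeroʳ x)) Tr-0)) ⟩
        Q x + 0# + c * 0#                ≡⟨ solve 2 (λ q c → q :+ con (+ 0) :+ c :* con (+ 0) := q) refl (Q x) c ⟩
        Q x                              ∎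

    -- Off the radical, Q (x + z) - Q x is an affine function of x with nonzero linear part c Tr (x
    -- L z), hence equidistributed on V d.
    #stable-regular : ∀ d z → V d z → ¬ V 1 z → + p ℤ.* #stable d z ≡ ∣V∣ d
    #stable-regular d z vz ¬v1 = trans
      (cong (+ p ℤ.*_) (∑-cong elems (λ x → cong ([ x ∈V d ] ℤ.*_) (when-⇔ (Q (x + z) ≟ Q x) (h x ≟ 0#) x≡y⇒x-y≡0 x-y≡0⇒x≡y))))
      (equidistribution d h v v∈V (λ x → V-sub {1} (V1-Q (x + z)) (V1-Q x)) shift 0# (V-0 {1}))
      where
      h : K → K
      h x = Q (x + z) - Q x
      Lz≢0 : L z ≢ 0#
      Lz≢0 = ¬v1 ∘ L≡0⇒V1
      κ : K
      κ = c * ιℕ n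
      κ≢0 : κ ≢ 0#
      κ≢0 = *-nonzero c≢0 ιn≢0
      κ∈V1 : V 1 κ
      κ∈V1 = V-* {1} c∈F (V1-ιℕ n)
      -- Chosen so that v L z = (c n)⁻¹ lies in F_p: the trace multiplies it by n and the form by c,
      -- so a step a v raises h by exactly a.
      v : K
      v = κ ⁻¹ * (L z) ⁻¹
      v∈V : V d v
      v∈V = V-* {d} (V1⊆V d (V-⁻¹ {1} κ≢0 κ∈V1)) (V-⁻¹ {d} Lz≢0 (L-V {d} vz))
      h≡ : ∀ x → h x ≡ Q z + c * Tr (x * L z)
      h≡ x = trans (cong (λ w → w - Q x) (polar x z)) (solve 3 (λ a b u → a :+ b :+ u :- a := b :+ u) refl (Q x) (Q z) (c * Tr (x * L z)))
      gain : ∀ a → V 1 a → c * Tr ((a * v) * L z) ≡ a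
      gain a va = begin
        c * Tr ((a * v) * L z)
          ≡⟨ cong (λ w → c * Tr w) (trans (solve 4 (λ a k l' l → (a :* (k :* l')) :* l := (a :* k) :* (l :* l')) refl a (κ ⁻¹) ((L z) ⁻¹) (L z)) (cong (λ w → (a * κ ⁻¹) * w) (inverse (L z) Lz≢0))) ⟩
        c * Tr ((a * κ ⁻¹) * 1#)
          ≡⟨ cong (λ w → c * w) (trans (Tr-scale 1# (V-* {1} va (V-⁻¹ {1} κ≢0 κ∈V1))) (cong (λ w → (a * κ ⁻¹) * w) Tr-1)) ⟩
        c * ((a * κ ⁻¹) * ιℕ n)
          ≡⟨ solve 4 (λ c a k n → c :* ((a :* k) :* n) := a :* ((c :* n) :* k)) refl c a (κ ⁻¹) (ιℕ n) ⟩
        a * (κ * κ ⁻¹)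
          ≡⟨ trans (cong (λ w → a * w) (inverse κ κ≢0)) (*-identityʳ a) ⟩
        a ∎
      shift : ∀ a x → V 1 a → h (x + a * v) ≡ h x + a
      shift a x va = begin
        h (x + a * v)                                    ≡⟨ h≡ _ ⟩
        Q z + c * Tr ((x + a * v) * L z)                 ≡⟨ cong (λ w → Q z + c * w) (trans (cong Tr (distribʳ (L z) x (a * v))) (Tr-+ _ _)) ⟩
        Q z + c * (Tr (x * L z) + Tr ((a * v) * L z))    ≡⟨ solve 4 (λ q c u w → q :+ c :* (u :+ w) := (q :+ c :* u) :+ c :* w) refl (Q z) c _ _ ⟩
        (Q z + c * Tr (x * L z)) + c * Tr ((a * v) * L z) ≡⟨ cong₂ _+_ (sym (h≡ x)) (gain a va) ⟩
        h x + a                                          ∎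

    ∑N²≡∑stable : ∀ d → ∑ elems (λ y → N d y ℤ.* N d y) ≡ ∑ elems (λ z → [ z ∈V d ] ℤ.* #stable d z)
    ∑N²≡∑stable d = begin
      ∑ elems (λ y → N d y ℤ.* N d y)
        ≡⟨ ∑-N* d (N d) ⟩
      ∑ elems (λ x → [ x ∈V d ] ℤ.* N d (Q x))
        ≡⟨ ∑-cong elems (λ x → cong ([ x ∈V d ] ℤ.*_) (sym (∑-permute K-finite (λ z → x + z) (λ z → z - x)
             (λ z → solve 2 (λ x z → x :+ (z :- x) := z) refl x z) (λ z → solve 2 (λ x z → (x :+ z) :- x := z) refl x z) _))) ⟩
      ∑ elems (λ x → [ x ∈V d ] ℤ.* ∑ elems (λ z → [ x + z ∈V d ] ℤ.* ind (Q (x + z) ≟ Q x)))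
        ≡⟨ ∑-cong elems (λ x → trans (sym (∑-*ˡ elems [ x ∈V d ] _)) (∑-cong elems (λ z → exchange x z (ind (Q (x + z) ≟ Q x))))) ⟩
      ∑ elems (λ x → ∑ elems (λ z → [ z ∈V d ] ℤ.* ([ x ∈V d ] ℤ.* ind (Q (x + z) ≟ Q x))))
        ≡⟨ ∑-swap elems elems _ ⟩
      ∑ elems (λ z → ∑ elems (λ x → [ z ∈V d ] ℤ.* ([ x ∈V d ] ℤ.* ind (Q (x + z) ≟ Q x))))
        ≡⟨ ∑-cong elems (λ z → ∑-*ˡ elems [ z ∈V d ] _) ⟩
      ∑ elems (λ z → [ z ∈V d ] ℤ.* #stable d z) ∎
      where
      exchange : ∀ x z i → [ x ∈V d ] ℤ.* ([ x + z ∈V d ] ℤ.* i) ≡ [ z ∈V d ] ℤ.* ([ x ∈V d ] ℤ.* i)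
      exchange x z i with V? d x
      ... | no _   = sym (ℤₚ.*-zeroʳ [ z ∈V d ])
      ... | yes vx = trans (ℤₚ.*-identityˡ _) (cong₂ ℤ._*_
              (when-⇔ (V? d (x + z)) (V? d z)
                (λ e → subst (V d) (solve 2 (λ x z → (x :+ z) :- x := z) refl x z) (V-sub {d} e vx))
                (λ e → V-+ {d} vx e))
              (sym (ℤₚ.*-identityˡ i)))

  -- Each of the p radical z is stable for all of V d, each of the other ∣V d∣ - p for a p-th part
  -- of it; the factor p avoids the division.
  second-moment : ∀ d → + p ℤ.* ∑ elems (λ y → N d y ℤ.* N d y) ≡ + p ℤ.* (+ p ℤ.* ∣V∣ d) ℤ.+ (∣V∣ d ℤ.- + p) ℤ.* ∣V∣ d
  second-moment d = begin
    + p ℤ.* ∑ elems (λ y → N d y ℤ.* N d y)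
      ≡⟨ cong (+ p ℤ.*_) (∑N²≡∑stable d) ⟩
    + p ℤ.* ∑ elems (λ z → [ z ∈V d ] ℤ.* #stable d z)
      ≡⟨ sym (∑-*ˡ elems (+ p) _) ⟩
    ∑ elems (λ z → + p ℤ.* ([ z ∈V d ] ℤ.* #stable d z))
      ≡⟨ ∑-cong elems split ⟩
    ∑ elems (λ z → [ z ∈V 1 ] ℤ.* (+ p ℤ.* v) ℤ.+ ([ z ∈V d ] ℤ.- [ z ∈V 1 ]) ℤ.* v)
      ≡⟨ trans (∑-∙ elems _ _) (cong₂ ℤ._+_ (∑-*ʳ elems (+ p ℤ.* v) _) (trans (∑-*ʳ elems v _) (cong (ℤ._* v) (∑-sub elems _ _)))) ⟩
    ∣V∣ 1 ℤ.* (+ p ℤ.* v) ℤ.+ (v ℤ.- ∣V∣ 1) ℤ.* v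
      ≡⟨ cong (λ w → w ℤ.* (+ p ℤ.* v) ℤ.+ (v ℤ.- w) ℤ.* v) ∣V1∣ ⟩
    + p ℤ.* (+ p ℤ.* v) ℤ.+ (v ℤ.- + p) ℤ.* v ∎
    where
    v = ∣V∣ d
    reg : ∀ w v → + 0 ℤ.* w ℤ.+ (+ 1 ℤ.- + 0) ℤ.* v ≡ v
    reg = ℤSolver.solve-∀
    rad : ∀ w v → + 1 ℤ.* w ℤ.+ (+ 1 ℤ.- + 1) ℤ.* v ≡ w
    rad = ℤSolver.solve-∀
    out : ∀ w v → + 0 ℤ.* w ℤ.+ (+ 0 ℤ.- + 0) ℤ.* v ≡ + 0
    out = ℤSolver.solve-∀
    split : ∀ z → + p ℤ.* ([ z ∈V d ] ℤ.* #stable d z) ≡ [ z ∈V 1 ] ℤ.* (+ p ℤ.* v) ℤ.+ ([ z ∈V d ] ℤ.- [ z ∈V 1 ]) ℤ.* v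
    split z with V? d z | V? 1 z
    ... | no ¬vd | yes v1 = contradiction (V1⊆V d v1) ¬vd
    ... | no _   | no _   = trans (ℤₚ.*-zeroʳ (+ p)) (sym (out (+ p ℤ.* v) v))
    ... | yes _  | yes v1 = trans (cong (+ p ℤ.*_) (trans (ℤₚ.*-identityˡ _) (#stable-radical d z v1))) (sym (rad (+ p ℤ.* v) v))
    ... | yes vd | no ¬v1 = trans (cong (+ p ℤ.*_) (ℤₚ.*-identityˡ _)) (trans (#stable-regular d z vd ¬v1) (sym (reg (+ p ℤ.* v) v)))

  -- The quantity 4 (p Σ N² - (Σ N)²) is evaluated by square classes and by the two moments; both
  -- results carry the factor p - 1, which cancels.
  norm-equation : ∀ d → let X = N d 0# ℤ.- N d 1# ; Y = N d 0# ℤ.- N d ν ; D = N d ν ℤ.- N d 1# in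
    (X ℤ.+ Y) ℤ.* (X ℤ.+ Y) ℤ.+ + p ℤ.* (D ℤ.* D) ≡ + 4 ℤ.* (+ p ℤ.* ∣V∣ d)
  norm-equation d = ℤₚ.*-cancelˡ-≡ (+ p ℤ.- + 1) _ _ {{p-1≢0}} (begin
    (P ℤ.- + 1) ℤ.* _
      ≡⟨ sym (moments-identity P (N d 0#) (N d 1#) (N d ν)) ⟩
    _ ≡⟨ cong₂ (λ s t → + 2 ℤ.* P ℤ.* s ℤ.- t ℤ.* t) (sym sum₂) (sym sum₁) ⟩
    + 2 ℤ.* P ℤ.* (+ 2 ℤ.* S₂) ℤ.- (+ 2 ℤ.* v) ℤ.* (+ 2 ℤ.* v)
      ≡⟨ regroup P S₂ v ⟩
    + 4 ℤ.* (P ℤ.* S₂) ℤ.- + 4 ℤ.* (v ℤ.* v)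
      ≡⟨ cong (λ w → + 4 ℤ.* w ℤ.- + 4 ℤ.* (v ℤ.* v)) (second-moment d) ⟩
    + 4 ℤ.* (P ℤ.* (P ℤ.* v) ℤ.+ (v ℤ.- P) ℤ.* v) ℤ.- + 4 ℤ.* (v ℤ.* v)
      ≡⟨ finish P v ⟩
    (P ℤ.- + 1) ℤ.* (+ 4 ℤ.* (P ℤ.* v)) ∎)
    where
    P = + p
    v = ∣V∣ d
    S₂ = ∑ elems (λ y → N d y ℤ.* N d y)
    regroup : ∀ P S v → + 2 ℤ.* P ℤ.* (+ 2 ℤ.* S) ℤ.- (+ 2 ℤ.* v) ℤ.* (+ 2 ℤ.* v) ≡ + 4 ℤ.* (P ℤ.* S) ℤ.- + 4 ℤ.* (v ℤ.* v)
    regroup = ℤSolver.solve-∀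
    finish : ∀ P v → + 4 ℤ.* (P ℤ.* (P ℤ.* v) ℤ.+ (v ℤ.- P) ℤ.* v) ℤ.- + 4 ℤ.* (v ℤ.* v) ≡ (P ℤ.- + 1) ℤ.* (+ 4 ℤ.* (P ℤ.* v))
    finish = ℤSolver.solve-∀
    p-1≢0 : ℤ.NonZero (+ p ℤ.- + 1)
    p-1≢0 = ℤ.≢-nonZero (λ e → ℕₚ.<⇒≢ p>1 (sym (ℤₚ.+-injective (ℤₚ.i-j≡0⇒i≡j (+ p) (+ 1) e))))
    sum₁ : + 2 ℤ.* v ≡ + 2 ℤ.* N d 0# ℤ.+ (P ℤ.- + 1) ℤ.* (N d 1# ℤ.+ N d ν)
    sum₁ = trans (cong (+ 2 ℤ.*_) (trans (sym (∑-N d)) (∑-cong elems (λ y → trans (sym (ℤₚ.*-identityʳ _)) (trans (sym (N-restrict d y (λ _ → + 1))) (cong ([ y ∈V 1 ] ℤ.*_) (ℤₚ.*-identityʳ _)))))))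
      (∑-SquareInvariant (N d) (N-SquareInvariant d))
    sum₂ : + 2 ℤ.* S₂ ≡ + 2 ℤ.* (N d 0# ℤ.* N d 0#) ℤ.+ (P ℤ.- + 1) ℤ.* (N d 1# ℤ.* N d 1# ℤ.+ N d ν ℤ.* N d ν)
    sum₂ = trans (cong (+ 2 ℤ.*_) (∑-cong elems (λ y → sym (N-restrict d y (N d)))))
      (∑-SquareInvariant (λ y → N d y ℤ.* N d y) (λ a y va a≢0 → cong₂ ℤ._*_ (N-SquareInvariant d a y va a≢0) (N-SquareInvariant d a y va a≢0)))

-- Consequences of congruences modulo a prime.

record Congruent (ℓ : ℕ) (x y : ℤ) : Set where
  constructor congruent
  field
    quotient : ℤ
    equation : x ≡ y ℤ.+ + ℓ ℤ.* quotient

Congruent-sub : ∀ {ℓ x x′ y y′} → Congruent ℓ x y → Congruent ℓ x′ y′ → Congruent ℓ (x ℤ.- x′) (y ℤ.- y′)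
Congruent-sub {ℓ} {y = y} {y′} (congruent u refl) (congruent v refl) = congruent (u ℤ.- v) (combine y y′ (+ ℓ) u v)
  where
  combine : ∀ x y l u v → (x ℤ.+ l ℤ.* u) ℤ.- (y ℤ.+ l ℤ.* v) ≡ (x ℤ.- y) ℤ.+ l ℤ.* (u ℤ.- v)
  combine = ℤSolver.solve-∀

Congruent-zero⇒∣ : ∀ {ℓ x y} → Congruent ℓ x y → y ≡ + 0 → ℓ ∣ ℤ.∣ x ∣
Congruent-zero⇒∣ {ℓ} (congruent k eq) refl = divides ℤ.∣ k ∣
  (trans (cong ℤ.∣_∣ (trans eq (ℤₚ.+-identityˡ (+ ℓ ℤ.* k)))) (trans (ℤₚ.abs-* (+ ℓ) k) (ℕₚ.*-comm ℓ ℤ.∣ k ∣)))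

vanishing-by-norm : ∀ {p ℓ} → Prime p → Prime ℓ → 3 ℕ.≤ ℓ → ¬ (ℓ ∣ p) → ∀ h a D →
  a ℤ.* a ℤ.+ + p ℤ.* (D ℤ.* D) ≡ + 4 ℤ.* (+ (p ℕ.^ h) ℤ.* + (p ℕ.^ h)) → ℓ ∣ ℤ.∣ D ∣ → D ≡ + 0
vanishing-by-norm {p} {ℓ} pr ℓ-prime 3≤ℓ ℓ∤p h a D eq ℓ∣D with norm-descent pr h a D eq
... | a′ , D′ , _ , D≡HD′ , eq′ = trans D≡HD′ (trans (cong (+ (p ℕ.^ h) ℤ.*_)
        (small-norm (ℕ.nonTrivial⇒n>1 p {{prime⇒nonTrivial pr}}) 3≤ℓ a′ D′ ℓ∣D′ eq′)) (ℤₚ.*-zeroʳ (+ (p ℕ.^ h))))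
  where
  ℓ∣D′ : ℓ ∣ ℤ.∣ D′ ∣
  ℓ∣D′ with euclidsLemma (p ℕ.^ h) ℤ.∣ D′ ∣ ℓ-prime (subst (ℓ ∣_) (trans (cong ℤ.∣_∣ D≡HD′) (ℤₚ.abs-* (+ (p ℕ.^ h)) D′)) ℓ∣D)
  ... | inj₁ ℓ∣H = contradiction ℓ∣H (prime∤^ ℓ-prime ℓ∤p h)
  ... | inj₂ d   = d

norm⇒square : ∀ N₀ N₁ N₂ P v → N₁ ≡ N₂ →
  ((N₀ ℤ.- N₁) ℤ.+ (N₀ ℤ.- N₂)) ℤ.* ((N₀ ℤ.- N₁) ℤ.+ (N₀ ℤ.- N₂)) ℤ.+ P ℤ.* ((N₂ ℤ.- N₁) ℤ.* (N₂ ℤ.- N₁)) ≡ + 4 ℤ.* (P ℤ.* v) →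
  (N₀ ℤ.- N₁) ℤ.* (N₀ ℤ.- N₁) ≡ P ℤ.* v
norm⇒square N₀ N₁ N₂ P v refl eq = ℤₚ.*-cancelˡ-≡ (+ 4) _ _ (trans (expand N₀ N₁ P) eq)
  where
  expand : ∀ a b P → + 4 ℤ.* ((a ℤ.- b) ℤ.* (a ℤ.- b)) ≡ ((a ℤ.- b) ℤ.+ (a ℤ.- b)) ℤ.* ((a ℤ.- b) ℤ.+ (a ℤ.- b)) ℤ.+ P ℤ.* ((b ℤ.- b) ℤ.* (b ℤ.- b))
  expand = ℤSolver.solve-∀

opposite⇒double : ∀ x x′ → x ℤ.+ x′ ≡ + 0 → + 2 ℤ.* x ≡ x ℤ.- x′
opposite⇒double x x′ eq = trans (split x x′) (trans (cong (λ z → (x ℤ.- x′) ℤ.+ z) eq) (ℤₚ.+-identityʳ _))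
  where
  split : ∀ x y → + 2 ℤ.* x ≡ (x ℤ.- y) ℤ.+ (x ℤ.+ y)
  split = ℤSolver.solve-∀

equal-or-opposite : ∀ x y → x ℤ.* x ≡ y ℤ.* y → x ≡ y ⊎ x ℤ.+ y ≡ + 0
equal-or-opposite x y eq with ℤₚ.i*j≡0⇒i≡0∨j≡0 (x ℤ.- y) {x ℤ.+ y} (trans (factor x y) (ℤₚ.i≡j⇒i-j≡0 eq))
  where
  factor : ∀ x y → (x ℤ.- y) ℤ.* (x ℤ.+ y) ≡ x ℤ.* x ℤ.- y ℤ.* y
  factor = ℤSolver.solve-∀
... | inj₁ e = inj₁ (ℤₚ.i-j≡0⇒i≡j x y e)
... | inj₂ e = inj₂ e

-- The case x = − x′ would make the prime ℓ divide 2x, hence 4x² = 4M.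
congruent-squares⇒equal : ∀ {ℓ} → Prime ℓ → 3 ℕ.≤ ℓ → ∀ x x′ M → ¬ (ℓ ∣ M) →
  x ℤ.* x ≡ + M → x′ ℤ.* x′ ≡ + M → ℓ ∣ ℤ.∣ x ℤ.- x′ ∣ → x ≡ x′
congruent-squares⇒equal {ℓ} ℓ-prime 3≤ℓ x x′ M ℓ∤M x² x′² diff with equal-or-opposite x x′ (trans x² (sym x′²))
... | inj₁ e = e
... | inj₂ opp with euclidsLemma 2 ℤ.∣ x ∣ ℓ-prime (subst (ℓ ∣_) (trans (cong ℤ.∣_∣ (sym (opposite⇒double x x′ opp))) (ℤₚ.abs-* (+ 2) x)) diff)
...   | inj₁ ℓ∣2 = contradiction (∣⇒≤ ℓ∣2) (ℕₚ.<⇒≱ 3≤ℓ)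
...   | inj₂ ℓ∣x = contradiction (subst (ℓ ∣_) (ℤₚ.+-injective (trans (sym (square-abs x)) x²)) (∣-trans ℓ∣x (m∣m*n ℤ.∣ x ∣))) ℓ∤M

-- Value distribution of Q by induction along a prime factorisation of n.

module ValueDistribution {p n : ℕ} {{p≢0 : NonZero p}} (pr : Prime p) (𝔽 : FiniteField p n)
         (n≥1 : 1 ℕ.≤ n) (n⊥p : gcd n p ≡ 1) (p-odd : ¬ (2 ∣ p)) (n-odd : ¬ (2 ∣ n)) where
  open TraceTheory pr 𝔽 n≥1 n⊥p
  open SquareClasses pr 𝔽 n≥1 n⊥p p-odd
  open OrbitCounting pr 𝔽 n≥1 n⊥p
  open ≡-Reasoning
  private
    module C = Counting pr 𝔽 n≥1 n⊥p p-odd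
    module QF = QuadraticForm pr 𝔽 n≥1 n⊥p

  ∣V∣-divisor : ∀ {d} → d ∣ n → ∣V∣ d ≡ + (p ℕ.^ d)
  ∣V∣-divisor {d} (divides zero n≡)       = contradiction n≥1 (ℕₚ.<⇒≱ (subst (ℕ._< 1) (sym n≡) (s≤s z≤n)))
  ∣V∣-divisor {zero} (divides (suc k) n≡) = contradiction n≥1 (ℕₚ.<⇒≱ (subst (ℕ._< 1) (sym (trans n≡ (ℕₚ.*-zeroʳ k))) (s≤s z≤n)))
  ∣V∣-divisor {d@(suc _)} (divides (suc k) n≡) = ∣V∣≡p^d d k (s≤s z≤n) n≡

  odd-divisor-≥3 : ∀ {ℓ} → Prime ℓ → ℓ ∣ n → 3 ℕ.≤ ℓ
  odd-divisor-≥3 {ℓ} ℓ-prime ℓ∣n = ℕₚ.≤∧≢⇒< (ℕ.nonTrivial⇒n>1 ℓ {{prime⇒nonTrivial ℓ-prime}}) (λ { refl → n-odd ℓ∣n })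

  divisor∤p : ∀ {ℓ} → Prime ℓ → ℓ ∣ n → ¬ (ℓ ∣ p)
  divisor∤p {ℓ} ℓ-prime ℓ∣n ℓ∣p = ℕₚ.<⇒≱ (ℕ.nonTrivial⇒n>1 ℓ {{prime⇒nonTrivial ℓ-prime}}) (∣⇒≤ (subst (ℓ ∣_) n⊥p (gcd-greatest ℓ∣n ℓ∣p)))

  module _ (Π : Parameters 𝔽) where
    open C Π using (N; norm-equation; N-SquareInvariant) public
    open QF Π using (Q; Q-φ; Q-V1)

    -- The condition D = 0: with square invariance, N d takes a single value on the nonzero elements
    -- of F_p.
    Flat : ℕ → Set
    Flat d = N d 1# ≡ N d ν

    -- If `Flat d` holds, this is the Gauss sum of Q on V d, because the nontrivial p-th roots of
    -- unity add up to -1.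
    X : ℕ → ℤ
    X d = N d 0# ℤ.- N d 1#

    N-congruence : ∀ {ℓ} → Prime ℓ → ∀ d y → Congruent ℓ (N (ℓ ℕ.* d) y) (N d y)
    N-congruence {zero}  ℓ-prime d y = contradiction (ℕ.nonTrivial⇒n>1 0 {{prime⇒nonTrivial ℓ-prime}}) (λ ())
    N-congruence {suc ℓ-1} ℓ-prime d y =
      let (m , eq) = orbit-congruence d ℓ-1 ℓ-prime (λ x → ind (Q x ≟ y)) (λ x → cong (λ z → ind (z ≟ y)) (Q-φ d x)) in congruent m eq

    N-1-nonzero : ∀ y → y ≢ 0# → N 1 y ≡ + 0
    N-1-nonzero y y≢0 = trans (∑-cong elems vanish) (∑-ε elems)
      where
      vanish : ∀ x → [ x ∈V 1 ] ℤ.* ind (Q x ≟ y) ≡ + 0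
      vanish x with V? 1 x
      ... | no _   = refl
      ... | yes vx = trans (ℤₚ.*-identityˡ _) (when-no (Q x ≟ y) (λ e → y≢0 (trans (sym e) (Q-V1 vx))))

    N-1-0 : N 1 0# ≡ + p
    N-1-0 = trans (∑-cong elems full) ∣V1∣
      where
      full : ∀ x → [ x ∈V 1 ] ℤ.* ind (Q x ≟ 0#) ≡ [ x ∈V 1 ]
      full x with V? 1 x
      ... | no _   = refl
      ... | yes vx = trans (ℤₚ.*-identityˡ _) (ind-yes (Q x ≟ 0#) (Q-V1 vx))

    Flat-1 : Flat 1
    Flat-1 = trans (N-1-nonzero 1# 1≢0) (sym (N-1-nonzero ν ν≢0))

    X-1 : X 1 ≡ + p
    X-1 = trans (cong₂ ℤ._-_ N-1-0 (N-1-nonzero 1# 1≢0)) (ℤₚ.+-identityʳ (+ p))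

    Flat-step : ∀ {ℓ} → Prime ℓ → ∀ d → ℓ ℕ.* d ∣ n → Flat d → Flat (ℓ ℕ.* d)
    Flat-step {ℓ} ℓ-prime d ℓd∣n flat = sym (ℤₚ.i-j≡0⇒i≡j _ _ D≡0)
      where
      e = ℓ ℕ.* d
      ℓ∣n : ℓ ∣ n
      ℓ∣n = ∣-trans (m∣m*n d) ℓd∣n
      D : ℤ
      D = N e ν ℤ.- N e 1#
      ℓ∣D : ℓ ∣ ℤ.∣ D ∣
      ℓ∣D = Congruent-zero⇒∣ (Congruent-sub (N-congruence ℓ-prime d ν) (N-congruence ℓ-prime d 1#)) (ℤₚ.i≡j⇒i-j≡0 (sym flat))
      -- A divisor of the odd n is odd, so p^(e+1) is the square of p^h with h = (e + 1)/2, as the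
      -- descent requires.
      half = odd⇒suc-double e (λ 2∣e → n-odd (∣-trans 2∣e ℓd∣n))
      h = proj₁ half
      size≡ : + p ℤ.* ∣V∣ e ≡ + (p ℕ.^ h) ℤ.* + (p ℕ.^ h)
      size≡ = begin
        + p ℤ.* ∣V∣ e                ≡⟨ cong (+ p ℤ.*_) (∣V∣-divisor ℓd∣n) ⟩
        + p ℤ.* + (p ℕ.^ e)          ≡⟨ sym (ℤₚ.pos-* p (p ℕ.^ e)) ⟩
        + (p ℕ.^ suc e)              ≡⟨ cong (λ m → + (p ℕ.^ m)) (proj₂ half) ⟩
        + (p ℕ.^ (h ℕ.+ h))          ≡⟨ trans (cong +_ (ℕₚ.^-distribˡ-+-* p h h)) (ℤₚ.pos-* (p ℕ.^ h) (p ℕ.^ h)) ⟩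
        + (p ℕ.^ h) ℤ.* + (p ℕ.^ h)  ∎
      D≡0 : D ≡ + 0
      D≡0 = vanishing-by-norm pr ℓ-prime (odd-divisor-≥3 ℓ-prime ℓ∣n) (divisor∤p ℓ-prime ℓ∣n) h
        ((N e 0# ℤ.- N e 1#) ℤ.+ (N e 0# ℤ.- N e ν)) D (trans (norm-equation e) (cong (+ 4 ℤ.*_) size≡)) ℓ∣D

    X-square : ∀ {d} → d ∣ n → Flat d → X d ℤ.* X d ≡ + (p ℕ.^ suc d)
    X-square {d} d∣n flat = trans (norm⇒square (N d 0#) (N d 1#) (N d ν) (+ p) (∣V∣ d) flat (norm-equation d))
      (trans (cong (+ p ℤ.*_) (∣V∣-divisor d∣n)) (sym (ℤₚ.pos-* p (p ℕ.^ d))))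

    X-congruence : ∀ {ℓ} → Prime ℓ → ∀ d → Congruent ℓ (X (ℓ ℕ.* d)) (X d)
    X-congruence ℓ-prime d = Congruent-sub (N-congruence ℓ-prime d 0#) (N-congruence ℓ-prime d 1#)

    Flat-product : ∀ ps → All Prime ps → product ps ∣ n → Flat (product ps)
    Flat-product []       []          _   = Flat-1
    Flat-product (ℓ ∷ ps) (ℓ-prime ∷ primes) d∣n =
      Flat-step ℓ-prime (product ps) d∣n (Flat-product ps primes (∣-trans (n∣m*n ℓ) d∣n))

  -- Both values are ± p^((d+1)/2), and congruent modulo the odd prime ℓ ≠ p.
  X-product : ∀ Π Π′ ps → All Prime ps → product ps ∣ n → X Π (product ps) ≡ X Π′ (product ps)
  X-product Π Π′ []       []                 _   = trans (X-1 Π) (sym (X-1 Π′))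
  X-product Π Π′ (ℓ ∷ ps) (ℓ-prime ∷ primes) e∣n =
    congruent-squares⇒equal ℓ-prime (odd-divisor-≥3 ℓ-prime ℓ∣n) (X Π e) (X Π′ e) (p ℕ.^ suc e)
      (prime∤^ ℓ-prime (divisor∤p ℓ-prime ℓ∣n) (suc e))
      (X-square Π e∣n (Flat-product Π (ℓ ∷ ps) (ℓ-prime ∷ primes) e∣n))
      (X-square Π′ e∣n (Flat-product Π′ (ℓ ∷ ps) (ℓ-prime ∷ primes) e∣n))
      (Congruent-zero⇒∣ (Congruent-sub (X-congruence Π ℓ-prime d) (X-congruence Π′ ℓ-prime d))
        (ℤₚ.i≡j⇒i-j≡0 (X-product Π Π′ ps primes (∣-trans (n∣m*n ℓ) e∣n))))
    where
    d = product ps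
    e = ℓ ℕ.* d
    ℓ∣n : ℓ ∣ n
    ℓ∣n = ∣-trans (m∣m*n d) e∣n

  private
    instance
      n≢0 : NonZero n
      n≢0 = ℕ.>-nonZero n≥1
    open PrimeFactorisation (factorise n) using (factors; isFactorisation; factorsPrime)

    product∣n : product factors ∣ n
    product∣n = ∣-reflexive (sym isFactorisation)

  Flat-n : ∀ Π → Flat Π n
  Flat-n Π = subst (Flat Π) (sym isFactorisation) (Flat-product Π factors factorsPrime product∣n)

  X-n : ∀ Π Π′ → X Π n ≡ X Π′ n
  X-n Π Π′ = subst (λ d → X Π d ≡ X Π′ d) (sym isFactorisation) (X-product Π Π′ factors factorsPrime product∣n)

  X-n-square : ∀ Π → X Π n ℤ.* X Π n ≡ + (p ℕ.^ suc n)
  X-n-square Π = X-square Π ∣-refl (Flat-n Π)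

  N-n : ∀ Π y → V 1 y → N Π n y ≡ N Π n 1# ℤ.+ ind (y ≟ 0#) ℤ.* X Π n
  N-n Π y vy with y ≟ 0#
  ... | yes refl = reassemble (N Π n 0#) (N Π n 1#)
    where
    reassemble : ∀ a b → a ≡ b ℤ.+ + 1 ℤ.* (a ℤ.- b)
    reassemble = ℤSolver.solve-∀
  ... | no y≢0 = trans (N≡N1 (square-dichotomy y vy)) (sym (ℤₚ.+-identityʳ _))
    where
    root≢0 : ∀ μ a → μ * (a * a) ≡ y → a ≢ 0#
    root≢0 μ a e refl = y≢0 (trans (sym e) (trans (cong (λ z → μ * z) (zeroˡ 0#)) (zeroʳ μ)))
    N≡N1 : HasRoot 1# y ⊎ HasRoot ν y → N Π n y ≡ N Π n 1#
    N≡N1 (inj₁ (a , va , e)) = trans (cong (N Π n) (trans (sym e) (*-comm 1# (a * a)))) (N-SquareInvariant Π n a 1# va (root≢0 1# a e))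
    N≡N1 (inj₂ (a , va , e)) = trans (trans (cong (N Π n) (trans (sym e) (*-comm ν (a * a)))) (N-SquareInvariant Π n a ν va (root≢0 ν a e))) (sym (Flat-n Π))

-- Level counts of Q minus a linear form.

module Walsh {p n : ℕ} {{p≢0 : NonZero p}} (pr : Prime p) (𝔽 : FiniteField p n)
         (n≥1 : 1 ℕ.≤ n) (n⊥p : gcd n p ≡ 1) (p-odd : ¬ (2 ∣ p)) (n-odd : ¬ (2 ∣ n)) (Π : Parameters 𝔽) where
  open TraceTheory pr 𝔽 n≥1 n⊥p
  open QuadraticForm pr 𝔽 n≥1 n⊥p Π
  open Parameters Π
  private module D = ValueDistribution pr 𝔽 n≥1 n⊥p p-odd n-odd
  open Solver using (solve; _:=_; _:+_; _:*_; _:-_; :-_; con)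
  open ≡-Reasoning

  ∑-V-n : (f : K → ℤ) → ∑ elems (λ x → [ x ∈V n ] ℤ.* f x) ≡ ∑ elems f
  ∑-V-n f = ∑-cong elems (λ x → trans (cong (ℤ._* f x) (ind-yes (V? n x) (φ-n x))) (ℤₚ.*-identityˡ (f x)))

  ∣V∣-n : ∣V∣ n ≡ q
  ∣V∣-n = trans (∑-cong elems (λ x → ind-yes (V? n x) (φ-n x))) ∑-one

  -- Since Tr (a/n) = a for a in F_p, the trace takes its p values equally often.
  #traceless : + p ℤ.* ∑ elems (λ β → ind (Tr β ≟ 0#)) ≡ q
  #traceless = trans (cong (+ p ℤ.*_) (sym (∑-V-n (λ β → ind (Tr β ≟ 0#)))))
    (trans (equidistribution n Tr (ιℕ n ⁻¹) (φ-n _) V1-Tr shift 0# (V-0 {1})) ∣V∣-n)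
    where
    shift : ∀ a x → V 1 a → Tr (x + a * ιℕ n ⁻¹) ≡ Tr x + a
    shift a x va = trans (Tr-+ _ _) (cong (λ z → Tr x + z) (begin
      Tr (a * ιℕ n ⁻¹)       ≡⟨ Tr-V1 (V-* {1} va (V-⁻¹ {1} ιn≢0 (V1-ιℕ n))) ⟩
      (a * ιℕ n ⁻¹) * ιℕ n   ≡⟨ solve 3 (λ a u v → (a :* u) :* v := a :* (v :* u)) refl a (ιℕ n ⁻¹) (ιℕ n) ⟩
      a * (ιℕ n * ιℕ n ⁻¹)   ≡⟨ trans (cong (λ z → a * z) (inverse _ ιn≢0)) (*-identityʳ a) ⟩
      a                      ∎))

  private
    cL : K → K
    cL x = c * L x

    cL-+ : ∀ x y → cL (x + y) ≡ cL x + cL y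
    cL-+ x y = trans (cong (λ z → c * z) (L-+ x y)) (distribˡ c (L x) (L y))

    open Additive cL cL-+

    #ker : #fibre 0# ≡ + p
    #ker = trans (∑-cong elems (λ x → when-⇔ (cL x ≟ 0#) (V? 1 x) to from)) ∣V1∣
      where
      to : ∀ {x} → cL x ≡ 0# → V 1 x
      to eq with integral eq
      ... | inj₁ c≡0 = contradiction c≡0 c≢0
      ... | inj₂ L≡0 = L≡0⇒V1 L≡0
      from : ∀ {x} → V 1 x → cL x ≡ 0#
      from vx = trans (cong (λ z → c * z) (V1⇒L≡0 vx)) (zeroʳ c)

    Tr-cL : ∀ x → Tr (cL x) ≡ 0#
    Tr-cL x = trans (Tr-scale (L x) c∈F) (trans (cong (λ z → c * z) (Tr-L x)) (zeroʳ c))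

    deficit : K → ℤ
    deficit β = ind (Tr β ≟ 0#) ℤ.* + p ℤ.- #fibre β

    deficit≥0 : ∀ β → + 0 ℤ.≤ deficit β
    deficit≥0 β with Tr β ≟ 0#
    ... | yes _ = ℤₚ.i≤j⇒0≤j-i (subst (#fibre β ℤ.≤_) (trans #ker (sym (ℤₚ.*-identityˡ (+ p)))) (#fibre-≤ β))
    ... | no ¬0 = ℤₚ.≤-reflexive (sym (cong (λ z → + 0 ℤ.- z) (#fibre-miss β (λ { (x , refl) → ¬0 (Tr-cL x) }))))

    ∑-deficit : ∑ elems deficit ≡ + 0
    ∑-deficit = trans (∑-sub elems _ #fibre) (trans (cong₂ ℤ._-_
      (trans (∑-*ʳ elems (+ p) _) (trans (ℤₚ.*-comm _ (+ p)) #traceless)) ∑-#fibre) (ℤₚ.+-inverseʳ q))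

  -- c L maps onto the kernel of the trace: its fibres there have at most
  -- p = #ker elements, and q / p of them have to add up to q.
  traceless⇒image : ∀ β → Tr β ≡ 0# → ∃ λ u → c * L u ≡ β
  traceless⇒image β Trβ≡0 with hit? β
  ... | yes found = found
  ... | no ¬hit = contradiction (ℤₚ.+-injective (begin
      + p                                    ≡⟨ sym (trans (ℤₚ.+-identityʳ _) (ℤₚ.*-identityˡ (+ p))) ⟩
      + 1 ℤ.* + p ℤ.- + 0                    ≡⟨ cong₂ (λ a b → a ℤ.* + p ℤ.- b) (sym (ind-yes (Tr β ≟ 0#) Trβ≡0)) (sym (#fibre-miss β ¬hit)) ⟩
      deficit β                              ≡⟨ ∑≡0⇒each≡0 elems deficit≥0 ∑-deficit (complete β) ⟩
      + 0                                    ∎)) (λ e → ℕₚ.<⇒≱ p>1 (subst (ℕ._≤ 1) (sym e) z≤n))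

  #level : K → K → ℤ
  #level β y = ∑ elems (λ x → ind ((Q x - Tr (β * x)) ≟ y))

  -- Moving x along the radical F_p leaves Q unchanged but moves Tr (β x) through all of F_p.
  level-constant : ∀ β → Tr β ≢ 0# → ∀ y → V 1 y → #level β y ≡ #level β 0#
  level-constant β Trβ≢0 y vy = ℤₚ.*-cancelˡ-≡ (+ p) (#level β y) (#level β 0#) (trans (level y vy) (sym (level 0# (V-0 {1}))))
    where
    h : K → K
    h x = Q x - Tr (β * x)
    v : K
    -- The sign makes up for the minus in h: a step a v changes -Tr (β x) by +a.
    v = - (Tr β ⁻¹)
    v∈V1 : V 1 v
    v∈V1 = V-neg {1} (V-⁻¹ {1} Trβ≢0 (V1-Tr β))
    shift : ∀ a x → V 1 a → h (x + a * v) ≡ h x + a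
    shift a x va = begin
      Q (x + a * v) - Tr (β * (x + a * v))
        ≡⟨ cong₂ _-_ Q-shift (trans (cong Tr (distribˡ β x (a * v))) (Tr-+ _ _)) ⟩
      Q x - (Tr (β * x) + Tr (β * (a * v)))
        ≡⟨ cong (λ z → Q x - (Tr (β * x) + z)) (trans (cong Tr (*-comm β (a * v))) (Tr-scale β av∈V1)) ⟩
      Q x - (Tr (β * x) + (a * v) * Tr β)
        ≡⟨ solve 5 (λ q t a i b → q :- (t :+ (a :* (:- i)) :* b) := (q :- t) :+ a :* (b :* i)) refl (Q x) (Tr (β * x)) a (Tr β ⁻¹) (Tr β) ⟩
      h x + a * (Tr β * Tr β ⁻¹)
        ≡⟨ cong (λ z → h x + z) (trans (cong (λ z → a * z) (inverse _ Trβ≢0)) (*-identityʳ a)) ⟩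
      h x + a ∎
      where
      av∈V1 : V 1 (a * v)
      av∈V1 = V-* {1} va v∈V1
      Q-shift : Q (x + a * v) ≡ Q x
      Q-shift = begin
        Q (x + a * v)                              ≡⟨ polar x (a * v) ⟩
        Q x + Q (a * v) + c * Tr (x * L (a * v))   ≡⟨ cong₂ (λ u w → Q x + u + c * w) (Q-V1 av∈V1) (trans (cong (λ w → Tr (x * w)) (V1⇒L≡0 av∈V1)) (trans (cong Tr (zeroʳ x)) Tr-0)) ⟩
        Q x + 0# + c * 0#                          ≡⟨ solve 2 (λ q c → q :+ con (+ 0) :+ c :* con (+ 0) := q) refl (Q x) c ⟩
        Q x                                        ∎
    level : ∀ y → V 1 y → + p ℤ.* #level β y ≡ ∣V∣ n
    level y vy = trans (cong (+ p ℤ.*_) (sym (∑-V-n _)))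
      (equidistribution n h v (φ-n v) (λ x → V-sub {1} (V1-Q x) (V1-Tr _)) shift y vy)

  -- Writing β = c L u, the shift x ↦ x + u absorbs the linear term and leaves Q x + σ; σ is the
  -- exponent of the root of unity.
  level-peak : ∀ β → Tr β ≡ 0# → ∃ λ σ → V 1 σ × (∀ y → V 1 y → #level β y ≡ D.N Π n 1# ℤ.+ ind (y ≟ σ) ℤ.* D.X Π n)
  level-peak β Trβ≡0 = σ , σ∈V1 , λ y vy → begin
    #level β y
      ≡⟨ sym (∑-permute K-finite (λ x → x + u) (λ x → x - u)
           (λ x → solve 2 (λ x a → (x :- a) :+ a := x) refl x u)
           (λ x → solve 2 (λ x a → (x :+ a) :- a := x) refl x u) _) ⟩
    ∑ elems (λ x → ind ((Q (x + u) - Tr (β * (x + u))) ≟ y))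
      ≡⟨ ∑-cong elems (λ x → when-⇔ ((Q (x + u) - Tr (β * (x + u))) ≟ y) (Q x ≟ (y - σ))
           (λ e → trans (solve 2 (λ a s → a := (a :+ s) :- s) refl (Q x) σ) (cong (λ z → z - σ) (trans (sym (complete-square x)) e)))
           (λ e → trans (complete-square x) (trans (cong (λ z → z + σ) e) (solve 2 (λ a s → (a :- s) :+ s := a) refl y σ)))) ⟩
    ∑ elems (λ x → ind (Q x ≟ (y - σ)))
      ≡⟨ sym (∑-V-n _) ⟩
    D.N Π n (y - σ)
      ≡⟨ D.N-n Π (y - σ) (V-sub {1} vy σ∈V1) ⟩
    D.N Π n 1# ℤ.+ ind ((y - σ) ≟ 0#) ℤ.* D.X Π n
      ≡⟨ cong (λ z → D.N Π n 1# ℤ.+ z ℤ.* D.X Π n) (when-⇔ ((y - σ) ≟ 0#) (y ≟ σ) x-y≡0⇒x≡y x≡y⇒x-y≡0) ⟩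
    D.N Π n 1# ℤ.+ ind (y ≟ σ) ℤ.* D.X Π n ∎
    where
    u : K
    u = proj₁ (traceless⇒image β Trβ≡0)
    cLu≡β : c * L u ≡ β
    cLu≡β = proj₂ (traceless⇒image β Trβ≡0)
    σ : K
    σ = Q u - Tr (β * u)
    σ∈V1 : V 1 σ
    σ∈V1 = V-sub {1} (V1-Q u) (V1-Tr _)
    complete-square : ∀ x → Q (x + u) - Tr (β * (x + u)) ≡ Q x + σ
    complete-square x = begin
      Q (x + u) - Tr (β * (x + u))
        ≡⟨ cong₂ _-_ (polar x u) (trans (cong Tr (distribˡ β x u)) (Tr-+ _ _)) ⟩
      (Q x + Q u + c * Tr (x * L u)) - (Tr (β * x) + Tr (β * u))
        ≡⟨ cong (λ z → (Q x + Q u + c * Tr (x * L u)) - (z + Tr (β * u))) βx ⟩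
      (Q x + Q u + c * Tr (x * L u)) - (c * Tr (x * L u) + Tr (β * u))
        ≡⟨ solve 4 (λ a b t s → (a :+ b :+ t) :- (t :+ s) := a :+ (b :- s)) refl (Q x) (Q u) (c * Tr (x * L u)) (Tr (β * u)) ⟩
      Q x + σ ∎
      where
      βx : Tr (β * x) ≡ c * Tr (x * L u)
      βx = trans (cong (λ z → Tr (z * x)) (sym cLu≡β)) (trans (cong Tr (solve 3 (λ c l x → (c :* l) :* x := c :* (x :* l)) refl c (L u) x)) (Tr-scale _ c∈F))

-- Integer multiples of roots of unity in Z[ε].

module CyclotomicPeaks {p n : ℕ} {{p≢0 : NonZero p}} (pr : Prime p) (𝔽 : FiniteField p n)
         (n≥1 : 1 ℕ.≤ n) (n⊥p : gcd n p ≡ 1) where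
  open TraceTheory pr 𝔽 n≥1 n⊥p
  open Solver using (solve; _:=_; _:+_; _:*_; _:-_; :-_; con)
  open ≡-Reasoning

  -- u represents E ε^s, up to the multiple offset of 1 + ε + … + ε^(p-1) = 0.
  record Peak (E : ℤ) (s : Fin p) (u : Cyc p) : Set where
    constructor mkPeak
    field
      offset : ℤ
      shape  : ∀ j → u j ≡ offset ℤ.+ ind (j Fin.≟ s) ℤ.* E

  -- Zero is represented by the constant vectors only; comparing the entries at the indices of σ and
  -- σ + 1 shows X.
  peak≉0 : ∀ (u : Cyc p) N X σ → V 1 σ → (∀ j → u j ≡ N ℤ.+ ind (ι j ≟ σ) ℤ.* X) → X ≢ + 0 → ¬ (u ≈ᶜ zeroᶜ)
  peak≉0 u N X σ σ∈V1 u≡ X≢0 (C , const) = X≢0 (trans (difference N X) (ℤₚ.i≡j⇒i-j≡0 (begin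
    N ℤ.+ + 1 ℤ.* X  ≡⟨ cong (λ z → N ℤ.+ z ℤ.* X) (sym (ind-yes (ι j ≟ σ) ιj≡)) ⟩
    _                ≡⟨ sym (u≡ j) ⟩
    u j              ≡⟨ trans (const j) (sym (const j′)) ⟩
    u j′             ≡⟨ u≡ j′ ⟩
    _                ≡⟨ cong (λ z → N ℤ.+ z ℤ.* X) (when-no (ι j′ ≟ σ) ιj′≢) ⟩
    N ℤ.+ + 0 ℤ.* X  ∎)))
    where
    j = proj₁ (ι-onto σ σ∈V1)
    ιj≡ = proj₂ (ι-onto σ σ∈V1)
    j′ = proj₁ (ι-onto (σ + 1#) (V-+ {1} σ∈V1 (V-1 {1})))
    ιj′≢ : ι j′ ≢ σ
    ιj′≢ e = 0≢1 (+-cancelˡ σ (trans (+-identityʳ σ) (trans (sym e) (proj₂ (ι-onto (σ + 1#) (V-+ {1} σ∈V1 (V-1 {1})))))))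
    difference : ∀ N X → X ≡ (N ℤ.+ + 1 ℤ.* X) ℤ.- (N ℤ.+ + 0 ℤ.* X)
    difference = ℤSolver.solve-∀

  ι[j⊖-s] : ∀ j s → ι (j ⊖ negF s) ≡ ι j + ι s
  ι[j⊖-s] j s = trans (ι-⊖ j (negF s)) (trans (cong (λ z → ι j - z) (ι-negF s)) (solve 2 (λ a b → a :- (:- b) := a :+ b) refl (ι j) (ι s)))

  private
    to : ∀ j s → j ⊖ negF s ≡ s → j ≡ modp 0
    to j s e = ι-inj (trans (solve 2 (λ a b → a := (a :+ b) :- b) refl (ι j) (ι s))
      (trans (cong (λ z → z - ι s) (trans (sym (ι[j⊖-s] j s)) (cong ι e))) (trans (-‿inverseʳ _) (sym ι-0))))

    from : ∀ j s → j ≡ modp 0 → j ⊖ negF s ≡ s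
    from j s refl = ι-inj (trans (ι[j⊖-s] j s) (trans (cong (λ z → z + ι s) ι-0) (+-identityˡ _)))

  -- Multiplication by ε^(-s) translates the indices and brings the peak to 0.
  ⊛-εpow : ∀ {E s u} → Peak E s u → ∃ λ C → ∀ j → (u ⊛ εpow (negF s)) j ≡ C ℤ.+ ind (j Fin.≟ modp 0) ℤ.* E
  ⊛-εpow {E} {s} {u} (mkPeak C u≡) = C , λ j → begin
    (u ⊛ εpow (negF s)) j
      ≡⟨ foldr≡∑ (allFin p) (λ i → u i ℤ.* εpow (negF s) (j ⊖ i)) ⟩
    ∑ (allFin p) (λ i → u i ℤ.* εpow (negF s) (j ⊖ i))
      ≡⟨ ∑-cong (allFin p) (λ i → trans (cong (u i ℤ.*_) (δ j i)) (ℤₚ.*-comm (u i) _)) ⟩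
    ∑ (allFin p) (λ i → ind (i Fin.≟ (j ⊖ negF s)) ℤ.* u i)
      ≡⟨ ∑-ind (Fin-finite p) (j ⊖ negF s) u ⟩
    u (j ⊖ negF s)
      ≡⟨ u≡ _ ⟩
    C ℤ.+ ind ((j ⊖ negF s) Fin.≟ s) ℤ.* E
      ≡⟨ cong (λ z → C ℤ.+ z ℤ.* E) (when-⇔ ((j ⊖ negF s) Fin.≟ s) (j Fin.≟ modp 0) (to j s) (from j s)) ⟩
    C ℤ.+ ind (j Fin.≟ modp 0) ℤ.* E ∎
    where
    εpow≡ind : ∀ t k → εpow t k ≡ ind (t Fin.≟ k)
    εpow≡ind t k with t Fin.≟ k
    ... | yes _ = refl
    ... | no  _ = refl
    δ : ∀ j i → εpow (negF s) (j ⊖ i) ≡ ind (i Fin.≟ (j ⊖ negF s))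
    δ j i = trans (εpow≡ind (negF s) (j ⊖ i)) (when-⇔ (negF s Fin.≟ (j ⊖ i)) (i Fin.≟ (j ⊖ negF s))
      (λ e → ι-inj (begin
        ι i                       ≡⟨ solve 2 (λ i j → i := j :- (j :- i)) refl (ι i) (ι j) ⟩
        ι j - (ι j - ι i)         ≡⟨ cong (λ z → ι j - z) (trans (sym (ι-⊖ j i)) (trans (cong ι (sym e)) (ι-negF s))) ⟩
        ι j - (- ι s)             ≡⟨ trans (solve 2 (λ a b → a :- (:- b) := a :+ b) refl (ι j) (ι s)) (sym (ι[j⊖-s] j s)) ⟩
        ι (j ⊖ negF s)            ∎))
      (λ e → ι-inj (begin
        ι (negF s)                 ≡⟨ ι-negF s ⟩
        - ι s                      ≡⟨ solve 2 (λ a b → :- b := a :- (a :+ b)) refl (ι j) (ι s) ⟩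
        ι j - (ι j + ι s)          ≡⟨ cong (λ z → ι j - z) (sym (trans (cong ι e) (ι[j⊖-s] j s))) ⟩
        ι j - ι i                  ≡⟨ sym (ι-⊖ j i) ⟩
        ι (j ⊖ i)                  ∎)))

  -- In the product of C Σ ε^i + E ε^s with its conjugate all terms that involve C are constant
  -- vectors, and ε^s ε^(-s) puts E² at index 0. The factor p C + E is the sum of the entries of u.
  ⊛-conj : ∀ {E s u} → Peak E s u → ∃ λ C → ∀ j → (u ⊛ conj u) j ≡ C ℤ.+ ind (j Fin.≟ modp 0) ℤ.* (E ℤ.* E)
  ⊛-conj {E} {s} {u} (mkPeak C u≡) = (+ p ℤ.* C ℤ.+ E) ℤ.* C ℤ.+ C ℤ.* E , λ j → begin
    (u ⊛ conj u) j
      ≡⟨ foldr≡∑ (allFin p) (λ i → u i ℤ.* u (negF (j ⊖ i))) ⟩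
    ∑ (allFin p) (λ i → u i ℤ.* u (negF (j ⊖ i)))
      ≡⟨ ∑-cong (allFin p) (λ i → cong (u i ℤ.*_) (trans (u≡ _) (cong (λ z → C ℤ.+ z ℤ.* E) (δ j i)))) ⟩
    ∑ (allFin p) (λ i → u i ℤ.* (C ℤ.+ ind (i Fin.≟ (j ⊖ negF s)) ℤ.* E))
      ≡⟨ ∑-cong (allFin p) (λ i → expand (u i) C (ind (i Fin.≟ (j ⊖ negF s))) E) ⟩
    ∑ (allFin p) (λ i → u i ℤ.* C ℤ.+ ind (i Fin.≟ (j ⊖ negF s)) ℤ.* (u i ℤ.* E))
      ≡⟨ trans (∑-∙ (allFin p) _ _) (cong₂ ℤ._+_ (trans (∑-*ʳ (allFin p) C u) (cong (ℤ._* C) ∑u)) (∑-ind (Fin-finite p) (j ⊖ negF s) (λ i → u i ℤ.* E))) ⟩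
    (+ p ℤ.* C ℤ.+ E) ℤ.* C ℤ.+ u (j ⊖ negF s) ℤ.* E
      ≡⟨ cong (λ z → (+ p ℤ.* C ℤ.+ E) ℤ.* C ℤ.+ z ℤ.* E) (trans (u≡ _) (cong (λ z → C ℤ.+ z ℤ.* E) (when-⇔ ((j ⊖ negF s) Fin.≟ s) (j Fin.≟ modp 0) (to j s) (from j s)))) ⟩
    (+ p ℤ.* C ℤ.+ E) ℤ.* C ℤ.+ (C ℤ.+ ind (j Fin.≟ modp 0) ℤ.* E) ℤ.* E
      ≡⟨ regroup ((+ p ℤ.* C ℤ.+ E) ℤ.* C) C (ind (j Fin.≟ modp 0)) E ⟩
    ((+ p ℤ.* C ℤ.+ E) ℤ.* C ℤ.+ C ℤ.* E) ℤ.+ ind (j Fin.≟ modp 0) ℤ.* (E ℤ.* E) ∎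
    where
    expand : ∀ u C d E → u ℤ.* (C ℤ.+ d ℤ.* E) ≡ u ℤ.* C ℤ.+ d ℤ.* (u ℤ.* E)
    expand = ℤSolver.solve-∀
    regroup : ∀ A C d E → A ℤ.+ (C ℤ.+ d ℤ.* E) ℤ.* E ≡ (A ℤ.+ C ℤ.* E) ℤ.+ d ℤ.* (E ℤ.* E)
    regroup = ℤSolver.solve-∀
    ∑u : ∑ (allFin p) u ≡ + p ℤ.* C ℤ.+ E
    ∑u = trans (∑-cong (allFin p) u≡) (trans (∑-∙ (allFin p) _ _) (cong₂ ℤ._+_ (∑-Fin-const p C) (∑-ind (Fin-finite p) s (λ _ → E))))
    ι-neg⊖ : ∀ i j → ι (negF (j ⊖ i)) ≡ ι i - ι j
    ι-neg⊖ i j = trans (ι-negF (j ⊖ i)) (trans (cong -_ (ι-⊖ j i)) (solve 2 (λ i j → :- (j :- i) := i :- j) refl (ι i) (ι j)))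
    δ : ∀ j i → ind (negF (j ⊖ i) Fin.≟ s) ≡ ind (i Fin.≟ (j ⊖ negF s))
    δ j i = when-⇔ (negF (j ⊖ i) Fin.≟ s) (i Fin.≟ (j ⊖ negF s))
      (λ e → ι-inj (begin
        ι i                       ≡⟨ solve 2 (λ i j → i := j :+ (i :- j)) refl (ι i) (ι j) ⟩
        ι j + (ι i - ι j)         ≡⟨ cong (λ z → ι j + z) (trans (sym (ι-neg⊖ i j)) (cong ι e)) ⟩
        ι j + ι s                 ≡⟨ sym (ι[j⊖-s] j s) ⟩
        ι (j ⊖ negF s)            ∎))
      (λ e → ι-inj (trans (ι-neg⊖ i j) (trans (cong (λ z → z - ι j) (trans (cong ι e) (ι[j⊖-s] j s))) (solve 2 (λ a b → (a :+ b) :- a := b) refl (ι j) (ι s)))))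

  peak⇒norm : ∀ E s u M → E ℤ.* E ≡ + M → Peak E s u → (u ⊛ conj u) ≈ᶜ intᶜ M
  peak⇒norm E s u M E²≡M pk = proj₁ (⊛-conj pk) , λ j →
    trans (proj₂ (⊛-conj pk) j) (trans (ℤₚ.+-comm (proj₁ (⊛-conj pk)) _) (cong (λ z → z ℤ.+ proj₁ (⊛-conj pk)) (spike j)))
    where
    spike : ∀ j → ind (j Fin.≟ modp 0) ℤ.* (E ℤ.* E) ≡ intᶜ M j
    spike j with j Fin.≟ modp 0
    ... | yes _ = trans (ℤₚ.*-identityˡ (E ℤ.* E)) E²≡M
    ... | no _  = refl

  peaks⇒≈ : ∀ E s u s′ u′ → Peak E s u → Peak E s′ u′ → (u ⊛ εpow (negF s)) ≈ᶜ (u′ ⊛ εpow (negF s′))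
  peaks⇒≈ E s u s′ u′ pk pk′ = C ℤ.- C′ , λ j →
    trans (proj₂ (⊛-εpow pk) j) (trans (rebase C C′ (ind (j Fin.≟ modp 0) ℤ.* E)) (cong (λ z → z ℤ.+ (C ℤ.- C′)) (sym (proj₂ (⊛-εpow pk′) j))))
    where
    C = proj₁ (⊛-εpow pk)
    C′ = proj₁ (⊛-εpow pk′)
    rebase : ∀ C C₀ x → C ℤ.+ x ≡ (C₀ ℤ.+ x) ℤ.+ (C ℤ.- C₀)
    rebase = ℤSolver.solve-∀

-- Lagrange interpolation in y.

module Interpolation {p n : ℕ} {{p≢0 : NonZero p}} (pr : Prime p) (𝔽 : FiniteField p n)
                     (n≥1 : 1 ℕ.≤ n) (n⊥p : gcd n p ≡ 1) where
  open TraceTheory pr 𝔽 n≥1 n⊥p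
  open Solver using (solve; _:=_; _:+_; _:*_; _:-_; :-_; con)
  open ≡-Reasoning

  sumK≡∑ : {A : Set} (g : A → K) (xs : List A) → sumK (map g xs) ≡ ∑+.∑ xs g
  sumK≡∑ g []       = refl
  sumK≡∑ g (x ∷ xs) = cong (λ z → g x + z) (sumK≡∑ g xs)

  prodK≡∏ : {A : Set} {P : A → Set} (P? : Decidable P) (g : A → K) (xs : List A) →
            prodK (map g (filter P? xs)) ≡ ∑*.∑ xs (λ x → ∑*.when (P? x) (g x))
  prodK≡∏ P? g []       = refl
  prodK≡∏ P? g (x ∷ xs) with P? x
  ... | yes _ = cong (λ z → g x * z) (prodK≡∏ P? g xs)
  ... | no _  = trans (prodK≡∏ P? g xs) (sym (*-identityˡ _))

  ∏-zero : {A : Set} (g : A → K) {xs : List A} {a : A} → a ∈ xs → g a ≡ 0# → ∑*.∑ xs g ≡ 0#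
  ∏-zero g {x ∷ xs} (here refl) ga≡0 = trans (cong (λ z → z * ∑*.∑ xs g) ga≡0) (zeroˡ _)
  ∏-zero g {x ∷ xs} (there a∈)  ga≡0 = trans (cong (λ z → g x * z) (∏-zero g a∈ ga≡0)) (zeroʳ _)

  ∏-nonzero : {A : Set} (g : A → K) (xs : List A) → (∀ x → g x ≢ 0#) → ∑*.∑ xs g ≢ 0#
  ∏-nonzero g []       g≢0 = 0≢1 ∘ sym
  ∏-nonzero g (x ∷ xs) g≢0 = *-nonzero (g≢0 x) (∏-nonzero g xs g≢0)

  ∏-V1 : {A : Set} (g : A → K) (xs : List A) → (∀ x → V 1 (g x)) → V 1 (∑*.∑ xs g)
  ∏-V1 g []       g∈V = V-1 {1}
  ∏-V1 g (x ∷ xs) g∈V = V-* {1} (g∈V x) (∏-V1 g xs g∈V)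

  -- Index 0 contributes the neutral factor 1, so the product ω is (p - 1)! in F_p.
  factor : Fin p → K
  factor i = ∑*.when (¬? (i Fin.≟ modp 0)) (ι i)

  ω κ : K
  ω = ∑*.∑ (allFin p) factor
  κ = ιℕ (p ∸ 1) * ω

  factor≢0 : ∀ i → factor i ≢ 0#
  factor≢0 i with i Fin.≟ modp 0
  ... | yes _  = 0≢1 ∘ sym
  ... | no i≢0 = λ e → i≢0 (ι-inj (trans e (sym ι-0)))

  factor∈V1 : ∀ i → V 1 (factor i)
  factor∈V1 i with i Fin.≟ modp 0
  ... | yes _ = V-1 {1}
  ... | no _  = V1-ι i

  κ≢0 : κ ≢ 0#
  κ≢0 = *-nonzero (λ e → ℕₚ.<⇒≱ (ℕₚ.∸-monoʳ-< {p} {1} {0} (s≤s z≤n) (ℕₚ.<⇒≤ p>1))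
          (∣⇒≤ {{ℕ.>-nonZero (ℕₚ.m<n⇒0<n∸m p>1)}} (ιℕ≡0⇒p∣ (p ∸ 1) e))) (∏-nonzero factor (allFin p) factor≢0)

  κ∈V1 : V 1 κ
  κ∈V1 = V-* {1} (V1-ιℕ (p ∸ 1)) (∏-V1 factor (allFin p) factor∈V1)

  private
    lagrange : Fin p → Fin p → K
    lagrange y k = prodK (map (λ j → ι y - ι j) (filter (λ j → ¬? (j Fin.≟ k)) (allFin p)))

    -- The involution j ↦ y - j carries the indices j ≠ y to the nonzero ones, so the value does not
    -- depend on y.
    lagrange-diag : ∀ y → lagrange y y ≡ ω
    lagrange-diag y = begin
      lagrange y y
        ≡⟨ prodK≡∏ (λ j → ¬? (j Fin.≟ y)) (λ j → ι y - ι j) (allFin p) ⟩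
      ∑*.∑ (allFin p) (λ j → ∑*.when (¬? (j Fin.≟ y)) (ι y - ι j))
        ≡⟨ ∑*.∑-cong (allFin p) (λ j → trans (∑*.when-⇔ (¬? (j Fin.≟ y)) (¬? ((y ⊖ j) Fin.≟ modp 0))
             (λ j≢y e → j≢y (ι-inj (sym (x-y≡0⇒x≡y (trans (sym (ι-⊖ y j)) (trans (cong ι e) ι-0))))))
             (λ ≢0 e → ≢0 (ι-inj (trans (ι-⊖ y j) (trans (x≡y⇒x-y≡0 (cong ι (sym e))) (sym ι-0))))))
             (cong (∑*.when (¬? ((y ⊖ j) Fin.≟ modp 0))) (sym (ι-⊖ y j)))) ⟩
      ∑*.∑ (allFin p) (λ j → factor (y ⊖ j))
        ≡⟨ ∑*.∑-reindex (Fin-finite p) (Fin-finite p) (y ⊖_) (y ⊖_) invol invol factor ⟩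
      ω ∎
      where
      invol : ∀ i → y ⊖ (y ⊖ i) ≡ i
      invol i = ι-inj (trans (ι-⊖ y (y ⊖ i)) (trans (cong (λ z → ι y - z) (ι-⊖ y i)) (solve 2 (λ y i → y :- (y :- i) := i) refl (ι y) (ι i))))

    lagrange-off : ∀ y k → k ≢ y → lagrange y k ≡ 0#
    lagrange-off y k k≢y = trans (prodK≡∏ (λ j → ¬? (j Fin.≟ k)) (λ j → ι y - ι j) (allFin p))
      (∏-zero _ (∈-allFin y) (trans (∑*.when-yes (¬? (y Fin.≟ k)) (k≢y ∘ sym)) (-‿inverseʳ (ι y))))

  -- κ = 1 by Wilson's theorem, but only κ ∈ F_p^* matters.
  Fgen≡κ* : ∀ (f : Fin p → K → K) x y → Fgen f x y ≡ κ * f y x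
  Fgen≡κ* f x y = begin
    ιℕ (p ∸ 1) * sumK (map (λ k → lagrange y k * f k x) (allFin p))
      ≡⟨ cong (λ z → ιℕ (p ∸ 1) * z) (sumK≡∑ _ (allFin p)) ⟩
    ιℕ (p ∸ 1) * ∑+.∑ (allFin p) (λ k → lagrange y k * f k x)
      ≡⟨ cong (λ z → ιℕ (p ∸ 1) * z) (∑+.∑-cong (allFin p) select) ⟩
    ιℕ (p ∸ 1) * ∑+.∑ (allFin p) (λ k → ∑+.when (k Fin.≟ y) (ω * f k x))
      ≡⟨ cong (λ z → ιℕ (p ∸ 1) * z) (∑+.∑-delta (Fin-finite p) y (λ k → ω * f k x)) ⟩
    ιℕ (p ∸ 1) * (ω * f y x)
      ≡⟨ sym (*-assoc _ _ _) ⟩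
    κ * f y x ∎
    where
    select : ∀ k → lagrange y k * f k x ≡ ∑+.when (k Fin.≟ y) (ω * f k x)
    select k with k Fin.≟ y
    ... | yes refl = cong (λ z → z * f k x) (lagrange-diag k)
    ... | no k≢y   = trans (cong (λ z → z * f k x) (lagrange-off y k k≢y)) (zeroˡ _)

-- Assembly of the Walsh coefficients of F.

choose : {P A : Set} → Dec P → A → A → A
choose (yes _) a b = a
choose (no _)  a b = b

choose-yes : {P A : Set} (d : Dec P) {a b : A} → P → choose d a b ≡ a
choose-yes (yes _) _ = refl
choose-yes (no ¬p) p = contradiction p ¬p

choose-no : {P A : Set} (d : Dec P) {a b : A} → ¬ P → choose d a b ≡ b
choose-no (yes p) ¬p = contradiction p ¬p
choose-no (no _)  _  = refl

∑-peak : ∀ {m} (g base : Fin m → ℤ) k X → g k ≡ base k ℤ.+ X → (∀ y → y ≢ k → g y ≡ base y) →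
         ∑ (allFin m) g ≡ ∑ (allFin m) base ℤ.+ X
∑-peak {m} g base k X at off = trans (∑-cong (allFin m) split)
  (trans (∑-∙ (allFin m) _ _) (cong (λ z → ∑ (allFin m) base ℤ.+ z) (∑-ind (Fin-finite m) k (λ _ → X))))
  where
  split : ∀ y → g y ≡ base y ℤ.+ ind (y Fin.≟ k) ℤ.* X
  split y with y Fin.≟ k
  ... | yes refl = trans at (cong (λ z → base y ℤ.+ z) (sym (ℤₚ.*-identityˡ X)))
  ... | no y≢k   = trans (off y y≢k) (sym (ℤₚ.+-identityʳ _))

module Main {p n : ℕ} {{p≢0 : NonZero p}} (pr : Prime p) (p-odd : ¬ (2 ∣ p)) (n-odd : ¬ (2 ∣ n)) (n≥1 : 1 ℕ.≤ n)
  (𝔽 : FiniteField p n) (c : Fin p → Fin p) (c≢0 : ∀ k → ¬ (toℕ (c k) ≡ 0)) (r t : Fin p → ℕ)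
  (n⊥r+t : ∀ k → gcd n (r k ℕ.+ t k) ≡ 1) (n⊥r-t : ∀ k → gcd n ∣ r k - t k ∣ ≡ 1) (n⊥p : gcd n p ≡ 1)
  (b : Fin p → FiniteField.K 𝔽)
  (disjoint : ∀ i j → ¬ (i ≡ j) → ∀ β →
    ¬ (FF.InSupp 𝔽 (FF.ffun 𝔽 (c i) (r i) (t i) (b i)) β × FF.InSupp 𝔽 (FF.ffun 𝔽 (c j) (r j) (t j) (b j)) β)) where
  open TraceTheory pr 𝔽 n≥1 n⊥p
  open Interpolation pr 𝔽 n≥1 n⊥p
  open CyclotomicPeaks pr 𝔽 n≥1 n⊥p
  open Solver using (solve; _:=_; _:+_; _:*_; _:-_; :-_; con)
  open ≡-Reasoning
  module D = ValueDistribution pr 𝔽 n≥1 n⊥p p-odd n-odd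
  module W = Walsh pr 𝔽 n≥1 n⊥p p-odd n-odd

  f : Fin p → K → K
  f k = ffun (c k) (r k) (t k) (b k)

  ιc≢0 : ∀ k → ι (c k) ≢ 0#
  ιc≢0 k e = c≢0 k (trans (cong toℕ (ι-inj (trans e (sym ι-0)))) (trans (Finₚ.toℕ-fromℕ< _) (ℕₚ.n≤0⇒n≡0 (m%n≤m 0 p))))

  -- Two uses: s = 1 gives the functions f_k of the disjointness hypothesis, s = κ the slices F(·,
  -- k). The factor s goes into the scalar c, which is why `Parameters` takes c in K.
  module Scaled (s : K) (s∈V1 : V 1 s) (s≢0 : s ≢ 0#) where
    Π : Fin p → Parameters 𝔽
    Π k = record { c = s * ι (c k) ; r = r k ; t = t k ; c∈F = V-* {1} s∈V1 (V1-ι (c k)) ; c≢0 = *-nonzero s≢0 (ιc≢0 k)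
                 ; n⊥r+t = n⊥r+t k ; n⊥∣r-t∣ = n⊥r-t k }

    β : Fin p → K → K
    β k a = a - s * b k

    Tr-β : ∀ k a → Tr (β k a) ≡ Tr a - s * Tr (b k)
    Tr-β k a = trans (Tr-sub a (s * b k)) (cong (λ z → Tr a - z) (Tr-scale (b k) s∈V1))

    f≡Q : ∀ k a x → s * f k x - Tr (a * x) ≡ QuadraticForm.Q pr 𝔽 n≥1 n⊥p (Π k) x - Tr (β k a * x)
    f≡Q k a x = begin
      s * (ι (c k) * Tr (pow x (p ℕ.^ r k ℕ.+ 1) - pow x (p ℕ.^ t k ℕ.+ 1)) + Tr (b k * x)) - Tr (a * x)
        ≡⟨ cong (λ z → s * (ι (c k) * z + Tr (b k * x)) - Tr (a * x)) (trans (cong₂ (λ u v → Tr (u - v)) (pow+1 (r k)) (pow+1 (t k))) (Tr-sub _ _)) ⟩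
      s * (ι (c k) * (Tr (φ (r k) x * x) - Tr (φ (t k) x * x)) + Tr (b k * x)) - Tr (a * x)
        ≡⟨ solve 5 (λ s c q u v → s :* (c :* q :+ u) :- v := (s :* c) :* q :- (v :- s :* u)) refl s (ι (c k)) _ _ _ ⟩
      (s * ι (c k)) * (Tr (φ (r k) x * x) - Tr (φ (t k) x * x)) - (Tr (a * x) - s * Tr (b k * x))
        ≡⟨ cong (λ z → (s * ι (c k)) * (Tr (φ (r k) x * x) - Tr (φ (t k) x * x)) - z)
             (trans (cong (λ z → Tr (a * x) - z) (sym (Tr-scale (b k * x) s∈V1))) (trans (sym (Tr-sub _ _)) (cong Tr (solve 4 (λ a s b x → a :* x :- s :* (b :* x) := (a :- s :* b) :* x) refl a s (b k) x)))) ⟩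
      (s * ι (c k)) * (Tr (φ (r k) x * x) - Tr (φ (t k) x * x)) - Tr (β k a * x) ∎
      where
      pow+1 : ∀ i → pow x (p ℕ.^ i ℕ.+ 1) ≡ φ i x * x
      pow+1 i = trans (pow-+ x (p ℕ.^ i) 1) (cong (λ z → φ i x * z) (*-identityʳ x))

  k₀ : Fin p
  k₀ = modp 0

  module S1 = Scaled 1# (V-1 {1}) (0≢1 ∘ sym)
  module Sκ = Scaled κ κ∈V1 κ≢0

  -- The common Gauss sum; by `X-n` it does not depend on the parameters, and `k₀` is an arbitrary
  -- reference index.
  E : ℤ
  E = D.X (Sκ.Π k₀) n

  E-square : E ℤ.* E ≡ + (p ℕ.^ suc n)
  E-square = D.X-n-square (Sκ.Π k₀)

  E≢0 : E ≢ + 0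
  E≢0 E≡0 = ℕₚ.<⇒≢ (ℕₚ.m^n>0 p (suc n)) (ℤₚ.+-injective (trans (sym (cong₂ ℤ._*_ E≡0 E≡0)) E-square))

  walsh≡level : ∀ k a j → walsh (f k) a j ≡ W.#level (S1.Π k) (S1.β k a) (ι j)
  walsh≡level k a j = trans (∑-ind-filter (λ x → (f k x - Tr (a * x)) ≟ ι j) elems)
    (∑-cong elems (λ x → cong (λ z → ind (z ≟ ι j)) (trans (cong (λ z → z - Tr (a * x)) (sym (*-identityˡ (f k x)))) (S1.f≡Q k a x))))

  -- The coefficient is a peak whose height has square p^(n+1), hence is nonzero.
  support : ∀ k a → Tr a ≡ Tr (b k) → InSupp (f k) a
  support k a eq = peak≉0 (walsh (f k) a) (D.N (S1.Π k) n 1#) (D.X (S1.Π k) n) (proj₁ pk) (proj₁ (proj₂ pk))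
    (λ j → trans (walsh≡level k a j) (proj₂ (proj₂ pk) (ι j) (V1-ι j)))
    (λ X≡0 → E≢0 (trans (D.X-n (Sκ.Π k₀) (S1.Π k)) X≡0))
    where
    pk = W.level-peak (S1.Π k) (S1.β k a) (trans (S1.Tr-β k a) (x≡y⇒x-y≡0 (trans eq (sym (*-identityˡ _)))))

  -- If two traces agreed, the point `b i` would lie in both supports. The factor κ is kept because
  -- slice k of F peaks where Tr a = κ Tr (b k).
  Tr-b-injective : ∀ {i j} → κ * Tr (b i) ≡ κ * Tr (b j) → i ≡ j
  Tr-b-injective {i} {j} eq with i Fin.≟ j
  ... | yes i≡j = i≡j
  ... | no i≢j  = contradiction (support i (b i) refl , support j (b i) (*-cancelˡ κ κ≢0 eq)) (disjoint i j i≢j (b i))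

  -- The p distinct values κ Tr (b k) exhaust F_p, so every a has a slice with a peak.
  active : ∀ a → ∃ λ k → κ * Tr (b k) ≡ Tr a
  active a = injective⇒onto-V1 (λ k → κ * Tr (b k)) (λ k → V-* {1} κ∈V1 (V1-Tr (b k))) Tr-b-injective (Tr a) (V1-Tr a)

  F : K → Fin p → K
  F = Fgen f

  -- The pairs are sorted by y; the term -d y of the exponent only shifts the level at which slice y
  -- is read.
  walsh₂≡∑level : ∀ a d j → walsh₂ F a d j ≡ ∑ (allFin p) (λ y → W.#level (Sκ.Π y) (Sκ.β y a) (ι j + ι d * ι y))
  walsh₂≡∑level a d j = begin
    walsh₂ F a d j
      ≡⟨ ∑-ind-filter (λ xy → (F (proj₁ xy) (proj₂ xy) - Tr (a * proj₁ xy) - ι d * ι (proj₂ xy)) ≟ ι j) pairs ⟩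
    ∑ pairs (λ xy → ind ((F (proj₁ xy) (proj₂ xy) - Tr (a * proj₁ xy) - ι d * ι (proj₂ xy)) ≟ ι j))
      ≡⟨ ∑-pairs elems (allFin p) _ ⟩
    ∑ elems (λ x → ∑ (allFin p) (λ y → ind ((F x y - Tr (a * x) - ι d * ι y) ≟ ι j)))
      ≡⟨ ∑-swap elems (allFin p) _ ⟩
    ∑ (allFin p) (λ y → ∑ elems (λ x → ind ((F x y - Tr (a * x) - ι d * ι y) ≟ ι j)))
      ≡⟨ ∑-cong (allFin p) (λ y → ∑-cong elems (λ x → when-⇔ ((F x y - Tr (a * x) - ι d * ι y) ≟ ι j) ((Qy y x - Tr (Sκ.β y a * x)) ≟ (ι j + ι d * ι y))
           (λ e → trans (sym (F≡Q x y)) (trans (solve 2 (λ u v → u := (u :- v) :+ v) refl (F x y - Tr (a * x)) (ι d * ι y)) (cong (λ z → z + ι d * ι y) e)))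
           (λ e → trans (cong (λ z → z - ι d * ι y) (trans (F≡Q x y) e)) (solve 2 (λ u v → (u :+ v) :- v := u) refl (ι j) (ι d * ι y))))) ⟩
    ∑ (allFin p) (λ y → W.#level (Sκ.Π y) (Sκ.β y a) (ι j + ι d * ι y)) ∎
    where
    Qy : Fin p → K → K
    Qy y = QuadraticForm.Q pr 𝔽 n≥1 n⊥p (Sκ.Π y)
    F≡Q : ∀ x y → F x y - Tr (a * x) ≡ Qy y x - Tr (Sκ.β y a * x)
    F≡Q x y = trans (cong (λ z → z - Tr (a * x)) (Fgen≡κ* f x y)) (Sκ.f≡Q y a x)

  peak : ∀ a d → ∃ λ s → Peak E s (walsh₂ F a d)
  peak a d = s , mkPeak (∑ (allFin p) base) λ j → trans (walsh₂≡∑level a d j)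
    (∑-peak (λ y → W.#level (Sκ.Π y) (Sκ.β y a) (ι j + ι d * ι y)) base k (ind (j Fin.≟ s) ℤ.* E) (at-k j) (off-k j))
    where
    k : Fin p
    k = proj₁ (active a)
    κTrb≡Tra : κ * Tr (b k) ≡ Tr a
    κTrb≡Tra = proj₂ (active a)
    pk = W.level-peak (Sκ.Π k) (Sκ.β k a) (trans (Sκ.Tr-β k a) (x≡y⇒x-y≡0 (sym κTrb≡Tra)))
    σ : K
    σ = proj₁ pk
    -- Slice k is read at level j + d k, so its peak σ appears at j = σ - d k; this index is the
    -- value of F* at (a, d).
    σ-k = ι-onto (σ - ι d * ι k) (V-sub {1} (proj₁ (proj₂ pk)) (V-* {1} (V1-ι d) (V1-ι k)))
    s : Fin p
    s = proj₁ σ-k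
    arg∈V1 : ∀ j y → V 1 (ι j + ι d * ι y)
    arg∈V1 j y = V-+ {1} (V1-ι j) (V-* {1} (V1-ι d) (V1-ι y))
    -- What each slice contributes at every j: the offset of the peak for y = k, the constant level
    -- for y ≠ k.
    base : Fin p → ℤ
    base y = choose (y Fin.≟ k) (D.N (Sκ.Π k) n 1#) (W.#level (Sκ.Π y) (Sκ.β y a) 0#)
    at-k : ∀ j → W.#level (Sκ.Π k) (Sκ.β k a) (ι j + ι d * ι k) ≡ base k ℤ.+ ind (j Fin.≟ s) ℤ.* E
    at-k j = trans (proj₂ (proj₂ pk) _ (arg∈V1 j k)) (cong₂ ℤ._+_ (sym (choose-yes (k Fin.≟ k) refl)) (cong₂ ℤ._*_
      (when-⇔ ((ι j + ι d * ι k) ≟ σ) (j Fin.≟ s)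
        (λ e → ι-inj (trans (solve 2 (λ u v → u := (u :+ v) :- v) refl (ι j) (ι d * ι k)) (trans (cong (λ z → z - ι d * ι k) e) (sym (proj₂ σ-k)))))
        (λ e → trans (cong (λ z → z + ι d * ι k) (trans (cong ι e) (proj₂ σ-k))) (solve 2 (λ u v → (u :- v) :+ v := u) refl σ (ι d * ι k))))
      (D.X-n (Sκ.Π k) (Sκ.Π k₀))))
    off-k : ∀ j y → y ≢ k → W.#level (Sκ.Π y) (Sκ.β y a) (ι j + ι d * ι y) ≡ base y
    off-k j y y≢k = trans (W.level-constant (Sκ.Π y) (Sκ.β y a)
      (λ e → y≢k (Tr-b-injective (trans (sym (x-y≡0⇒x≡y (trans (sym (Sκ.Tr-β y a)) e))) (sym κTrb≡Tra)))) _ (arg∈V1 j y))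
      (sym (choose-no (y Fin.≟ k) y≢k))

  abstract
    F* : K → Fin p → Fin p
    F* a d = proj₁ (peak a d)

    F*-peak : ∀ a d → Peak E (F* a d) (walsh₂ F a d)
    F*-peak a d = proj₂ (peak a d)

  bent : Bent F
  bent a d = peak⇒norm E (F* a d) (walsh₂ F a d) (p ℕ.^ suc n) E-square (F*-peak a d)

  weaklyRegular : WeaklyRegular F
  weaklyRegular = bent , F* , λ a d →
    peaks⇒≈ E (F* a d) (walsh₂ F a d) (F* 0# (modp 0)) (walsh₂ F 0# (modp 0)) (F*-peak a d) (F*-peak 0# (modp 0))

open import Data.Nat using (_+_; _≥_)

theorem8 : (p n : ℕ) → {{_ : NonZero p}} → Prime p → ¬ (2 ∣ p) → ¬ (2 ∣ n) → n ≥ 1 →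
  (𝔽 : FiniteField p n) →
  (c : Fin p → Fin p) → (∀ k → ¬ (toℕ (c k) ≡ 0)) →
  (r t : Fin p → ℕ) →
  (∀ k → gcd n (r k + t k) ≡ 1) → (∀ k → gcd n ∣ r k - t k ∣ ≡ 1) → gcd n p ≡ 1 →
  (b : Fin p → FiniteField.K 𝔽) →
  (∀ i j → ¬ (i ≡ j) → ∀ β →
    ¬ (FF.InSupp 𝔽 (FF.ffun 𝔽 (c i) (r i) (t i) (b i)) β
       × FF.InSupp 𝔽 (FF.ffun 𝔽 (c j) (r j) (t j) (b j)) β)) →
  FF.WeaklyRegular 𝔽 (FF.Fgen 𝔽 (λ k → FF.ffun 𝔽 (c k) (r k) (t k) (b k)))
theorem8 p n pr p-odd n-odd n≥1 𝔽 c c≢0 r t n⊥r+t n⊥r-t n⊥p b disjoint =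
  Main.weaklyRegular pr p-odd n-odd n≥1 𝔽 c c≢0 r t n⊥r+t n⊥r-t n⊥p b disjoint
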